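{- For every integer $n\ge 7$, $\mathrm{sat}_{\mathsf g}(n)\le \frac78\cdot 2^{n-2}\le \frac78\cdot \mathrm{ram}_{\mathsf g}(n)$.
   Context: Points in the plane are in general position if no three are collinear. A planar point set is $n$-gon-free if it contains no $n$ points in convex position. $\mathrm{ram}_{\mathsf g}(n)$ is the maximum size of a planar point set in general position that is $n$-gon-free. A planar point set $P$ in general position is $n$-gon-saturated if it is $n$-gon-free and for every point $q\notin P$ such that $P\cup\{q\}$ is in general position, $q$ belongs to some set of $n$ points of $P\cup\{q\}$ in convex position. $\mathrm{sat}_{\mathsf g}(n)$ is the smallest size of an $n$-gon-saturated set.
   Formalization: The plane is taken with rational coordinates: the point sets are rational and saturation is stated only for rational added points q; real q follow since each open cell of the line arrangement of P contains a rational point. -}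

module Defs where

open import Data.Nat as ℕ using (ℕ)
open import Data.Rational using (ℚ; _+_; _*_; _-_; _≤_; 0ℚ; 1ℚ)
open import Data.Product using (_×_; _,_; Σ; ∃; ∃-syntax; proj₁; proj₂)
open import Data.List using (List; []; _∷_; _++_; length; zipWith; foldr; map)
open import Data.List.Relation.Unary.All using (All)
open import Data.List.Relation.Unary.Unique.Propositional using (Unique)
open import Data.List.Membership.Propositional using (_∈_; _∉_)
open import Data.List.Relation.Binary.Sublist.Propositional using (_⊆_)
open import Relation.Binary.PropositionalEquality using (_≡_; _≢_)
open import Relation.Nullary using (¬_)

Point : Set
Point = ℚ × ℚ

cross : Point → Point → Point → ℚ
cross (ax , ay) (bx , by) (cx , cy) =
  ((bx - ax) * (cy - ay)) - ((by - ay) * (cx - ax))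

sumℚ : List ℚ → ℚ
sumℚ = foldr _+_ 0ℚ

-- A finite planar point set, represented as a duplicate-free list.
-- General position: distinct points, no three collinear.
GeneralPosition : List Point → Set
GeneralPosition P =
  Unique P × (∀ a b c → (a ∷ b ∷ c ∷ []) ⊆ P → cross a b c ≢ 0ℚ)

InConvexHull : Point → List Point → Set
InConvexHull p Q =
  ∃[ w ] (length w ≡ length Q × All (0ℚ ≤_) w × sumℚ w ≡ 1ℚ
          × sumℚ (zipWith (λ λi q → λi * proj₁ q) w Q) ≡ proj₁ p
          × sumℚ (zipWith (λ λi q → λi * proj₂ q) w Q) ≡ proj₂ p)

ConvexPosition : List Point → Set
ConvexPosition S =
  ∀ pre p post → S ≡ pre ++ (p ∷ post) → ¬ InConvexHull p (pre ++ post)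

NGonFree : ℕ → List Point → Set
NGonFree n P = ∀ S → S ⊆ P → length S ≡ n → ¬ ConvexPosition S

NGonSaturated : ℕ → List Point → Set
NGonSaturated n P =
  GeneralPosition P × NGonFree n P ×
  (∀ q → q ∉ P → GeneralPosition (q ∷ P) →
     ∃[ S ] (S ⊆ (q ∷ P) × length S ≡ n × q ∈ S × ConvexPosition S))

-- sat_g(n) ≤ k  (there is an n-gon-saturated set of size at most k)
-- expressed with a rational bound a/b as  b * |P| ≤ a.
-- ram_g(n) ≥ m : there is an n-gon-free set in general position of size ≥ m.

module Submission where

-- Turning the direction is possible because the directions that sort a fixed set form a convex
-- cone. By the placement of `Y`, every direction from a point of `W` to a point of `Y` sorts `W`,
-- and the direction through `q` that is needed always lies between two directions already known to
-- sort `W`. Between such directions the order of `W` stays the same, and with it the cups of `W`;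
-- only the place of `q` in this order changes. Saturation of the eight points is a statement about
-- infinitely many `q` and directions. It becomes finite since only signs matter: on every branch of
-- a case distinction over the orientations of triples, constrained by the sign rule for four sorted
-- points, a large cup or cap appears. Two sign patterns escape this and are excluded by actual
-- coordinates. One of them can be excluded only for directions in a fixed cone, which is why all
-- directions are kept in that cone.

-- Both sets are Erdős–Szekeres sets. Let Y lie far above and to the right of W, so
-- that Y is above all lines of W and W is below all lines of Y. A cup of W extends
-- by one point of Y only, a cap of Y by one point of W only, and a convex polygon
-- meeting both sides consists of a cup of W and a cap of Y. Blocks F(k,l) with cups
-- of at most k and caps of at most l points are built from points by joining
-- F(k-1,l) and F(k,l-1), and joining F(1,n-1), F(2,n-2), …, F(n-1,1) in this order
-- gives a set without convex n-gons.
--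
-- If every new point q completes a (k+1)-cup or an (l+1)-cap in each of two blocks,
-- then also in their join. Similarly, by induction along the row, q completes an
-- n-gon or a cup that is larger than those of the first j blocks: a large cup of
-- the left part and a large cap of the new block, both through q, are either
-- combined into an n-gon, or one of them is extended by a point of the other side.
-- The only obstruction is a point q whose lines to the other side split the cup, and
-- it disappears when the vertical direction is turned towards q; therefore the
-- claims are proved for all directions. After the last block the cup is an n-gon.
--
-- Saturation only needs saturated blocks. For F(4,3) and its mirror image F(3,4)
-- eight points suffice instead of ten, which turns 32 into 28 points for n = 7, and
-- the size of a row at most doubles from n to n+1.

open import Defs
open import Data.Product using (_,_; _×_; ∃-syntax; proj₁; proj₂; uncurry)
open import Data.Sum as Sum using (_⊎_; inj₁; inj₂)
open import Data.Empty using (⊥; ⊥-elim)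
open import Relation.Binary.PropositionalEquality
open import Relation.Binary.Definitions using (tri<; tri≈; tri>; DecidableEquality)
open import Relation.Nullary using (¬_; Dec; yes; no; does)
open import Relation.Nullary.Decidable using (map′; True; toWitness; from-yes; _×-dec_; _⊎-dec_)
open import Data.List using (List; []; _∷_; _++_; reverse; length; zipWith; map; concatMap; upTo; downFrom; filter; take)
open import Data.List.Properties using (unfold-reverse; length-++; length-reverse; ++-assoc; ++-identityʳ; length-map; map-++; length-take; map-∘; map-cong; map-id)
open import Data.List.Relation.Unary.All as All using (All; []; _∷_; all?)
import Data.List.Relation.Unary.All.Properties as All
open import Data.List.Relation.Unary.Any as Any using (Any; here; there; any?)
import Data.List.Relation.Unary.Any.Properties as Any
open import Data.List.Relation.Unary.AllPairs as AllPairs using (AllPairs; []; _∷_; allPairs?)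
import Data.List.Relation.Unary.AllPairs.Properties as AllPairs
open import Data.List.Membership.Propositional using (_∈_; find; _∉_)
open import Data.List.Membership.Propositional.Properties using (∈-++⁺ˡ; ∈-++⁺ʳ; ∈-map⁺; ∈-++⁻; ∈-map⁻; ∈-filter⁻; ∈-upTo⁺; ∈-upTo⁻; ∈-∃++; ∈-filter⁺)
open import Function using (_∘_; id)
open import Data.Bool as Bool using (Bool; true; false; not; if_then_else_)
open import Data.List.Relation.Binary.Sublist.Propositional using (_⊆_; []; _∷_; _∷ʳ_; lookup; minimum; ⊆-trans)
open import Data.List.Relation.Binary.Sublist.Propositional.Properties using (++⁺; ++⁺ˡ; All-resp-⊆; filter-⊆)
open import Data.Maybe using (Maybe; just; nothing)
open import Data.Product.Properties using (≡-dec)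
open import Data.List.Relation.Unary.Unique.Propositional using (Unique)

-- Signs of orientations, and the order of points along a direction

module Orientations where
  open import Data.Nat using (ℕ)
  open import Data.Rational hiding (_≤_)
  open import Data.Rational.Properties
  open import Data.Rational.Solver

  open +-*-Solver using (solve; _:*_; _:+_; _:-_; :-_; _:=_; Polynomial; con)

  det : Point → Point → ℚ
  det (ux , uy) (wx , wy) = ux * wy - uy * wx

  infixl 6 _⊖_
  _⊖_ : Point → Point → Point
  (ax , ay) ⊖ (bx , by) = (ax - bx) , (ay - by)

  Pos Neg : ℚ → Set
  Pos x = 0ℚ < x
  Neg x = x < 0ℚ

  pos-* : ∀ {x y} → Pos x → Pos y → Pos (x * y)
  pos-* {x} {y} p q = positive⁻¹ (x * y) {{pos*pos⇒pos x {{positive p}} y {{positive q}}}}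

  pos-+ : ∀ {x y} → Pos x → Pos y → Pos (x + y)
  pos-+ = +-mono-<

  pos-cancel : ∀ {x y} → Pos x → Pos (x * y) → Pos y
  pos-cancel {x} {y} p q = *-cancelˡ-<-nonNeg x {{pos⇒nonNeg x {{positive p}}}}
    (subst (_< x * y) (sym (*-zeroʳ x)) q)

  neg⇒pos : ∀ {x} → Neg x → Pos (- x)
  neg⇒pos = neg-antimono-<

  pos⇒neg : ∀ {x} → Pos (- x) → Neg x
  pos⇒neg {x} p = subst (_< 0ℚ) (⁻¹-involutive x) (neg-antimono-< p)
    where open import Algebra.Properties.Group +-0-group using (⁻¹-involutive)

  pos-neg : ∀ {x} → Pos x → ¬ Neg x
  pos-neg = <-asym

  -- Only the signs of the coefficients matter, so they are hidden; the factor on `z` avoids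
  -- division.
  record Btw (x z y : ℚ) : Set where
    constructor btw
    field
      {α β γ} : ℚ
      α⁺ : Pos α
      β⁺ : Pos β
      γ⁺ : Pos γ
      eq : α * z ≡ β * x + γ * y

  btw-pos : ∀ {x z y} → Btw x z y → Pos x → Pos y → Pos z
  btw-pos (btw α⁺ β⁺ γ⁺ eq) x⁺ y⁺ =
    pos-cancel α⁺ (subst Pos (sym eq) (pos-+ (pos-* β⁺ x⁺) (pos-* γ⁺ y⁺)))

  btw-neg : ∀ {x z y} → Btw x z y → Btw (- x) (- z) (- y)
  btw-neg {x} {z} {y} (btw {α} {β} {γ} a b c eq) = btw a b c
    (trans (solve 2 (λ α z → α :* (:- z) := :- (α :* z)) refl α z)
    (trans (cong -_ eq)
      (solve 4 (λ β x γ y → :- (β :* x :+ γ :* y) := β :* (:- x) :+ γ :* (:- y)) refl β x γ y)))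

  btw-flip : ∀ {x z y} → Btw x z y → Btw y z x
  btw-flip {x} {z} {y} (btw {α} {β} {γ} a b c eq) = btw a c b (trans eq (+-comm (β * x) (γ * y)))

  -- Moving `γ * y` to the other side exhibits `x` as a combination of `z` and `- y`. With
  -- `btw-flip` and `btw-neg`, all six sign rules below reduce to `btw-pos`.
  btw-rot : ∀ {x z y} → Btw x z y → Btw z x (- y)
  btw-rot {x} {z} {y} (btw {α} {β} {γ} a b c eq) = btw b a c
    (trans (solve 4 (λ β x γ y → β :* x := (β :* x :+ γ :* y) :+ γ :* (:- y)) refl β x γ y)
      (cong (_+ γ * (- y)) (sym eq)))

  -- A record rather than an abbreviation, so that the points can be inferred from the type; `cross`
  -- would unfold to coordinates.
  record Left (a b c : Point) : Set where
    constructor left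
    field left-pos : Pos (cross a b c)
  open Left

  record Right (a b c : Point) : Set where
    constructor right
    field right-neg : Neg (cross a b c)
  open Right

  module _ {a b c d e f g h i : Point} (B : Btw (cross a b c) (cross d e f) (cross g h i)) where

    mid⁺ : Left a b c → Left g h i → Left d e f
    mid⁺ (left p) (left q) = left (btw-pos B p q)

    mid⁻ : Right a b c → Right g h i → Right d e f
    mid⁻ (right p) (right q) = right (pos⇒neg (btw-pos (btw-neg B) (neg⇒pos p) (neg⇒pos q)))

    fst⁺ : Left d e f → Right g h i → Left a b c
    fst⁺ (left p) (right q) = left (btw-pos (btw-rot B) p (neg⇒pos q))

    fst⁻ : Right d e f → Left g h i → Right a b c
    fst⁻ (right p) (left q) =
      right (pos⇒neg (btw-pos (btw-neg (btw-rot B)) (neg⇒pos p) (neg⇒pos (neg-antimono-< q))))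

    lst⁺ : Right a b c → Left d e f → Left g h i
    lst⁺ (right p) (left q) = left (btw-pos (btw-rot (btw-flip B)) q (neg⇒pos p))

    lst⁻ : Left a b c → Right d e f → Right g h i
    lst⁻ (left p) (right q) =
      right (pos⇒neg (btw-pos (btw-neg (btw-rot (btw-flip B))) (neg⇒pos q) (neg⇒pos (neg-antimono-< p))))

  module _ {n : ℕ} where
    detP : (ux uy wx wy : Polynomial n) → Polynomial n
    detP ux uy wx wy = ux :* wy :- uy :* wx

    crossP : (ax ay bx by cx cy : Polynomial n) → Polynomial n
    crossP ax ay bx by cx cy = (bx :- ax) :* (cy :- ay) :- (by :- ay) :* (cx :- ax)

    dirP : (ax ay bx by vx vy : Polynomial n) → Polynomial n
    dirP ax ay bx by vx vy = detP (bx :- ax) (by :- ay) vx vy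

  cross-cycle : ∀ a b c → cross b c a ≡ cross a b c
  cross-cycle (ax , ay) (bx , by) (cx , cy) = solve 6 (λ ax ay bx by cx cy →
    crossP bx by cx cy ax ay := crossP ax ay bx by cx cy) refl ax ay bx by cx cy

  cross-swap : ∀ a b c → cross a c b ≡ - cross a b c
  cross-swap (ax , ay) (bx , by) (cx , cy) = solve 6 (λ ax ay bx by cx cy →
    crossP ax ay cx cy bx by := :- crossP ax ay bx by cx cy) refl ax ay bx by cx cy

  cyc : ∀ {a b c} → Left a b c → Left b c a
  cyc {a} {b} {c} (left p) = left (subst Pos (sym (cross-cycle a b c)) p)

  cyc² : ∀ {a b c} → Left a b c → Left c a b
  cyc² p = cyc (cyc p)

  flipʳ : ∀ {a b c} → Left a c b → Right a b c
  flipʳ {a} {b} {c} (left p) = right (pos⇒neg (subst Pos (cross-swap a b c) p))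

  flipˡ : ∀ {a b c} → Right a b c → Left a c b
  flipˡ {a} {b} {c} (right p) = left (subst Pos (sym (cross-swap a b c)) (neg⇒pos p))

  left-right : ∀ {a b c} → Left a b c → Right a b c → ⊥
  left-right (left p) (right q) = pos-neg p q

  left-asym : ∀ {a b c} → Left a b c → Left a c b → ⊥
  left-asym p q = left-right p (flipʳ q)

  sgn : ∀ {x} → x ≢ 0ℚ → Pos x ⊎ Neg x
  sgn {x} x≢0 with <-cmp 0ℚ x
  ... | tri< p _ _ = inj₁ p
  ... | tri≈ _ e _ = ⊥-elim (x≢0 (sym e))
  ... | tri> _ _ p = inj₂ p

  side : ∀ {a b c} → cross a b c ≢ 0ℚ → Left a b c ⊎ Right a b c
  side ne = Sum.map left right (sgn ne)

  left? : ∀ a b c → Dec (Left a b c)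
  left? a b c = map′ left left-pos (0ℚ <? cross a b c)

  infix 4 _<[_]_
  -- The order in which a line parallel to `v` sweeps over the points; for vertical `v` it compares
  -- first coordinates. It is the orientation of `a`, `b` and the point at infinity in direction
  -- `v`.
  record _<[_]_ (a v b : Point) : Set where
    constructor before
    field dir-pos : Pos (det (b ⊖ a) v)
  open _<[_]_

  dir-split : ∀ v a b c → det (c ⊖ a) v ≡ det (b ⊖ a) v + det (c ⊖ b) v
  dir-split (vx , vy) (ax , ay) (bx , by) (cx , cy) = solve 8 (λ vx vy ax ay bx by cx cy →
    dirP ax ay cx cy vx vy := dirP ax ay bx by vx vy :+ dirP bx by cx cy vx vy)
    refl vx vy ax ay bx by cx cy

  <v-trans : ∀ {v a b c} → a <[ v ] b → b <[ v ] c → a <[ v ] c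
  <v-trans {v} {a} {b} {c} (before p) (before q) =
    before (subst Pos (sym (dir-split v a b c)) (pos-+ p q))

  dir-swap : ∀ v a b → det (a ⊖ b) v ≡ - det (b ⊖ a) v
  dir-swap (vx , vy) (ax , ay) (bx , by) = solve 6 (λ vx vy ax ay bx by →
    dirP bx by ax ay vx vy := :- dirP ax ay bx by vx vy) refl vx vy ax ay bx by

  <v-asym : ∀ {v a b} → a <[ v ] b → b <[ v ] a → ⊥
  <v-asym {v} {a} {b} (before p) (before q) = pos-neg p (pos⇒neg (subst Pos (dir-swap v a b) q))

  <v? : ∀ a v b → Dec (a <[ v ] b)
  <v? a v b = map′ before dir-pos (0ℚ <? det (b ⊖ a) v)

  -- The Grassmann–Plücker relations with the direction v as a fifth point (at
  -- infinity): along v-sorted points a, b, c, d the orientations of abc, abd,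
  -- acd, bcd change sign at most once.
  module _ {v a b c d : Point} (ab : a <[ v ] b) (bc : b <[ v ] c) (cd : c <[ v ] d) where
    private
      ac = <v-trans ab bc
      bd = <v-trans bc cd
      ad = <v-trans ab bd

    btw₁₂₃ : Btw (cross a b c) (cross a b d) (cross a c d)
    btw₁₂₃ = btw (dir-pos ac) (dir-pos ad) (dir-pos ab) (lemma v a b c d)
      where
      lemma : ∀ v a b c d → det (c ⊖ a) v * cross a b d ≡
        det (d ⊖ a) v * cross a b c + det (b ⊖ a) v * cross a c d
      lemma (vx , vy) (ax , ay) (bx , by) (cx , cy) (dx , dy) = solve 10
        (λ vx vy ax ay bx by cx cy dx dy →
          dirP ax ay cx cy vx vy :* crossP ax ay bx by dx dy :=
          dirP ax ay dx dy vx vy :* crossP ax ay bx by cx cy :+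
          dirP ax ay bx by vx vy :* crossP ax ay cx cy dx dy)
        refl vx vy ax ay bx by cx cy dx dy

    btw₁₂₄ : Btw (cross a b c) (cross a b d) (cross b c d)
    btw₁₂₄ = btw (dir-pos bc) (dir-pos bd) (dir-pos ab) (lemma v a b c d)
      where
      lemma : ∀ v a b c d → det (c ⊖ b) v * cross a b d ≡
        det (d ⊖ b) v * cross a b c + det (b ⊖ a) v * cross b c d
      lemma (vx , vy) (ax , ay) (bx , by) (cx , cy) (dx , dy) = solve 10
        (λ vx vy ax ay bx by cx cy dx dy →
          dirP bx by cx cy vx vy :* crossP ax ay bx by dx dy :=
          dirP bx by dx dy vx vy :* crossP ax ay bx by cx cy :+
          dirP ax ay bx by vx vy :* crossP bx by cx cy dx dy)
        refl vx vy ax ay bx by cx cy dx dy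

    btw₁₃₄ : Btw (cross a b c) (cross a c d) (cross b c d)
    btw₁₃₄ = btw (dir-pos bc) (dir-pos cd) (dir-pos ac) (lemma v a b c d)
      where
      lemma : ∀ v a b c d → det (c ⊖ b) v * cross a c d ≡
        det (d ⊖ c) v * cross a b c + det (c ⊖ a) v * cross b c d
      lemma (vx , vy) (ax , ay) (bx , by) (cx , cy) (dx , dy) = solve 10
        (λ vx vy ax ay bx by cx cy dx dy →
          dirP bx by cx cy vx vy :* crossP ax ay cx cy dx dy :=
          dirP cx cy dx dy vx vy :* crossP ax ay bx by cx cy :+
          dirP ax ay cx cy vx vy :* crossP bx by cx cy dx dy)
        refl vx vy ax ay bx by cx cy dx dy

    btw₂₃₄ : Btw (cross a b d) (cross a c d) (cross b c d)
    btw₂₃₄ = btw (dir-pos bd) (dir-pos cd) (dir-pos ad) (lemma v a b c d)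
      where
      lemma : ∀ v a b c d → det (d ⊖ b) v * cross a c d ≡
        det (d ⊖ c) v * cross a b d + det (d ⊖ a) v * cross b c d
      lemma (vx , vy) (ax , ay) (bx , by) (cx , cy) (dx , dy) = solve 10
        (λ vx vy ax ay bx by cx cy dx dy →
          dirP bx by dx dy vx vy :* crossP ax ay cx cy dx dy :=
          dirP cx cy dx dy vx vy :* crossP ax ay bx by dx dy :+
          dirP ax ay dx dy vx vy :* crossP bx by cx cy dx dy)
        refl vx vy ax ay bx by cx cy dx dy

  -- By Cramer's rule the first three determinants make `v` a positive combination of `u` and `w`.
  cone : ∀ u v w z → Pos (det u w) → Pos (det v w) → Pos (det u v) → Pos (det z u) → Pos (det z w) → Pos (det z v)
  cone u v w z uw vw uv zu zw =
    btw-pos (btw uw vw uv (lemma u v w z)) zu zw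
    where
    lemma : ∀ u v w z → det u w * det z v ≡ det v w * det z u + det u v * det z w
    lemma (ux , uy) (vx , vy) (wx , wy) (zx , zy) = solve 8 (λ ux uy vx vy wx wy zx zy →
      detP ux uy wx wy :* detP zx zy vx vy :=
      detP vx vy wx wy :* detP zx zy ux uy :+ detP ux uy vx vy :* detP zx zy wx wy)
      refl ux uy vx vy wx wy zx zy

  -- Twice the signed area of the quadrilateral `abcd`, cut along either diagonal.
  cross-split : ∀ a b c d → cross a b c + cross a c d ≡ cross a b d + cross b c d
  cross-split (ax , ay) (bx , by) (cx , cy) (dx , dy) = solve 8 (λ ax ay bx by cx cy dx dy →
    crossP ax ay bx by cx cy :+ crossP ax ay cx cy dx dy :=
    crossP ax ay bx by dx dy :+ crossP bx by cx cy dx dy) refl ax ay bx by cx cy dx dy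

  -- The order along a direction that joins two of three points is an orientation. This and the next
  -- two identities translate between them when the direction is turned towards `q`.
  det-turn : ∀ a b c → det (c ⊖ b) (b ⊖ a) ≡ - cross a b c
  det-turn (ax , ay) (bx , by) (cx , cy) = solve 6 (λ ax ay bx by cx cy →
    detP (cx :- bx) (cy :- by) (bx :- ax) (by :- ay) := :- crossP ax ay bx by cx cy)
    refl ax ay bx by cx cy

  det-back : ∀ a b c → det (b ⊖ a) (c ⊖ b) ≡ cross a b c
  det-back (ax , ay) (bx , by) (cx , cy) = solve 6 (λ ax ay bx by cx cy →
    detP (bx :- ax) (by :- ay) (cx :- bx) (cy :- by) := crossP ax ay bx by cx cy)
    refl ax ay bx by cx cy

  det-heads : ∀ a b c → det (c ⊖ a) (c ⊖ b) ≡ cross a b c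
  det-heads (ax , ay) (bx , by) (cx , cy) = solve 6 (λ ax ay bx by cx cy →
    detP (cx :- ax) (cy :- ay) (cx :- bx) (cy :- by) := crossP ax ay bx by cx cy)
    refl ax ay bx by cx cy

  turn-right : ∀ {a b c} → Pos (det (c ⊖ b) (b ⊖ a)) → Right a b c
  turn-right {a} {b} {c} p = right (pos⇒neg (subst Pos (det-turn a b c) p))

  right-turn : ∀ {a b c} → Right a b c → Pos (det (c ⊖ b) (b ⊖ a))
  right-turn {a} {b} {c} (right p) = subst Pos (sym (det-turn a b c)) (neg⇒pos p)

  back-left : ∀ {a b c} → Pos (det (b ⊖ a) (c ⊖ b)) → Left a b c
  back-left {a} {b} {c} p = left (subst Pos (det-back a b c) p)

  left-back : ∀ {a b c} → Left a b c → Pos (det (b ⊖ a) (c ⊖ b))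
  left-back {a} {b} {c} (left p) = subst Pos (sym (det-back a b c)) p

  heads-left : ∀ {a b c} → Pos (det (c ⊖ a) (c ⊖ b)) → Left a b c
  heads-left {a} {b} {c} p = left (subst Pos (det-heads a b c) p)

  left-heads : ∀ {a b c} → Left a b c → Pos (det (c ⊖ a) (c ⊖ b))
  left-heads {a} {b} {c} (left p) = subst Pos (sym (det-heads a b c)) p

  no-four : ∀ {a b d q} → Left a b d → Left a d q → Right a b q → Right b d q → ⊥
  no-four {a} {b} {d} {q} (left p₁) (left p₂) (right n₁) (right n₂) =
    pos-neg (subst Pos (cross-split a b d q) (pos-+ p₁ p₂)) (+-mono-< n₁ n₂)

  left≢0 : ∀ {a b c} → Left a b c → cross a b c ≢ 0ℚ
  left≢0 (left p) e = <-irrefl (sym e) p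

  right≢0 : ∀ {a b c} → Right a b c → cross a b c ≢ 0ℚ
  right≢0 (right p) e = <-irrefl e p

open Orientations

-- Relations on all pairs and all triples of a list

module Tuples where
  open import Data.Nat using (_+_)

  module _ {A : Set} where

    all-or-some : ∀ {P Q : A → Set} xs → (∀ {x} → x ∈ xs → P x ⊎ Q x) →
      All P xs ⊎ ∃[ x ] (x ∈ xs × Q x)
    all-or-some [] f = inj₁ []
    all-or-some (x ∷ xs) f with f (here refl)
    ... | inj₂ q = inj₂ (x , here refl , q)
    ... | inj₁ p with all-or-some xs (λ m → f (there m))
    ...   | inj₁ ps = inj₁ (p ∷ ps)
    ...   | inj₂ (y , m , q) = inj₂ (y , there m , q)

    pairs-++⁻ : ∀ {R : A → A → Set} xs {ys} → AllPairs R (xs ++ ys) →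
      AllPairs R xs × All (λ x → All (R x) ys) xs × AllPairs R ys
    pairs-++⁻ [] p = [] , [] , p
    pairs-++⁻ (x ∷ xs) (r ∷ p) with pairs-++⁻ xs p
    ... | p₁ , p₁₂ , p₂ = All.++⁻ˡ xs r ∷ p₁ , All.++⁻ʳ xs r ∷ p₁₂ , p₂

    -- Asymmetry lets `R a b` recover the order in the list, where `S` holds too. This carries
    -- comparisons from one sorting direction to another.
    pairs-transfer : ∀ {R S : A → A → Set} → (∀ {a b} → R a b → R b a → ⊥) →
      ∀ {xs} → AllPairs R xs → AllPairs S xs →
      ∀ {a b} → a ∈ xs → b ∈ xs → R a b → S a b
    pairs-transfer asym (r ∷ rs) (s ∷ ss) (here refl) (here refl) rab = ⊥-elim (asym rab rab)
    pairs-transfer asym (r ∷ rs) (s ∷ ss) (here refl) (there mb) rab = All.lookup s mb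
    pairs-transfer asym (r ∷ rs) (s ∷ ss) (there ma) (here refl) rab = ⊥-elim (asym rab (All.lookup r ma))
    pairs-transfer asym (r ∷ rs) (s ∷ ss) (there ma) (there mb) rab = pairs-transfer asym rs ss ma mb rab

    pairs-cmp : ∀ {R : A → A → Set} {xs} → AllPairs R xs → ∀ {a b} → a ∈ xs → b ∈ xs →
      a ≡ b ⊎ R a b ⊎ R b a
    pairs-cmp (r ∷ rs) (here refl) (here refl) = inj₁ refl
    pairs-cmp (r ∷ rs) (here refl) (there mb) = inj₂ (inj₁ (All.lookup r mb))
    pairs-cmp (r ∷ rs) (there ma) (here refl) = inj₂ (inj₂ (All.lookup r ma))
    pairs-cmp (r ∷ rs) (there ma) (there mb) = pairs-cmp rs ma mb

    pairs-within : ∀ {R S : A → A → Set} {W : List A} →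
      (∀ {a b} → a ∈ W → b ∈ W → R a b → S a b) →
      ∀ {xs} → All (_∈ W) xs → AllPairs R xs → AllPairs S xs
    pairs-within f [] [] = []
    pairs-within f (m ∷ ms) (r ∷ rs) =
      All.zipWith (λ (m′ , rab) → f m m′ rab) (ms , r) ∷ pairs-within f ms rs

    pairs-All : ∀ {B : Set} {R : A → A → B → Set} {xs} {ys : List B} →
      (∀ {y} → y ∈ ys → AllPairs (λ a b → R a b y) xs) → AllPairs (λ a b → All (R a b) ys) xs
    pairs-All {xs = []} f = []
    pairs-All {xs = x ∷ xs} {ys} f =
      All.tabulate (λ m → All.tabulate (λ my → All.lookup (AllPairs.head (f my)) m)) ∷
      pairs-All (λ my → AllPairs.tail (f my))

    last-of : ∀ {R : A → A → Set} x xs → AllPairs R (x ∷ xs) →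
      ∃[ z ] (z ∈ x ∷ xs × (∀ {y} → y ∈ x ∷ xs → y ≡ z ⊎ R y z))
    last-of x [] _ = x , here refl , λ { (here e) → inj₁ e }
    last-of x (y ∷ ys) (r ∷ rs) with last-of y ys rs
    ... | z , m , f = z , there m ,
      λ { (here refl) → inj₂ (All.lookup r m) ; (there k) → f k }

    data Triples (R : A → A → A → Set) : List A → Set where
      []  : Triples R []
      _∷_ : ∀ {x xs} → AllPairs (R x) xs → Triples R xs → Triples R (x ∷ xs)

    module _ {R : A → A → A → Set} where

      triples-++⁺ : ∀ {xs ys} → Triples R xs → AllPairs (λ a b → All (R a b) ys) xs →
        All (λ a → AllPairs (R a) ys) xs → Triples R ys → Triples R (xs ++ ys)
      triples-++⁺ [] [] [] t = t
      triples-++⁺ (p ∷ t₁) (p₂₁ ∷ t₂₁) (p₁₂ ∷ t₁₂) t₂ =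
        AllPairs.++⁺ p p₁₂ p₂₁ ∷ triples-++⁺ t₁ t₂₁ t₁₂ t₂

      triples-++⁻ : ∀ xs {ys} → Triples R (xs ++ ys) → Triples R xs ×
        AllPairs (λ a b → All (R a b) ys) xs × All (λ a → AllPairs (R a) ys) xs × Triples R ys
      triples-++⁻ [] t = [] , [] , [] , t
      triples-++⁻ (x ∷ xs) (p ∷ t) with pairs-++⁻ xs p | triples-++⁻ xs t
      ... | p₁ , p₂₁ , p₁₂ | t₁ , t₂₁ , t₁₂ , t₂ = p₁ ∷ t₁ , p₂₁ ∷ t₂₁ , p₁₂ ∷ t₁₂ , t₂

    triples-map : ∀ {R S : A → A → A → Set} → (∀ {a b c} → R a b c → S a b c) →
      ∀ {xs} → Triples R xs → Triples S xs
    triples-map f [] = []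
    triples-map f (p ∷ t) = AllPairs.map f p ∷ triples-map f t

    pairs-reverse : ∀ {R : A → A → Set} {xs} → AllPairs R xs → AllPairs (λ a b → R b a) (reverse xs)
    pairs-reverse [] = []
    pairs-reverse {xs = x ∷ xs} (r ∷ rs) = subst (AllPairs _) (sym (unfold-reverse x xs))
      (AllPairs.++⁺ (pairs-reverse rs) ([] ∷ []) (All.map (_∷ []) (All.tabulate (λ m → All.lookup r (Any.reverse⁻ m)))))

    triples-reverse : ∀ {R : A → A → A → Set} {xs} → Triples R xs →
      Triples (λ a b c → R c b a) (reverse xs)
    triples-reverse [] = []
    triples-reverse {xs = x ∷ xs} (p ∷ t) = subst (Triples _) (sym (unfold-reverse x xs))
      (triples-++⁺ (triples-reverse t) (AllPairs.map (_∷ []) (pairs-reverse p))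
        (All.tabulate (λ _ → [] ∷ [])) ([] ∷ []))

    triples-transfer : ∀ {R : A → A → Set} {S : A → A → A → Set} → (∀ {a b} → R a b → R b a → ⊥) →
      ∀ {xs} → AllPairs R xs → Triples S xs →
      ∀ {a b c} → a ∈ xs → b ∈ xs → c ∈ xs → R a b → R b c → S a b c
    triples-transfer asym (r ∷ rs) (p ∷ t) (here refl) (here refl) _ ab _ = ⊥-elim (asym ab ab)
    triples-transfer asym (r ∷ rs) (p ∷ t) (here refl) (there mb) (here refl) ab bc = ⊥-elim (asym ab bc)
    triples-transfer asym (r ∷ rs) (p ∷ t) (here refl) (there mb) (there mc) _ bc =
      pairs-transfer asym rs p mb mc bc
    triples-transfer asym (r ∷ rs) (p ∷ t) (there ma) (here refl) _ ab _ = ⊥-elim (asym ab (All.lookup r ma))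
    triples-transfer asym (r ∷ rs) (p ∷ t) (there ma) (there mb) (here refl) _ bc =
      ⊥-elim (asym bc (All.lookup r mb))
    triples-transfer asym (r ∷ rs) (p ∷ t) (there ma) (there mb) (there mc) ab bc =
      triples-transfer asym rs t ma mb mc ab bc

open Tuples

-- Cups and caps through a new point, and joins of saturated blocks

module CupsAndCaps where
  open import Data.Rational using (0ℚ; 1ℚ; -_)
  open import Data.Nat using (ℕ; suc; _+_)
  open import Data.Nat.Properties using (+-comm; +-suc; +-identityʳ)

  -- A fixed cone of directions: the eight-point sets are saturated for these only.
  Steep : Point → Set
  Steep v = Pos (det (1ℚ , 1ℚ) v) × Pos (det (1ℚ , - 1ℚ) v)

  record Sorts (v : Point) (X : List Point) : Set where
    constructor sorts
    field
      steep : Steep v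
      sorted : AllPairs (_<[ v ]_) X
  open Sorts

  record Generic (v q : Point) (X : List Point) : Set where
    constructor generic
    field
      no-tie : All (λ p → p <[ v ] q ⊎ q <[ v ] p) X
      no-line : AllPairs (λ a b → cross a b q ≢ 0ℚ) X
  open Generic

  -- With R = Left a cup through q, with R = Right a cap. It has m + 1 points: m of
  -- them in X, l before q and r after q along v.
  record Chain (R : Point → Point → Point → Set) (v q : Point) (X : List Point) (m : ℕ) : Set where
    constructor chain
    field
      {l r} : List Point
      l⊆ : All (_∈ X) l
      r⊆ : All (_∈ X) r
      size : length l + length r ≡ m
      order : AllPairs (_<[ v ]_) (l ++ q ∷ r)
      triples : Triples R (l ++ q ∷ r)

  -- A list whose triples all turn left runs through a convex polygon counterclockwise, from an
  -- arbitrary first vertex. Convexity in terms of hulls follows in `polygon-convex`.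
  record NGon (n : ℕ) (q : Point) (X : List Point) : Set where
    constructor ngon
    field
      {L} : List Point
      q∈ : q ∈ L
      L⊆ : All (_∈ q ∷ X) L
      size : length L ≡ n
      poly : Triples Left L

  -- The direction is arbitrary because the induction turns it towards q.
  Sat : ℕ → ℕ → List Point → Set
  Sat k l X = ∀ v q → Sorts v X → Generic v q X → Chain Left v q X k ⊎ Chain Right v q X l

  -- `k` does not count `q`, so for `k = n - 1` the cup is an `n`-gon as well.
  Claim : ℕ → ℕ → List Point → Set
  Claim n k X = ∀ v q → Sorts v X → Generic v q X → NGon n q X ⊎ Chain Left v q X k

  -- If y ⊖ u sorts W for all u, then y is above every line of W; if it sorts Y,
  -- then u is below every line of Y.
  record Joins (W Y : List Point) : Set where
    field
      sortsˡ : ∀ {u y} → u ∈ W → y ∈ Y → Sorts (y ⊖ u) W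
      sortsʳ : ∀ {u y} → u ∈ W → y ∈ Y → Sorts (y ⊖ u) Y

  chain-weaken : ∀ {R v q X X′ m} → (∀ {p} → p ∈ X → p ∈ X′) → Chain R v q X m → Chain R v q X′ m
  chain-weaken f (chain l⊆ r⊆ s o t) = chain (All.map f l⊆) (All.map f r⊆) s o t

  ngon-weaken : ∀ {n q X X′} → (∀ {p} → p ∈ X → p ∈ X′) → NGon n q X → NGon n q X′
  ngon-weaken f (ngon q∈ L⊆ s p) =
    ngon q∈ (All.map (λ { (here e) → here e ; (there m) → there (f m) }) L⊆) s p

  -- `A` is the lower chain from left to right; the upper chain `D`, traversed backwards, closes the
  -- counterclockwise circuit.
  join-polygon : ∀ {A D} → Triples Left A → Triples Right D →
    AllPairs (λ a b → All (Left a b) D) A → All (λ a → AllPairs (Right a) D) A →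
    Triples Left (A ++ reverse D)
  join-polygon tA tD AAD ADD = triples-++⁺ tA
    (AllPairs.map (λ p → All.tabulate (λ m → All.lookup p (Any.reverse⁻ m))) AAD)
    (All.map (λ p → AllPairs.map flipˡ (pairs-reverse p)) ADD)
    (triples-map (λ p → cyc (flipˡ p)) (triples-reverse tD))

  -- Steepness and each comparison are positivity conditions that are linear in the direction.
  cone-sorts : ∀ {u v w X} → Pos (det u w) → Pos (det v w) → Pos (det u v) →
    Sorts u X → Sorts w X → Sorts v X
  cone-sorts {u} {v} {w} uw vw uv (sorts (s₁ , s₂) ou) (sorts (t₁ , t₂) ow) =
    sorts (cone u v w (1ℚ , 1ℚ) uw vw uv s₁ t₁ , cone u v w (1ℚ , - 1ℚ) uw vw uv s₂ t₂)
      (AllPairs.zipWith (λ {a} {b} (before p , before q) → before (cone u v w (b ⊖ a) uw vw uv p q)) (ou , ow))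

  module Facts {W Y : List Point} (J : Joins W Y) {v q : Point}
    (sv : Sorts v (W ++ Y)) (g : Generic v q (W ++ Y)) where

    open Joins J

    svW : Sorts v W
    svW = sorts (steep sv) (proj₁ (pairs-++⁻ W (sorted sv)))

    svY : Sorts v Y
    svY = sorts (steep sv) (proj₂ (proj₂ (pairs-++⁻ W (sorted sv))))

    gW : Generic v q W
    gW = generic (All.++⁻ˡ W (no-tie g)) (proj₁ (pairs-++⁻ W (no-line g)))

    gY : Generic v q Y
    gY = generic (All.++⁻ʳ W (no-tie g)) (proj₂ (proj₂ (pairs-++⁻ W (no-line g))))

    W<Y : ∀ {w y} → w ∈ W → y ∈ Y → w <[ v ] y
    W<Y mw my = All.lookup (All.lookup (proj₁ (proj₂ (pairs-++⁻ W (sorted sv)))) mw) my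

    no-line-WY : ∀ {w y} → w ∈ W → y ∈ Y → cross w y q ≢ 0ℚ
    no-line-WY mw my = All.lookup (All.lookup (proj₁ (proj₂ (pairs-++⁻ W (no-line g)))) mw) my

    reorder : ∀ {u a b} → Sorts u W → a ∈ W → b ∈ W → a <[ v ] b → a <[ u ] b
    reorder su = pairs-transfer <v-asym (sorted svW) (sorted su)

    reorder⁻ : ∀ {u a b} → Sorts u W → a ∈ W → b ∈ W → a <[ u ] b → a <[ v ] b
    reorder⁻ su = pairs-transfer <v-asym (sorted su) (sorted svW)

    -- `cross c c′ y` is `det (c′ ⊖ c) (y ⊖ c)` by definition, and `y ⊖ c` is a sorting direction of
    -- the join.
    cup : ∀ {c c′ y} → c ∈ W → c′ ∈ W → y ∈ Y → c <[ v ] c′ → Left c c′ y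
    cup mc mc′ my lt with reorder (sortsˡ mc my) mc mc′ lt
    ... | before p = left p

    cap : ∀ {c y y′} → c ∈ W → y ∈ Y → y′ ∈ Y → y <[ v ] y′ → Right c y y′
    cap mc my my′ lt with pairs-transfer <v-asym (sorted svY) (sorted (sortsʳ mc my)) my my′ lt
    ... | before p = turn-right p

    caps : ∀ {c D} → c ∈ W → All (_∈ Y) D → AllPairs (_<[ v ]_) D → AllPairs (Right c) D
    caps mc = pairs-within (cap mc)

    cups : ∀ {C D} → All (_∈ W) C → All (_∈ Y) D → AllPairs (_<[ v ]_) C →
      AllPairs (λ c c′ → All (Left c c′) D) C
    cups mC mD = pairs-within (λ mc mc′ lt → All.map (λ my → cup mc mc′ my lt) mD) mC

    below : ∀ {c d} → c ∈ W → d ∈ Y → d <[ v ] q → c <[ v ] q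
    below mc md d<q = <v-trans (W<Y mc md) d<q

    -- Only `cdq` has to be tested. For `x` in `l`, right turns `cdx` and `dxq` force one at `cxq`;
    -- for `y` in `r`, right turns `cdq` and `dqy` force one at `cqy`.
    capA : ∀ {c d l r} → c ∈ W → All (_∈ Y) (d ∷ l) → All (_∈ Y) r →
      AllPairs (_<[ v ]_) (d ∷ l ++ q ∷ r) → Triples Right (d ∷ l ++ q ∷ r) →
      Right c d q → AllPairs (Right c) (d ∷ l ++ q ∷ r)
    capA {c} {d} {l} {r} mc ml@(md ∷ ml′) mr o t cdq
      with pairs-++⁻ (d ∷ l) o | triples-++⁻ (d ∷ l) t
    ... | o₁@(d<l ∷ _) , o₁₂@((d<q ∷ _) ∷ _) , (q<r ∷ o₂) | t₁ , (t₂₁ ∷ _) , ((dqr ∷ _) ∷ _) , _ =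
      AllPairs.++⁺ (caps mc ml o₁) (All.tabulate cq ∷ caps mc mr o₂)
        (All.tabulate λ mx → cxq mx ∷ All.tabulate λ my →
          cap mc (All.lookup ml mx) (All.lookup mr my) (<v-trans (x<q mx) (All.lookup q<r my)))
      where
      x<q : ∀ {x} → x ∈ d ∷ l → x <[ v ] q
      x<q mx = All.head (All.lookup o₁₂ mx)
      cxq : ∀ {x} → x ∈ d ∷ l → Right c x q
      cxq (here refl) = cdq
      cxq (there mx) = mid⁻ (btw₁₃₄ (W<Y mc md) (All.lookup d<l mx) (x<q (there mx)))
        (cap mc md (All.lookup ml′ mx) (All.lookup d<l mx)) (All.head (All.lookup t₂₁ mx))
      cq : ∀ {y} → y ∈ r → Right c q y
      cq my = mid⁻ (btw₁₃₄ (W<Y mc md) d<q (All.lookup q<r my)) cdq (All.lookup dqr my)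

    module _ {d r} (md : d ∈ Y) (mr : All (_∈ Y) r) (q<d : q <[ v ] d)
      (d<r : All (d <[ v ]_) r) (qdr : All (Right q d) r) where

      capB : ∀ {c} → c ∈ W → c <[ v ] q → Right c q d → All (Right c q) (d ∷ r)
      capB mc c<q cqd = cqd ∷ All.tabulate λ my →
        mid⁻ (btw₁₂₄ c<q q<d (All.lookup d<r my)) cqd (All.lookup qdr my)

      capB′ : ∀ {c} → c ∈ W → q <[ v ] c → Right q c d → All (Right q c) (d ∷ r)
      capB′ mc q<c qcd = qcd ∷ All.tabulate λ my →
        mid⁻ (btw₁₂₄ q<c (W<Y mc md) (All.lookup d<r my)) qcd
          (cap mc md (All.lookup mr my) (All.lookup d<r my))

    cupA : ∀ {l d} → All (_∈ W) l → AllPairs (_<[ v ]_) l → Triples Left l →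
      AllPairs (λ a b → Left a b q) l → All (λ c → Left c d q) l → d ∈ Y → d <[ v ] q →
      Chain Left v q (W ++ Y) (suc (length l))
    cupA {l} {d} ml o t tq td md d<q = chain {l = l ++ d ∷ []} {r = []}
      (All.++⁺ (All.map ∈-++⁺ˡ ml) (∈-++⁺ʳ W md ∷ [])) []
      (trans (+-identityʳ _) (trans (length-++ l) (+-comm (length l) 1)))
      (AllPairs.++⁺ (AllPairs.++⁺ o ([] ∷ []) (All.map (λ mc → W<Y mc md ∷ []) ml)) ([] ∷ [])
        (All.++⁺ (All.map (λ mc → below mc md d<q ∷ []) ml) ((d<q ∷ []) ∷ [])))
      (triples-++⁺
        (triples-++⁺ t (cups ml (md ∷ []) o) (All.map (λ _ → [] ∷ []) ml) ([] ∷ []))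
        (AllPairs.++⁺ (AllPairs.map (_∷ []) tq) ([] ∷ []) (All.map (λ p → (p ∷ []) ∷ []) td))
        (All.tabulate λ _ → [] ∷ []) ([] ∷ []))

    cup-around : ∀ {u l r D} → Sorts u W → All (_∈ W) l → All (_∈ W) r → All (_∈ Y) D →
      AllPairs (_<[ u ]_) (l ++ q ∷ r) →
      All (λ c → All (Left c q) D) l → All (λ c → All (Left q c) D) r →
      AllPairs (λ a b → All (Left a b) D) (l ++ q ∷ r)
    cup-around {u} {l} {r} su ml mr mD o lq qr with pairs-++⁻ l o
    ... | o₁ , o₁₂ , (_ ∷ o₂) =
      AllPairs.++⁺ (cups ml mD (toV ml o₁)) (qr ∷ cups mr mD (toV mr o₂))
        (All.tabulate λ mc → All.lookup lq mc ∷ All.tabulate λ mc′ → All.map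
          (λ my → cup (All.lookup ml mc) (All.lookup mr mc′) my
            (reorder⁻ su (All.lookup ml mc) (All.lookup mr mc′)
              (All.lookup (All.tail (All.lookup o₁₂ mc)) mc′))) mD)
      where
      toV : ∀ {xs} → All (_∈ W) xs → AllPairs (_<[ u ]_) xs → AllPairs (_<[ v ]_) xs
      toV = pairs-within (reorder⁻ su)

    cupB : ∀ {l r d} → All (_∈ W) l → All (_∈ W) r → d ∈ Y → q <[ v ] d →
      AllPairs (_<[ v ]_) (l ++ q ∷ r) → Triples Left (l ++ q ∷ r) →
      All (λ c → Left c q d) l → All (λ c → Left q c d) r →
      Chain Left v q (W ++ Y) (suc (length l + length r))
    cupB {l} {r} {d} ml mr md q<d o t lqd qrd = chain {l = l} {r = r ++ d ∷ []}
      (All.map ∈-++⁺ˡ ml) (All.++⁺ (All.map ∈-++⁺ˡ mr) (∈-++⁺ʳ W md ∷ []))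
      (trans (cong (length l +_) (trans (length-++ r) (+-comm (length r) 1))) (+-suc (length l) (length r)))
      (subst (AllPairs _) assoc
        (AllPairs.++⁺ o ([] ∷ []) (All.++⁺ (All.map (λ mc → W<Y mc md ∷ []) ml)
          ((q<d ∷ []) ∷ All.map (λ mc → W<Y mc md ∷ []) mr))))
      (subst (Triples _) assoc (triples-++⁺ t
        (cup-around svW ml mr (md ∷ []) o (All.map (_∷ []) lqd) (All.map (_∷ []) qrd))
        (All.tabulate λ _ → [] ∷ []) ([] ∷ [])))
      where
      assoc : (l ++ q ∷ r) ++ d ∷ [] ≡ l ++ q ∷ (r ++ d ∷ [])
      assoc = ++-assoc l (q ∷ r) (d ∷ [])

    -- `q` belongs to the lower chain here and to the upper chain in `ngonA`. The cup may be sorted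
    -- along another direction `u`, since it can come from the claim in a turned direction.
    ngonB : ∀ {u l r D} → Sorts u W → All (_∈ W) l → All (_∈ W) r → All (_∈ Y) D →
      AllPairs (_<[ u ]_) (l ++ q ∷ r) → Triples Left (l ++ q ∷ r) →
      All (λ c → All (Left c q) D) l → All (λ c → All (Left q c) D) r →
      AllPairs (_<[ v ]_) D → Triples Right D → AllPairs (Right q) D →
      NGon (suc (length l + length r) + length D) q (W ++ Y)
    ngonB {u} {l} {r} {D} su ml mr mD o t lq qr oD tD qD = ngon {L = (l ++ q ∷ r) ++ reverse D}
      (∈-++⁺ˡ (∈-++⁺ʳ l (here refl)))
      (All.++⁺ (All.++⁺ (All.map (there ∘ ∈-++⁺ˡ) ml) (here refl ∷ All.map (there ∘ ∈-++⁺ˡ) mr))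
        (All.tabulate λ m → there (∈-++⁺ʳ W (All.lookup mD (Any.reverse⁻ m)))))
      (trans (length-++ (l ++ q ∷ r)) (cong₂ _+_
        (trans (length-++ l) (+-suc (length l) (length r))) (length-reverse D)))
      (join-polygon t tD (cup-around su ml mr mD o lq qr)
        (All.++⁺ (All.map (λ mc → caps mc mD oD) ml) (qD ∷ All.map (λ mc → caps mc mD oD) mr)))

    ngonA : ∀ {u A l r} → Sorts u W → All (_∈ W) A → All (_∈ Y) l → All (_∈ Y) r →
      AllPairs (_<[ u ]_) A → Triples Left A → AllPairs (λ a b → Left a b q) A →
      Triples Right (l ++ q ∷ r) → All (λ c → AllPairs (Right c) (l ++ q ∷ r)) A →
      NGon (length A + suc (length l + length r)) q (W ++ Y)
    ngonA {u} {A} {l} {r} su mA ml mr oA tA Aq tD AD = ngon {L = A ++ reverse (l ++ q ∷ r)}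
      (∈-++⁺ʳ A (Any.reverse⁺ (∈-++⁺ʳ l (here refl))))
      (All.++⁺ (All.map (there ∘ ∈-++⁺ˡ) mA) (All.tabulate λ m → All.lookup
        (All.++⁺ (All.map (there ∘ ∈-++⁺ʳ W) ml) (here refl ∷ All.map (there ∘ ∈-++⁺ʳ W) mr))
        (Any.reverse⁻ m)))
      (trans (length-++ A) (cong (length A +_) (trans (length-reverse (l ++ q ∷ r))
        (trans (length-++ l) (+-suc (length l) (length r))))))
      (join-polygon tA tD
        (AllPairs.zipWith (λ (p , q , s) → All.++⁺ p (q ∷ s)) (cups mA ml oV , AllPairs.zip (Aq , cups mA mr oV)))
        AD)
      where
      oV : AllPairs (_<[ v ]_) A
      oV = pairs-within (reorder⁻ su) mA oA

    cqd : ∀ {c d} → c ∈ W → d ∈ Y → Left c q d ⊎ Right c q d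
    cqd mc md with side (no-line-WY mc md)
    ... | inj₁ p = inj₂ (flipʳ p)
    ... | inj₂ p = inj₁ (flipˡ p)

    qcd : ∀ {c d} → c ∈ W → d ∈ Y → Left q c d ⊎ Right q c d
    qcd mc md with side (no-line-WY mc md)
    ... | inj₁ p = inj₁ (cyc² p)
    ... | inj₂ p = inj₂ (flipʳ (cyc (flipˡ p)))

    no-right : ∀ {l c r d} → AllPairs (_<[ v ]_) (l ++ q ∷ c ∷ r) → c ∈ W → d ∈ Y → d <[ v ] q → ⊥
    no-right {l} o mc md d<q with pairs-++⁻ l o
    ... | _ , _ , ((q<c ∷ _) ∷ _) = <v-asym q<c (below mc md d<q)

    -- The first point `d` of the cap decides, or the one next to `q` if `q` comes first. If every
    -- point of the cup turns left with `d` and `q`, taken in their order along `v`, the cup gains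
    -- `d`; a single point `c` that turns right can be added to the cap.
    sat-combine : ∀ {k m} → Chain Left v q W k → Chain Right v q Y (suc m) →
      Chain Left v q (W ++ Y) (suc k) ⊎ Chain Right v q (W ++ Y) (suc (suc m))
    sat-combine (chain {l} {c ∷ r} ml (mc ∷ _) _ o _) (chain {d ∷ l′} (md ∷ _) _ _ ((_∷_ {xs = _} p _)) _) =
      ⊥-elim (no-right {l} o mc md (All.head (All.++⁻ʳ l′ p)))
    sat-combine (chain {l} {[]} ml [] sz o t) (chain {d ∷ l′} {r′} md@(_ ∷ _) mr sz′ o′@(p ∷ _) t′)
      with all-or-some l (λ mc → side (no-line-WY (All.lookup ml mc) (All.head md)))
    ... | inj₁ ps = inj₁ (subst (Chain Left v q (W ++ Y)) (cong suc (trans (sym (+-identityʳ _)) sz))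
      (cupA ml (proj₁ (pairs-++⁻ l o)) (proj₁ (triples-++⁻ l t))
        (AllPairs.map All.head (proj₁ (proj₂ (triples-++⁻ l t)))) ps (All.head md)
        (All.head (All.++⁻ʳ l′ p))))
    ... | inj₂ (c , mc , cdq) = inj₂ (chain {l = c ∷ d ∷ l′} {r = r′}
      (∈-++⁺ˡ mcW ∷ All.map (∈-++⁺ʳ W) md) (All.map (∈-++⁺ʳ W) mr) (cong suc sz′)
      ((W<Y mcW (All.head md) ∷ All.map (<v-trans (W<Y mcW (All.head md))) p) ∷ o′)
      (capA mcW md mr o′ t′ cdq ∷ t′))
      where mcW = All.lookup ml mc
    sat-combine {k} {m} (chain {l} {r} ml mr sz o t)
      (chain {[]} {d ∷ r′} [] (md ∷ mr′) sz′ o′@((q<d ∷ q<r) ∷ od@(d<r ∷ _)) t′@((qdr ∷ qr) ∷ td))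
      with all-or-some l (λ mc → cqd (All.lookup ml mc) md) | all-or-some r (λ mc → qcd (All.lookup mr mc) md)
    ... | inj₁ ps | inj₁ ps′ = inj₁ (subst (Chain Left v q (W ++ Y)) (cong suc sz) (cupB ml mr md q<d o t ps ps′))
    ... | inj₂ (c , mc , p) | _ = inj₂ (chain {l = c ∷ []} {r = d ∷ r′}
      (∈-++⁺ˡ mcW ∷ []) (All.map (∈-++⁺ʳ W) (md ∷ mr′)) (cong suc sz′)
      ((c<q ∷ All.map (<v-trans c<q) (q<d ∷ q<r)) ∷ o′)
      ((capB md mr′ q<d d<r qdr mcW c<q p ∷ caps mcW (md ∷ mr′) od) ∷ t′))
      where
      mcW = All.lookup ml mc
      c<q = All.head (All.lookup (proj₁ (proj₂ (pairs-++⁻ l o))) mc)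
    ... | inj₁ _ | inj₂ (c , mc , p) = inj₂ (chain {l = []} {r = c ∷ d ∷ r′}
      [] (∈-++⁺ˡ mcW ∷ All.map (∈-++⁺ʳ W) (md ∷ mr′)) (cong suc sz′)
      ((q<c ∷ q<d ∷ q<r) ∷ All.map (W<Y mcW) (md ∷ mr′) ∷ od)
      ((capB′ md mr′ q<d d<r qdr mcW q<c p ∷ qdr ∷ qr) ∷ caps mcW (md ∷ mr′) od ∷ td))
      where
      mcW = All.lookup mr mc
      q<c = All.lookup (AllPairs.head (proj₂ (proj₂ (pairs-++⁻ l o)))) mc
    sat-combine (chain {l} _ _ _ _ _) (chain {[]} {[]} _ _ () _ _)

  -- A cap from `X` or a cup from `Y` is already large enough. What remains is a cup from `X` and a
  -- cap from `Y`, each one point short.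
  sat-join : ∀ {X Y k l} → Joins X Y → Sat k (suc (suc l)) X → Sat (suc k) (suc l) Y →
    Sat (suc k) (suc (suc l)) (X ++ Y)
  sat-join {X} {Y} J sX sY v q sv g with sX v q svW gW | sY v q svY gY
    where open Facts J sv g
  ... | inj₂ D | _ = inj₂ (chain-weaken ∈-++⁺ˡ D)
  ... | inj₁ _ | inj₁ C = inj₁ (chain-weaken (∈-++⁺ʳ X) C)
  ... | inj₁ C | inj₂ D = Facts.sat-combine J sv g C D

open CupsAndCaps

-- Convex polygons from a cup of the left part and a cap of the next block

module Polygons where
  open import Data.Nat using (ℕ; suc; _+_)
  open import Data.Nat.Properties using (+-suc; +-identityʳ)

  open Sorts
  open Generic
  open _<[_]_

  -- The equation counts a polygon: `k` points of the cup, `suc m` points of the cap, and `q`. The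
  -- claim is available for this `q` in every direction that sorts `W` generically.
  module Combine {W Y : List Point} (J : Joins W Y) {v q : Point}
    (sv : Sorts v (W ++ Y)) (g : Generic v q (W ++ Y)) {n k m : ℕ} (n≡ : k + suc (suc m) ≡ n)
    (claim : ∀ u → Sorts u W → Generic u q W → NGon n q W ⊎ Chain Left u q W k) where

    open Facts J sv g
    open Joins J

    Result : Set
    Result = NGon n q (W ++ Y) ⊎ Chain Left v q (W ++ Y) (suc k)

    old : NGon n q W → Result
    old N = inj₁ (ngon-weaken ∈-++⁺ˡ N)

    polygon : ∀ {n′} → n′ ≡ n → NGon n′ q (W ++ Y) → Result
    polygon e N = inj₁ (subst (λ n → NGon n q (W ++ Y)) e N)

    bigger-cup : ∀ {k′} → k′ ≡ k → Chain Left v q (W ++ Y) (suc k′) → Result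
    bigger-cup e C = inj₂ (subst (λ k → Chain Left v q (W ++ Y) (suc k)) e C)

    toV : ∀ {u xs} → Sorts u W → All (_∈ W) xs → AllPairs (_<[ u ]_) xs → AllPairs (_<[ v ]_) xs
    toV s = pairs-within (reorder⁻ s)

    -- Along `q ⊖ d` or `d ⊖ q`, being before or after `q` means being on one or the other side of
    -- the line `qd`. Ties are impossible, since no line through `d` and a point of `W` contains
    -- `q`.
    module Through {d} (md : d ∈ Y) where
      up<q : ∀ {c} → Left c d q → c <[ q ⊖ d ] q
      up<q p = before (left-heads p)

      q<up : ∀ {c} → Right c d q → q <[ q ⊖ d ] c
      q<up p = before (right-turn (flipʳ (cyc (cyc (flipˡ p)))))

      up<q⁻ : ∀ {c} → c <[ q ⊖ d ] q → Left c d q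
      up<q⁻ (before p) = heads-left p

      q<up⁻ : ∀ {c} → q <[ q ⊖ d ] c → Right c d q
      q<up⁻ (before p) = flipʳ (cyc (flipˡ (turn-right p)))

      up-generic : Generic (q ⊖ d) q W
      up-generic = generic
        (All.tabulate λ mp → Sum.map up<q q<up (side (no-line-WY mp md))) (no-line gW)

      dn<q : ∀ {c} → Left c q d → c <[ d ⊖ q ] q
      dn<q p = before (left-back p)

      q<dn : ∀ {c} → Left q c d → q <[ d ⊖ q ] c
      q<dn (left p) = before p

      dn<q⁻ : ∀ {c} → c <[ d ⊖ q ] q → Left c q d
      dn<q⁻ (before p) = back-left p

      q<dn⁻ : ∀ {c} → q <[ d ⊖ q ] c → Left q c d
      q<dn⁻ (before p) = left p

      dn-generic : Generic (d ⊖ q) q W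
      dn-generic = generic
        (All.tabulate λ mp → Sum.map dn<q (λ p → q<dn (flipq p)) (cqd mp md)) (no-line gW)
        where
        flipq : ∀ {c} → Right c q d → Left q c d
        flipq p = cyc² (flipˡ p)

    -- q is to the right of W. If the points of W disagree about the side of the
    -- line cd on which q lies, then turning the direction to dq sorts this out.
    module CaseA {d l′ r′} (md : All (_∈ Y) (d ∷ l′)) (mr : All (_∈ Y) r′)
      (sz : length (d ∷ l′) + length r′ ≡ suc m)
      (o : AllPairs (_<[ v ]_) (d ∷ l′ ++ q ∷ r′)) (t : Triples Right (d ∷ l′ ++ q ∷ r′)) where

      d∈ = All.head md
      open Through d∈

      d<q : d <[ v ] q
      d<q = All.head (All.++⁻ʳ l′ (AllPairs.head o))

      cupA′ : ∀ {u l} → Sorts u W → All (_∈ W) l → AllPairs (_<[ u ]_) (l ++ q ∷ []) →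
        Triples Left (l ++ q ∷ []) → All (λ c → Left c d q) l → length l + 0 ≡ k → Result
      cupA′ {l = l} s ml ol tl p e with triples-++⁻ l tl
      ... | tl′ , tlq , _ = bigger-cup (trans (sym (+-identityʳ _)) e)
        (cupA ml (toV s ml (proj₁ (pairs-++⁻ l ol))) tl′ (AllPairs.map All.head tlq) p d∈ d<q)

      ngonA′ : ∀ {u A} → Sorts u W → All (_∈ W) A → AllPairs (_<[ u ]_) A → Triples Left A →
        AllPairs (λ a b → Left a b q) A → All (λ c → Right c d q) A → length A ≡ k → Result
      ngonA′ s mA oA tA Aq p e = polygon (trans (cong₂ _+_ e (cong suc sz)) n≡)
        (ngonA s mA md mr oA tA Aq t (All.zipWith (λ (mc , p) → capA mc md mr o t p) (mA , p)))

      -- As `q` lies on different sides of the lines `c₁d` and `c₂d`, the direction `q ⊖ d` lies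
      -- between `d ⊖ c₁` and `d ⊖ c₂`, which sort `W` by the join.
      mixed : ∀ {c₁ c₂} → c₁ ∈ W → c₂ ∈ W → Left c₁ d q → Right c₂ d q → Sorts (q ⊖ d) W
      mixed {c₁} {c₂} m₁ m₂ p₁ p₂ =
        cone-sorts {d ⊖ c₁} {q ⊖ d} {d ⊖ c₂} (left-heads (cup m₁ m₂ d∈ c₁<c₂)) (right-turn {c₂} {d} {q} p₂) (left-back p₁)
          (sortsˡ m₁ d∈) (sortsˡ m₂ d∈)
        where
        c₁<c₂ : c₁ <[ v ] c₂
        c₁<c₂ with pairs-cmp (sorted svW) m₁ m₂
        ... | inj₁ refl = ⊥-elim (left-right p₁ p₂)
        ... | inj₂ (inj₁ lt) = lt
        ... | inj₂ (inj₂ lt) = ⊥-elim (left-right p₁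
          (lst⁻ (btw₁₃₄ lt (W<Y m₁ d∈) d<q) (cup m₂ m₁ d∈ lt) p₂))

      -- Left turns `abd`, `adq` and right turns `abq`, `bdq` would give the quadrilateral `abdq`
      -- two areas of opposite sign. Hence a cup in the turned direction lies on one side of the
      -- line `qd`.
      straddle : ∀ {a l b r} → Sorts (q ⊖ d) W → a ∈ W → b ∈ W →
        AllPairs (_<[ q ⊖ d ]_) (a ∷ l ++ q ∷ b ∷ r) → Triples Left (a ∷ l ++ q ∷ b ∷ r) → ⊥
      straddle {a} {l} {b} {r} s ma mb o′ t′ =
        no-four (cup ma mb d∈ (reorder⁻ s ma mb (All.head (All.tail a<))))
          (up<q⁻ (All.head a<)) (flipʳ (cyc (cyc (cyc aqb)))) (q<up⁻ q<b)
        where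
        a< : All (a <[ q ⊖ d ]_) (q ∷ b ∷ r)
        a< = All.++⁻ʳ l (AllPairs.head o′)
        q<b : q <[ q ⊖ d ] b
        q<b = All.head (AllPairs.head (proj₂ (proj₂ (pairs-++⁻ (a ∷ l) o′))))
        aqb : Left a q b
        aqb = All.head (AllPairs.head (All.head (proj₁ (proj₂ (proj₂ (triples-++⁻ (a ∷ l) t′))))))

      reclaimed : Sorts (q ⊖ d) W → Chain Left (q ⊖ d) q W k → Result
      reclaimed s (chain {l} {[]} ml [] e ol tl) =
        cupA′ s ml ol tl (All.map (λ lt → up<q⁻ (All.head lt)) (proj₁ (proj₂ (pairs-++⁻ l ol)))) e
      reclaimed s (chain {[]} {r@(_ ∷ _)} [] mr e (q<r ∷ or) (qr ∷ tr)) =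
        ngonA′ s mr or tr (AllPairs.map cyc qr) (All.map q<up⁻ q<r) e
      reclaimed s (chain {a ∷ l} {b ∷ r} (ma ∷ _) (mb ∷ _) e o′ t′) = ⊥-elim (straddle s ma mb o′ t′)

      reclaim : Sorts (q ⊖ d) W → Result
      reclaim s = Sum.[ old , reclaimed s ]′ (claim (q ⊖ d) s up-generic)

      result : Chain Left v q W k → Result
      result (chain {l} {c ∷ r} ml (mc ∷ _) _ oC _) = ⊥-elim (no-right {l} oC mc d∈ d<q)
      result (chain {l} {[]} ml [] e oC tC)
        with all-or-some l (λ mc → side (no-line-WY (All.lookup ml mc) d∈))
           | all-or-some l (λ mc → Sum.swap (side (no-line-WY (All.lookup ml mc) d∈)))
      ... | inj₁ p | _ = cupA′ svW ml oC tC p e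
      ... | inj₂ _ | inj₁ p = ngonA′ svW ml (proj₁ (pairs-++⁻ l oC)) (proj₁ (triples-++⁻ l tC))
        (AllPairs.map All.head (proj₁ (proj₂ (triples-++⁻ l tC)))) p (trans (sym (+-identityʳ _)) e)
      ... | inj₂ (_ , m₂ , p₂) | inj₂ (_ , m₁ , p₁) =
        reclaim (mixed (All.lookup ml m₁) (All.lookup ml m₂) p₁ p₂)

    -- q is to the left of its cap in Y. If q does not extend the cup by d, then some
    -- c₀ is on the wrong side of q seen from d, and the direction is turned to q and
    -- the first (Lower) or the last (Upper) point of the cap.
    module CaseB {d r′} (mD : All (_∈ Y) (d ∷ r′)) (sz : length (d ∷ r′) ≡ suc m)
      (q<D : All (q <[ v ]_) (d ∷ r′)) (oD : AllPairs (_<[ v ]_) (d ∷ r′))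
      (qD : AllPairs (Right q) (d ∷ r′)) (tD : Triples Right (d ∷ r′)) where

      d∈ = All.head mD
      q<d = All.head q<D

      capsB : ∀ {c} → c ∈ W → c <[ v ] q → Right c q d → All (Right c q) (d ∷ r′)
      capsB = capB d∈ (All.tail mD) q<d (AllPairs.head oD) (AllPairs.head qD)

      capsB′ : ∀ {c} → c ∈ W → q <[ v ] c → Right q c d → All (Right q c) (d ∷ r′)
      capsB′ = capB′ d∈ (All.tail mD) q<d (AllPairs.head oD) (AllPairs.head qD)

      -- `u` and `v` order `W` alike, so only the place of `q` has to be given.
      order-v : ∀ {u l r} → Sorts u W → All (_∈ W) l → All (_∈ W) r →
        AllPairs (_<[ u ]_) (l ++ q ∷ r) → All (_<[ v ] q) l → All (q <[ v ]_) r →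
        AllPairs (_<[ v ]_) (l ++ q ∷ r)
      order-v {u} {l} {r} s ml mr o l<q q<r = AllPairs.++⁺
        (toV s ml (proj₁ (pairs-++⁻ l o)))
        (q<r ∷ toV s mr (AllPairs.tail (proj₂ (proj₂ (pairs-++⁻ l o)))))
        (All.map (λ lt → lt ∷ All.map (<v-trans lt) q<r) l<q)

      cupB′ : ∀ {u l r y} → Sorts u W → All (_∈ W) l → All (_∈ W) r → y ∈ d ∷ r′ →
        AllPairs (_<[ u ]_) (l ++ q ∷ r) → Triples Left (l ++ q ∷ r) →
        All (_<[ v ] q) l → All (q <[ v ]_) r →
        All (λ c → Left c q y) l → All (λ c → Left q c y) r → length l + length r ≡ k → Result
      cupB′ s ml mr my o t l<q q<r lqy qry e = bigger-cup e
        (cupB ml mr (All.lookup mD my) (All.lookup q<D my) (order-v s ml mr o l<q q<r) t lqy qry)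

      ngonB′ : ∀ {u l r} → Sorts u W → All (_∈ W) l → All (_∈ W) r →
        AllPairs (_<[ u ]_) (l ++ q ∷ r) → Triples Left (l ++ q ∷ r) →
        All (λ c → All (Left c q) (d ∷ r′)) l → All (λ c → All (Left q c) (d ∷ r′)) r →
        length l + length r ≡ k → Result
      ngonB′ s ml mr o t lq qr e =
        polygon (trans (cong₂ _+_ (cong suc e) sz) (trans (sym (+-suc k (suc m))) n≡))
          (ngonB s ml mr mD o t lq qr oD tD qD)

      tie : ∀ {c} → c ∈ W → c <[ v ] q ⊎ q <[ v ] c
      tie mc = All.lookup (no-tie gW) mc

      module Lower {c₀} (m₀ : c₀ ∈ W) (c₀<q : c₀ <[ v ] q) (c₀qd : Right c₀ q d) where
        open Through d∈

        -- A left turn `c₀qc` and the right turn `c₀qd` would force a right turn `c₀cd`, against the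
        -- join.
        no-right′ : ∀ {c} → c ∈ W → q <[ v ] c → Left c₀ q c → ⊥
        no-right′ mc q<c p = left-right (cup m₀ mc d∈ (<v-trans c₀<q q<c))
          (lst⁻ (btw₁₂₃ c₀<q q<c (W<Y mc d∈)) p c₀qd)

        -- `q` leaves the cup and becomes the first point of the cap.
        all-right : ∀ {l} → All (_∈ W) l → AllPairs (_<[ v ]_) (l ++ q ∷ []) →
          Triples Left (l ++ q ∷ []) → All (λ c → Right c q d) l → length l + 0 ≡ k → Result
        all-right {l} ml o t p e = polygon (trans (cong₂ _+_ (trans (sym (+-identityʳ _)) e) (cong suc sz)) n≡)
          (ngonA svW ml [] mD (proj₁ (pairs-++⁻ l o)) (proj₁ (triples-++⁻ l t))
            (AllPairs.map All.head (proj₁ (proj₂ (triples-++⁻ l t)))) (qD ∷ tD)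
            (All.tabulate λ mc → capsB (All.lookup ml mc)
                (All.head (All.lookup (proj₁ (proj₂ (pairs-++⁻ l o))) mc)) (All.lookup p mc)
              ∷ caps (All.lookup ml mc) mD oD))

        mixed : ∀ {c} → c ∈ W → c <[ v ] q → Left c q d → Sorts (d ⊖ q) W
        mixed {c} mc c<q p = cone-sorts {d ⊖ c} {d ⊖ q} {d ⊖ c₀}
          (left-heads (cup mc m₀ d∈ c<c₀)) (left-heads {q} {c₀} {d} (cyc² (flipˡ c₀qd))) (left-heads p)
          (sortsˡ mc d∈) (sortsˡ m₀ d∈)
          where
          c<c₀ : c <[ v ] c₀
          c<c₀ with pairs-cmp (sorted svW) mc m₀
          ... | inj₁ refl = ⊥-elim (left-right p c₀qd)
          ... | inj₂ (inj₁ lt) = lt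
          ... | inj₂ (inj₂ lt) = ⊥-elim (left-right p
            (lst⁻ (btw₂₃₄ lt c<q q<d) (cup m₀ mc d∈ lt) c₀qd))

        q<c₀ : q <[ d ⊖ q ] c₀
        q<c₀ = q<dn (cyc² (flipˡ c₀qd))

        module _ (s : Sorts (d ⊖ q) W) {c₁ r} (m₁ : c₁ ∈ r) (c₁<q : c₁ <[ v ] q)
          (mr : All (_∈ W) r) where
          m₁W = All.lookup mr m₁

          passed : Left q c₁ d → All (Right c₁ q) (d ∷ r′)
          passed p = capsB m₁W c₁<q (flipʳ (cyc p))

          -- Along `v` the order is `c`, `c₁`, `q`, `d`, and right turns `cc₁q` and `c₁qd` force one
          -- at `cc₁d`, against the join.
          no-left : ∀ {c} → c ∈ W → c <[ d ⊖ q ] q → q <[ d ⊖ q ] c₁ → Left c q c₁ → ⊥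
          no-left mc c<q q<c₁ p = left-right (cup mc m₁W d∈ c<c₁)
            (mid⁻ (btw₁₂₄ c<c₁ c₁<q q<d) (flipʳ p) (All.head (passed (q<dn⁻ q<c₁))))
            where c<c₁ = reorder⁻ s mc m₁W (<v-trans c<q q<c₁)

          -- A point before `q` along `v` sees the whole cap on the left by `capsB`, a point after
          -- `q` by comparison with `c₁`.
          see : AllPairs (_<[ d ⊖ q ]_) (q ∷ r) → AllPairs (Left q) r →
            ∀ {c} → c ∈ r → All (Left q c) (d ∷ r′)
          see (q<r ∷ or) qr {c} mc with tie (All.lookup mr mc)
          ... | inj₁ c<q = All.map (λ p → cyc² (flipˡ p))
            (capsB (All.lookup mr mc) c<q (flipʳ (cyc (q<dn⁻ (All.lookup q<r mc)))))
          ... | inj₂ q<c = All.tabulate λ my →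
            lst⁺ (btw₁₃₄ c₁<q q<c (W<Y mcW (All.lookup mD my)))
              (flipʳ (cyc (pairs-transfer <v-asym or qr m₁ mc c₁<c)))
              (cup m₁W mcW (All.lookup mD my) (<v-trans c₁<q q<c))
            where
            mcW = All.lookup mr mc
            c₁<c : c₁ <[ d ⊖ q ] c
            c₁<c = pairs-transfer <v-asym (sorted svW) (sorted s) m₁W mcW (<v-trans c₁<q q<c)

        reclaimed : Sorts (d ⊖ q) W → Chain Left (d ⊖ q) q W k → Result
        reclaimed s (chain {l} {r} ml mr e o t) =
          Sum.[ cups-out , polygon-out ]′ (all-or-some r λ mc → Sum.swap (tie (All.lookup mr mc)))
          where
          l<q : All (_<[ d ⊖ q ] q) l
          l<q = All.map All.head (proj₁ (proj₂ (pairs-++⁻ l o)))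
          q<r : All (q <[ d ⊖ q ]_) r
          q<r = AllPairs.head (proj₂ (proj₂ (pairs-++⁻ l o)))
          -- Here nothing changes sides: `l` precedes `c₀` and therefore `q` along `v`, so the new
          -- cup is also a cup along `v` and gains `d`.
          cups-out : All (q <[ v ]_) r → Result
          cups-out q<r′ = cupB′ s ml mr (here refl) o t
            (All.zipWith (λ (mc , lt) → <v-trans (reorder⁻ s mc m₀ (<v-trans lt q<c₀)) c₀<q) (ml , l<q)) q<r′
            (All.map dn<q⁻ l<q) (All.map q<dn⁻ q<r) e
          -- If some `c₁` changed sides, `l` is empty by `no-left` and the rest of the cup sees the
          -- whole cap.
          polygon-out : ∃[ c ] (c ∈ r × c <[ v ] q) → Result
          polygon-out (c₁ , m₁ , c₁<q) = shape l ml l<q e o t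
            where
            shape : ∀ l → All (_∈ W) l → All (_<[ d ⊖ q ] q) l → length l + length r ≡ k →
              AllPairs (_<[ d ⊖ q ]_) (l ++ q ∷ r) → Triples Left (l ++ q ∷ r) → Result
            shape [] _ _ e o t@(qr ∷ _) = ngonB′ s [] mr o t []
              (All.tabulate (see s m₁ c₁<q mr o qr)) e
            shape (x ∷ xs) (mx ∷ _) (x<q ∷ _) _ _ t = ⊥-elim (no-left s m₁ c₁<q mr mx x<q (All.lookup q<r m₁)
              (All.lookup (AllPairs.head (All.head (proj₁ (proj₂ (proj₂ (triples-++⁻ (x ∷ xs) t)))))) m₁))

        reclaim : Sorts (d ⊖ q) W → Result
        reclaim s = Sum.[ old , reclaimed s ]′ (claim (d ⊖ q) s dn-generic)

        result : ∀ {l r} → All (_∈ W) l → All (_∈ W) r → c₀ ∈ l → length l + length r ≡ k →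
          AllPairs (_<[ v ]_) (l ++ q ∷ r) → Triples Left (l ++ q ∷ r) → Result
        result {l} {[]} ml [] _ e o t =
          Sum.[ (λ p → all-right ml o t p e) , (λ (_ , mc , p) → reclaim (mixed (All.lookup ml mc)
            (All.head (All.lookup (proj₁ (proj₂ (pairs-++⁻ l o))) mc)) p)) ]′
          (all-or-some l (λ mc → Sum.swap (cqd (All.lookup ml mc) d∈)))
        result {l} {c ∷ r} ml (mc ∷ _) m₀l e o t = ⊥-elim (no-right′ mc
          (All.head (AllPairs.head (proj₂ (proj₂ (pairs-++⁻ l o)))))
          (All.head (AllPairs.head (All.lookup (proj₁ (proj₂ (proj₂ (triples-++⁻ l t)))) m₀l))))

      module Upper {c₀} (m₀ : c₀ ∈ W) (q<c₀ : q <[ v ] c₀) (qc₀d : Right q c₀ d)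
        {z} (z∈ : z ∈ d ∷ r′) (z-last : ∀ {y} → y ∈ d ∷ r′ → y ≡ z ⊎ y <[ v ] z) where

        z∈Y = All.lookup mD z∈
        q<z = All.lookup q<D z∈
        open Through z∈Y

        qc₀D : All (Right q c₀) (d ∷ r′)
        qc₀D = capsB′ m₀ q<c₀ qc₀d

        c₀qz : Left c₀ q z
        c₀qz = cyc² (flipˡ (All.lookup qc₀D z∈))

        -- `z ⊖ q` lies between `z ⊖ c₀` and `v`. As `v` itself bounds the cone, one exceptional
        -- point is enough, unlike in `Lower`.
        turned : Sorts (z ⊖ q) W
        turned = cone-sorts {z ⊖ c₀} {z ⊖ q} {v} (dir-pos (W<Y m₀ z∈Y)) (dir-pos q<z) (left-heads c₀qz)
          (sortsˡ m₀ z∈Y) svW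

        after : Sorts (z ⊖ q) W → ∀ {c} → c ∈ W → Left q c z → q <[ v ] c
        after s mc p = <v-trans q<c₀ (reorder⁻ s m₀ mc (<v-trans (dn<q c₀qz) (q<dn p)))

        -- The last point `z` is the hardest to see: for an earlier `y`, the right turn `cyz` turns
        -- the sign at `qcz` into the sign at `qcy`.
        see : ∀ {c} → c ∈ W → q <[ v ] c → Left q c z → All (Left q c) (d ∷ r′)
        see {c} mc q<c p = All.tabulate go
          where
          go : ∀ {y} → y ∈ d ∷ r′ → Left q c y
          go my with z-last my
          ... | inj₁ refl = p
          ... | inj₂ y<z = fst⁺ (btw₁₂₄ q<c (W<Y mc (All.lookup mD my)) y<z) p
            (cap mc (All.lookup mD my) z∈Y y<z)

        module Passed (s : Sorts (z ⊖ q) W) {l p} (ml : All (_∈ W) l)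
          (ol : AllPairs (_<[ z ⊖ q ]_) l) (lq : AllPairs (λ a b → Left a b q) l)
          (l<q : All (_<[ z ⊖ q ] q) l) (mp : p ∈ l) (q<p : q <[ v ] p) where

          mpW = All.lookup ml mp

          unseen : ∀ {c} → c ∈ l → Left q c z → ⊥
          unseen mc p = left-asym p (cyc (dn<q⁻ (All.lookup l<q mc)))

          -- If some `c` stayed before `q`, the right turn `cqp` and the left turn `cpz` would force
          -- a left turn `qpz`, although `p` precedes `q` along `z ⊖ q`.
          all-after : ∀ {c} → c ∈ l → q <[ v ] c
          all-after mc with tie (All.lookup ml mc)
          ... | inj₂ q<c = q<c
          ... | inj₁ c<q = ⊥-elim (unseen mp
            (lst⁺ (btw₁₃₄ c<q q<p (W<Y mpW z∈Y))
              (flipʳ (pairs-transfer <v-asym ol lq mc mp c<p)) (cup mcW mpW z∈Y (<v-trans c<q q<p))))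
            where
            mcW = All.lookup ml mc
            c<p = pairs-transfer <v-asym (sorted svW) (sorted s) mcW mpW (<v-trans c<q q<p)

          -- Left turns `qxy` and `xyz` would force one at `qxz`. Hence once a point of `l` has
          -- changed sides, it is the only point of `l`.
          one : ∀ {x y} → x ∈ l → y ∈ l → x <[ z ⊖ q ] y → Left x y q → ⊥
          one mx my x<y xyq = unseen mx
            (mid⁺ (btw₁₂₄ (all-after mx) x<y′ (W<Y myW z∈Y)) (cyc² xyq) (cup mxW myW z∈Y x<y′))
            where
            mxW = All.lookup ml mx
            myW = All.lookup ml my
            x<y′ = reorder⁻ s mxW myW x<y

        -- The single point of the new cup that changed sides is exchanged for c₀, which
        -- all points of the cap see on that side.
        replaced : ∀ {r} → Sorts (z ⊖ q) W → All (_∈ W) r → AllPairs (_<[ z ⊖ q ]_) (q ∷ r) →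
          Triples Left (q ∷ r) → suc (length r) ≡ k → Result
        replaced {r} s mr o@(q<r ∷ or) t@(qr ∷ tr) e = ngonB′ {l = c₀ ∷ []} s (m₀ ∷ []) mr
          ((c₀<q ∷ All.map (<v-trans c₀<q) q<r) ∷ o)
          ((All.tabulate c₀qb ∷ c₀bb) ∷ t)
          (All.map (λ p → cyc² (flipˡ p)) qc₀D ∷ [])
          (All.tabulate λ mb → see (All.lookup mr mb) (q<b mb) (qbz mb)) e
          where
          c₀<q = dn<q c₀qz
          qbz : ∀ {b} → b ∈ r → Left q b z
          qbz mb = q<dn⁻ (All.lookup q<r mb)
          q<b : ∀ {b} → b ∈ r → q <[ v ] b
          q<b mb = after s (All.lookup mr mb) (qbz mb)
          c₀<b : ∀ {b} → b ∈ r → c₀ <[ v ] b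
          c₀<b mb = reorder⁻ s m₀ (All.lookup mr mb) (<v-trans c₀<q (All.lookup q<r mb))
          c₀qb : ∀ {b} → b ∈ r → Left c₀ q b
          c₀qb mb = cyc² (flipˡ (fst⁻ (btw₁₂₃ q<c₀ (c₀<b mb) (W<Y (All.lookup mr mb) z∈Y))
            (All.lookup qc₀D z∈) (qbz mb)))
          c₀bb : AllPairs (λ b b′ → Left c₀ b b′) r
          c₀bb = pairs-within
            (λ mb mb′ (b<b′ , p) → mid⁺ (btw₁₃₄ c₀<q (All.lookup q<r mb) b<b′) (c₀qb mb) p)
            (All.tabulate λ mb → mb) (AllPairs.zip (or , qr))

        reclaimed : Sorts (z ⊖ q) W → Chain Left (z ⊖ q) q W k → Result
        reclaimed s (chain {l} {r} ml mr e o t) =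
          Sum.[ cups-out , (λ (p , mp , q<p) → shape l ml l<q mp q<p e o t) ]′
            (all-or-some l λ mc → tie (All.lookup ml mc))
          where
          l<q : All (_<[ z ⊖ q ] q) l
          l<q = All.map All.head (proj₁ (proj₂ (pairs-++⁻ l o)))
          q<r : All (q <[ z ⊖ q ]_) r
          q<r = AllPairs.head (proj₂ (proj₂ (pairs-++⁻ l o)))
          cups-out : All (_<[ v ] q) l → Result
          cups-out l<q′ = cupB′ s ml mr z∈ o t l<q′
            (All.zipWith (λ (mc , lt) → after s mc (q<dn⁻ lt)) (mr , q<r))
            (All.map dn<q⁻ l<q) (All.map q<dn⁻ q<r) e
          shape : ∀ l {p} → All (_∈ W) l → All (_<[ z ⊖ q ] q) l → p ∈ l → q <[ v ] p →
            length l + length r ≡ k → AllPairs (_<[ z ⊖ q ]_) (l ++ q ∷ r) →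
            Triples Left (l ++ q ∷ r) → Result
          shape (x ∷ []) _ _ _ _ e (_ ∷ o) (_ ∷ t) = replaced s mr o t e
          shape l@(x ∷ y ∷ l′) ml l<q mp q<p _ o t = ⊥-elim (Passed.one s ml
            (proj₁ (pairs-++⁻ l o)) (AllPairs.map All.head (proj₁ (proj₂ (triples-++⁻ l t))))
            l<q mp q<p (here refl) (there (here refl)) (All.head (AllPairs.head o))
            (All.head (All.head (AllPairs.head (proj₁ (proj₂ (triples-++⁻ l t)))))))

        result : Result
        result = Sum.[ old , reclaimed turned ]′ (claim (z ⊖ q) turned dn-generic)

      result : Chain Left v q W k → Result
      result (chain {l} {r} ml mr e o t) =
        decide (all-or-some l (λ mc → cqd (All.lookup ml mc) d∈)) (all-or-some r (λ mc → qcd (All.lookup mr mc) d∈))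
        where
        l<q : All (_<[ v ] q) l
        l<q = All.map All.head (proj₁ (proj₂ (pairs-++⁻ l o)))
        q<r : All (q <[ v ]_) r
        q<r = AllPairs.head (proj₂ (proj₂ (pairs-++⁻ l o)))
        decide : All (λ c → Left c q d) l ⊎ ∃[ c ] (c ∈ l × Right c q d) →
          All (λ c → Left q c d) r ⊎ ∃[ c ] (c ∈ r × Right q c d) → Result
        decide (inj₂ (c , mc , p)) _ =
          Lower.result (All.lookup ml mc) (All.lookup l<q mc) p ml mr mc e o t
        decide (inj₁ _) (inj₂ (c , mc , p)) with last-of d r′ oD
        ... | z , z∈ , z-last = Upper.result (All.lookup mr mc) (All.lookup q<r mc) p z∈ z-last
        decide (inj₁ p) (inj₁ p′) = cupB′ svW ml mr (here refl) o t l<q q<r p p′ e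

    combine : Chain Left v q W k → Chain Right v q Y (suc m) → Result
    combine C (chain {d ∷ l′} {r′} md mr sz o t) = CaseA.result md mr sz o t C
    combine C (chain {[]} {d ∷ r′} [] mD sz (q<D ∷ oD) (qD ∷ tD)) = CaseB.result mD sz q<D oD qD tD C
    combine C (chain {[]} {[]} _ _ () _ _)

  -- Only the claim for `W` is consulted in turned directions; `Y` is consulted along `v` alone.
  claim-join : ∀ {W Y n k m} → Joins W Y → k + suc (suc m) ≡ n →
    Claim n k W → Sat (suc k) (suc m) Y → Claim n (suc k) (W ++ Y)
  claim-join {W} {Y} {n} {k} {m} J n≡ cW sY v q sv g =
    finish (cW v q svW gW) (sY v q svY gY)
    where
    open Facts J sv g
    finish : NGon n q W ⊎ Chain Left v q W k → Chain Left v q Y (suc k) ⊎ Chain Right v q Y (suc m) →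
      NGon n q (W ++ Y) ⊎ Chain Left v q (W ++ Y) (suc k)
    finish _ (inj₁ C) = inj₂ (chain-weaken (∈-++⁺ʳ W) C)
    finish (inj₁ N) _ = inj₁ (ngon-weaken ∈-++⁺ˡ N)
    finish (inj₂ C) (inj₂ D) = Combine.combine J sv g n≡ (λ u → cW u q) C D

open Polygons

-- Points inside triangles, and the failure of convex position

module Hulls where
  open import Data.Rational using (ℚ; 0ℚ; 1ℚ; -_; _+_; _*_; _-_; 1/_; _≤_; Positive; NonZero; positive)
  open import Data.Rational.Properties
  open import Data.Rational.Solver
  open import Data.Nat using (suc)

  open +-*-Solver using (solve; _:*_; _:+_; _:-_; :-_; _:=_; con)

  wsum : (Point → ℚ) → List ℚ → List Point → ℚ
  wsum f w Q = sumℚ (zipWith (λ λi q → λi * f q) w Q)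

  hull-⊆ : ∀ {p Q Q′} → Q ⊆ Q′ → InConvexHull p Q → InConvexHull p Q′
  hull-⊆ {p} {Q} {Q′} τ (w , len , w≥0 , s , sx , sy) with pad τ w len w≥0
    where
    pad : ∀ {Q Q′} → Q ⊆ Q′ → ∀ w → length w ≡ length Q → All (0ℚ ≤_) w →
      ∃[ w′ ] (length w′ ≡ length Q′ × All (0ℚ ≤_) w′ × sumℚ w′ ≡ sumℚ w ×
        (∀ f → wsum f w′ Q′ ≡ wsum f w Q))
    pad [] [] e [] = [] , refl , [] , refl , λ _ → refl
    pad (y ∷ʳ τ) w e w≥0 with pad τ w e w≥0
    ... | w′ , e′ , w′≥0 , s , fs = 0ℚ ∷ w′ , cong suc e′ , ≤-refl ∷ w′≥0 , trans (+-identityˡ _) s ,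
      λ f → trans (trans (cong (_+ wsum f w′ _) (*-zeroˡ (f y))) (+-identityˡ _)) (fs f)
    pad (_∷_ {y = y} refl τ) (x ∷ w) e (x≥0 ∷ w≥0) with pad τ w (ℕ-suc e) w≥0
      where
      ℕ-suc : ∀ {m n} → suc m ≡ suc n → m ≡ n
      ℕ-suc refl = refl
    ... | w′ , e′ , w′≥0 , s , fs = x ∷ w′ , cong suc e′ , x≥0 ∷ w′≥0 , cong (x +_) s ,
      λ f → cong (x * f y +_) (fs f)
  ... | w′ , len′ , w′≥0 , s′ , fs =
    w′ , len′ , w′≥0 , trans s′ s , trans (fs proj₁) sx , trans (fs proj₂) sy

  barycentric : ∀ {p x y z α β γ} → Pos α → Pos β → Pos γ →
    (α + β + γ) * proj₁ p ≡ α * proj₁ x + β * proj₁ y + γ * proj₁ z →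
    (α + β + γ) * proj₂ p ≡ α * proj₂ x + β * proj₂ y + γ * proj₂ z →
    InConvexHull p (x ∷ y ∷ z ∷ [])
  barycentric {p} {x} {y} {z} {α} {β} {γ} α⁺ β⁺ γ⁺ ex ey =
    α * D⁻¹ ∷ β * D⁻¹ ∷ γ * D⁻¹ ∷ [] , refl ,
    <⇒≤ (pos-* α⁺ i⁺) ∷ <⇒≤ (pos-* β⁺ i⁺) ∷ <⇒≤ (pos-* γ⁺ i⁺) ∷ [] ,
    trans (solve 4 (λ α β γ i → α :* i :+ (β :* i :+ (γ :* i :+ con 0ℚ)) := (α :+ β :+ γ) :* i) refl α β γ D⁻¹) inv ,
    coordinate ex , coordinate ey
    where
    D = α + β + γ
    D⁺ : Pos D
    D⁺ = pos-+ (pos-+ α⁺ β⁺) γ⁺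
    instance
      D-pos : Positive D
      D-pos = positive D⁺
      D-nz : NonZero D
      D-nz = pos⇒nonZero D
    D⁻¹ = 1/ D
    i⁺ : Pos D⁻¹
    i⁺ = positive⁻¹ D⁻¹ {{1/pos⇒pos D}}
    inv : D * D⁻¹ ≡ 1ℚ
    inv = *-inverseʳ D
    coordinate : ∀ {p x y z} → D * p ≡ α * x + β * y + γ * z →
      α * D⁻¹ * x + (β * D⁻¹ * y + (γ * D⁻¹ * z + 0ℚ)) ≡ p
    coordinate {p} {x} {y} {z} e = trans
      (solve 7 (λ α β γ i x y z → α :* i :* x :+ (β :* i :* y :+ (γ :* i :* z :+ con 0ℚ)) :=
        i :* (α :* x :+ β :* y :+ γ :* z)) refl α β γ D⁻¹ x y z)
      (trans (cong (D⁻¹ *_) (sym e))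
      (trans (solve 3 (λ i D p → i :* (D :* p) := (D :* i) :* p) refl D⁻¹ D p)
      (trans (cong (_* p) inv) (*-identityˡ p))))

  Turn : Bool → Point → Point → Point → Set
  Turn true = Left
  Turn false = Right

  flip-turn : ∀ s {a b c} → Turn s a b c → Turn (not s) a c b
  flip-turn true p = flipʳ p
  flip-turn false p = flipˡ p

  cyc-turn : ∀ s {a b c} → Turn s a b c → Turn s b c a
  cyc-turn true p = cyc p
  cyc-turn false p = flipʳ (cyc² (flipˡ p))

  -- The areas of the triangles opposite to the vertices are barycentric coordinates of `p`.
  -- Clockwise triangles are reduced to counterclockwise ones by exchanging `y` and `z`.
  in-triangle : ∀ s {p x y z} → Turn s p y z → Turn s x p z → Turn s x y p →
    InConvexHull p (x ∷ y ∷ z ∷ [])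
  in-triangle true {p} {x} {y} {z} (left α) (left β) (left γ) = barycentric α β γ (onX p x y z) (onY p x y z)
    where
    onX : ∀ p x y z → (cross p y z + cross x p z + cross x y p) * proj₁ p ≡
      cross p y z * proj₁ x + cross x p z * proj₁ y + cross x y p * proj₁ z
    onX (px , py) (x₁ , x₂) (y₁ , y₂) (z₁ , z₂) = solve 8 (λ px py x₁ x₂ y₁ y₂ z₁ z₂ →
      (crossP px py y₁ y₂ z₁ z₂ :+ crossP x₁ x₂ px py z₁ z₂ :+ crossP x₁ x₂ y₁ y₂ px py) :* px :=
      crossP px py y₁ y₂ z₁ z₂ :* x₁ :+ crossP x₁ x₂ px py z₁ z₂ :* y₁ :+ crossP x₁ x₂ y₁ y₂ px py :* z₁)
      refl px py x₁ x₂ y₁ y₂ z₁ z₂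
    onY : ∀ p x y z → (cross p y z + cross x p z + cross x y p) * proj₂ p ≡
      cross p y z * proj₂ x + cross x p z * proj₂ y + cross x y p * proj₂ z
    onY (px , py) (x₁ , x₂) (y₁ , y₂) (z₁ , z₂) = solve 8 (λ px py x₁ x₂ y₁ y₂ z₁ z₂ →
      (crossP px py y₁ y₂ z₁ z₂ :+ crossP x₁ x₂ px py z₁ z₂ :+ crossP x₁ x₂ y₁ y₂ px py) :* py :=
      crossP px py y₁ y₂ z₁ z₂ :* x₂ :+ crossP x₁ x₂ px py z₁ z₂ :* y₂ :+ crossP x₁ x₂ y₁ y₂ px py :* z₂)
      refl px py x₁ x₂ y₁ y₂ z₁ z₂
  in-triangle false {p} {x} {y} {z} α β γ = hull-swap
    (in-triangle true (flipˡ α) (flipˡ γ) (flipˡ β))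
    where
    hull-swap : InConvexHull p (x ∷ z ∷ y ∷ []) → InConvexHull p (x ∷ y ∷ z ∷ [])
    hull-swap (a ∷ b ∷ c ∷ [] , refl , (a≥0 ∷ b≥0 ∷ c≥0 ∷ []) , s , sx , sy) =
      a ∷ c ∷ b ∷ [] , refl , a≥0 ∷ c≥0 ∷ b≥0 ∷ [] ,
      trans (swap a c b) s , trans (swap (a * proj₁ x) (c * proj₁ y) (b * proj₁ z)) sx ,
      trans (swap (a * proj₂ x) (c * proj₂ y) (b * proj₂ z)) sy
      where
      swap : ∀ a c b → a + (c + (b + 0ℚ)) ≡ a + (b + (c + 0ℚ))
      swap = solve 3 (λ a c b → a :+ (c :+ (b :+ con 0ℚ)) := a :+ (b :+ (c :+ con 0ℚ))) refl

  ⊆-split : ∀ {A : Set} (xs : List A) {p ys S} → xs ++ p ∷ ys ⊆ S →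
    ∃[ pre ] ∃[ post ] (S ≡ pre ++ p ∷ post × xs ⊆ pre × ys ⊆ post)
  ⊆-split [] (refl ∷ τ) = [] , _ , refl , [] , τ
  ⊆-split [] (y ∷ʳ τ) with ⊆-split [] τ
  ... | pre , post , refl , τ₁ , τ₂ = y ∷ pre , post , refl , y ∷ʳ τ₁ , τ₂
  ⊆-split (x ∷ xs) (refl ∷ τ) with ⊆-split xs τ
  ... | pre , post , refl , τ₁ , τ₂ = x ∷ pre , post , refl , refl ∷ τ₁ , τ₂
  ⊆-split (x ∷ xs) (y ∷ʳ τ) with ⊆-split (x ∷ xs) τ
  ... | pre , post , refl , τ₁ , τ₂ = y ∷ pre , post , refl , y ∷ʳ τ₁ , τ₂

  inner-point : ∀ {S} xs {p ys} → ConvexPosition S → xs ++ p ∷ ys ⊆ S → InConvexHull p (xs ++ ys) → ⊥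
  inner-point xs cp τ h with ⊆-split xs τ
  ... | pre , post , e , τ₁ , τ₂ = cp pre _ post e (hull-⊆ (++⁺ τ₁ τ₂) h)

  turn-not-not : ∀ s {a b c} → Turn (not (not s)) a b c → Turn s a b c
  turn-not-not true p = p
  turn-not-not false p = p

  -- The signs put `b` inside the triangle `acd`; in `inner-third` they put `c` inside `abd`.
  inner-second : ∀ s {S a b c d} → ConvexPosition S → a ∷ b ∷ c ∷ d ∷ [] ⊆ S →
    Turn (not s) a b c → Turn s a b d → Turn s b c d → ⊥
  inner-second s cp τ abc abd bcd = inner-point (_ ∷ []) cp τ
    (in-triangle s bcd abd (turn-not-not s (flip-turn (not s) abc)))

  inner-third : ∀ s {S a b c d} → ConvexPosition S → a ∷ b ∷ c ∷ d ∷ [] ⊆ S →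
    Turn s a b c → Turn s a c d → Turn (not s) b c d → ⊥
  inner-third s cp τ abc acd bcd = inner-point (_ ∷ _ ∷ []) cp τ (in-triangle s
    (turn-not-not s (cyc-turn (not (not s)) (cyc-turn (not (not s)) (flip-turn (not s) bcd)))) acd abc)

open Hulls

-- Bounds on cups, caps and convex subsets of a join

module FreeSets where
  open import Data.Rational using (0ℚ)
  open import Data.Nat using (ℕ; suc; _+_; _≤_; s≤s)
  open import Data.Nat.Properties

  ⊆-++⁻ : ∀ {A : Set} {S : List A} xs {ys} → S ⊆ xs ++ ys →
    ∃[ S₁ ] ∃[ S₂ ] (S ≡ S₁ ++ S₂ × S₁ ⊆ xs × S₂ ⊆ ys)
  ⊆-++⁻ [] τ = [] , _ , refl , [] , τ
  ⊆-++⁻ (x ∷ xs) (.x ∷ʳ τ) with ⊆-++⁻ xs τ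
  ... | S₁ , S₂ , e , τ₁ , τ₂ = S₁ , S₂ , e , x ∷ʳ τ₁ , τ₂
  ⊆-++⁻ (x ∷ xs) (refl ∷ τ) with ⊆-++⁻ xs τ
  ... | S₁ , S₂ , refl , τ₁ , τ₂ = x ∷ S₁ , S₂ , refl , refl ∷ τ₁ , τ₂

  pairs-⊆ : ∀ {A : Set} {R : A → A → Set} {xs ys} → xs ⊆ ys → AllPairs R ys → AllPairs R xs
  pairs-⊆ [] [] = []
  pairs-⊆ (y ∷ʳ τ) (_ ∷ p) = pairs-⊆ τ p
  pairs-⊆ (refl ∷ τ) (r ∷ p) = All-resp-⊆ τ r ∷ pairs-⊆ τ p

  triples-⊆ : ∀ {A : Set} {R : A → A → A → Set} {xs ys} → xs ⊆ ys → Triples R ys → Triples R xs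
  triples-⊆ [] [] = []
  triples-⊆ (y ∷ʳ τ) (_ ∷ t) = triples-⊆ τ t
  triples-⊆ (refl ∷ τ) (p ∷ t) = pairs-⊆ τ p ∷ triples-⊆ τ t

  triples-lookup : ∀ {A : Set} {R : A → A → A → Set} {xs a b c} →
    Triples R xs → a ∷ b ∷ c ∷ [] ⊆ xs → R a b c
  triples-lookup t τ with triples-⊆ τ t
  ... | ((r ∷ _) ∷ _) ∷ _ = r

  pairs-tabulate : ∀ {A : Set} {R : A → A → Set} {xs} →
    (∀ {a b} → a ∷ b ∷ [] ⊆ xs → R a b) → AllPairs R xs
  pairs-tabulate {xs = []} f = []
  pairs-tabulate {xs = x ∷ xs} f =
    All.tabulate (λ m → f (refl ∷ single m)) ∷ pairs-tabulate (λ τ → f (x ∷ʳ τ))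
    where
    single : ∀ {x xs} → x ∈ xs → x ∷ [] ⊆ xs
    single (here refl) = refl ∷ minimum _
    single (there m) = _ ∷ʳ single m

  triples-tabulate : ∀ {A : Set} {R : A → A → A → Set} {xs} →
    (∀ {a b c} → a ∷ b ∷ c ∷ [] ⊆ xs → R a b c) → Triples R xs
  triples-tabulate {xs = []} f = []
  triples-tabulate {xs = x ∷ xs} f =
    pairs-tabulate (λ τ → f (refl ∷ τ)) ∷ triples-tabulate (λ τ → f (x ∷ʳ τ))

  NonCollinear : List Point → Set
  NonCollinear = Triples (λ a b c → cross a b c ≢ 0ℚ)

  -- Cups and caps are read in list order, which the constructions keep equal to the order along the
  -- vertical.
  record Free (k l m : ℕ) (X : List Point) : Set where
    field
      proper : NonCollinear X
      cup-bound : ∀ {S} → S ⊆ X → Triples Left S → length S ≤ k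
      cap-bound : ∀ {S} → S ⊆ X → Triples Right S → length S ≤ l
      convex-bound : ∀ {S} → S ⊆ X → ConvexPosition S → length S ≤ m
  open Free

  module _ {W Y : List Point} (J : Joins W Y) where
    open Joins J
    open Sorts

    cup-join : ∀ {y} → y ∈ Y → AllPairs (λ a b → Left a b y) W
    cup-join my = pairs-tabulate λ τ → go (lookup τ (here refl)) τ
      where
      go : ∀ {a b} → a ∈ W → a ∷ b ∷ [] ⊆ W → Left a b _
      go ma τ with pairs-⊆ τ (sorted (sortsˡ ma my))
      ... | (before p ∷ _) ∷ _ = left p

    cap-join : ∀ {w} → w ∈ W → AllPairs (Right w) Y
    cap-join mw = pairs-tabulate λ τ → go (lookup τ (here refl)) τ
      where
      go : ∀ {a b} → a ∈ Y → a ∷ b ∷ [] ⊆ Y → Right _ a b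
      go ma τ with pairs-⊆ τ (sorted (sortsʳ mw ma))
      ... | (before p ∷ _) ∷ _ = turn-right p

    -- A cup of `W` can gain one point of `Y`, a cap of `Y` one point of `W`, and a convex set
    -- meeting both sides is a cup and a cap. The resulting bounds have slack because blocks and
    -- rows use different ones.
    free-join : ∀ {k k′ l l′ m m′ k″ l″ m″} → Free k l m W → Free k′ l′ m′ Y →
      suc k ≤ k″ → k′ ≤ k″ → l ≤ l″ → suc l′ ≤ l″ → m ≤ m″ → m′ ≤ m″ → k + l′ ≤ m″ →
      Free k″ l″ m″ (W ++ Y)
    free-join {k} {k′} {l} {l′} {m} {m′} {k″} {l″} {m″} fW fY h₁ h₂ h₃ h₄ h₅ h₆ h₇ = record
      { proper = triples-++⁺ (proper fW)
          (pairs-All (λ my → AllPairs.map left≢0 (cup-join my)))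
          (All.tabulate (λ mw → AllPairs.map right≢0 (cap-join mw))) (proper fY)
      ; cup-bound = λ {S} τ t → cups S t (⊆-++⁻ W τ)
      ; cap-bound = λ {S} τ t → caps S t (⊆-++⁻ W τ)
      ; convex-bound = λ {S} τ cp → convexes S cp (⊆-++⁻ W τ)
      }
      where
      Split : List Point → Set
      Split S = ∃[ S₁ ] ∃[ S₂ ] (S ≡ S₁ ++ S₂ × S₁ ⊆ W × S₂ ⊆ Y)

      cups : ∀ S → Triples Left S → Split S → length S ≤ k″
      cups _ t ([] , S₂ , refl , _ , τ₂) = ≤-trans (cup-bound fY τ₂ t) h₂
      cups _ t (S₁ , [] , refl , τ₁ , _) rewrite ++-identityʳ S₁ =
        ≤-trans (cup-bound fW τ₁ t) (≤-trans (n≤1+n _) h₁)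
      cups _ t (S₁ , y ∷ [] , refl , τ₁ , _) = begin
        length (S₁ ++ y ∷ [])  ≡⟨ trans (length-++ S₁) (+-comm (length S₁) 1) ⟩
        suc (length S₁)        ≤⟨ s≤s (cup-bound fW τ₁ (proj₁ (triples-++⁻ S₁ t))) ⟩
        suc k                  ≤⟨ h₁ ⟩
        k″                     ∎
        where open ≤-Reasoning
      cups _ t (x ∷ S₁ , y ∷ y′ ∷ S₂ , refl , τ₁ , τ₂) = ⊥-elim (left-right
        (triples-lookup t (refl ∷ ++⁺ˡ S₁ (refl ∷ refl ∷ minimum S₂)))
        (All.head (AllPairs.head (pairs-⊆ τ₂ (cap-join (lookup τ₁ (here refl)))))))

      caps : ∀ S → Triples Right S → Split S → length S ≤ l″
      caps _ t ([] , S₂ , refl , _ , τ₂) = ≤-trans (cap-bound fY τ₂ t) (≤-trans (n≤1+n _) h₄)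
      caps _ (_ ∷ t) (x ∷ [] , S₂ , refl , _ , τ₂) = ≤-trans (s≤s (cap-bound fY τ₂ t)) h₄
      caps _ t (S₁ , [] , refl , τ₁ , _) rewrite ++-identityʳ S₁ =
        ≤-trans (cap-bound fW τ₁ t) h₃
      caps _ t (x ∷ x′ ∷ S₁ , y ∷ S₂ , refl , τ₁ , τ₂) = ⊥-elim (left-right
        (All.head (AllPairs.head (pairs-⊆ τ₁ (cup-join (lookup τ₂ (here refl))))))
        (triples-lookup t (refl ∷ refl ∷ ++⁺ˡ S₁ (refl ∷ minimum S₂))))

      convexes : ∀ S → ConvexPosition S → Split S → length S ≤ m″
      convexes _ cp ([] , S₂ , refl , _ , τ₂) = ≤-trans (convex-bound fY τ₂ cp) h₆
      convexes _ cp (S₁ , [] , refl , τ₁ , _) rewrite ++-identityʳ S₁ =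
        ≤-trans (convex-bound fW τ₁ cp) h₅
      convexes _ cp (S₁@(x ∷ _) , S₂@(y ∷ _) , refl , τ₁ , τ₂) = begin
        length (S₁ ++ S₂)      ≡⟨ length-++ S₁ ⟩
        length S₁ + length S₂  ≤⟨ +-mono-≤ (cup-bound fW τ₁ lower) (cap-bound fY τ₂ upper) ⟩
        k + l′                 ≤⟨ h₇ ⟩
        m″                     ∎
        where
        open ≤-Reasoning
        -- A right turn `abc` would leave `b` inside the triangle formed by `a`, `c` and the point
        -- `y` far above.
        lower : Triples Left S₁
        lower = triples-tabulate λ τ → go τ (side (triples-lookup (proper fW) (⊆-trans τ τ₁)))
          where
          go : ∀ {a b c} → a ∷ b ∷ c ∷ [] ⊆ S₁ → Left a b c ⊎ Right a b c → Left a b c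
          go τ (inj₁ p) = p
          go τ (inj₂ p) with pairs-⊆ (⊆-trans τ τ₁) (cup-join (lookup τ₂ (here refl)))
          ... | (aby ∷ _) ∷ (bcy ∷ _) ∷ _ = ⊥-elim
            (inner-second true cp (++⁺ τ (refl ∷ minimum _)) p aby bcy)
        upper : Triples Right S₂
        upper = triples-tabulate λ τ → go τ (side (triples-lookup (proper fY) (⊆-trans τ τ₂)))
          where
          go : ∀ {a b c} → a ∷ b ∷ c ∷ [] ⊆ S₂ → Left a b c ⊎ Right a b c → Right a b c
          go τ (inj₂ p) = p
          go τ (inj₁ p) with pairs-⊆ (⊆-trans τ τ₂) (cap-join (lookup τ₁ (here refl)))
          ... | (xab ∷ _) ∷ (xbc ∷ _) ∷ _ = ⊥-elim
            (inner-third false cp (++⁺ (refl ∷ minimum _) τ) xab xbc p)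

open FreeSets

-- Complete case distinctions over the orientations of triples

module Search where
  open import Data.Nat as ℕ using (ℕ; zero; suc; _<_; _<?_)

  open import Data.List.Membership.DecPropositional ℕ._≟_ using (_∈?_)

  Triple : Set
  Triple = ℕ × ℕ × ℕ

  _≟ᵗ_ : DecidableEquality Triple
  _≟ᵗ_ = ≡-dec ℕ._≟_ (≡-dec ℕ._≟_ ℕ._≟_)

  -- A conjunction of sign conditions; a list of patterns is read as a disjunction.
  Pattern : Set
  Pattern = List (Triple × Bool)

  Matches : (Triple → Bool) → Pattern → Set
  Matches χ = All (λ (t , s) → χ t ≡ s)

  reduce : Triple → Bool → Pattern → Maybe Pattern
  reduce x s [] = just []
  reduce x s ((y , t) ∷ p) with y ≟ᵗ x
  ... | yes _ with t Bool.≟ s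
  ...   | yes _ = reduce x s p
  ...   | no _ = nothing
  reduce x s ((y , t) ∷ p) | no _ with reduce x s p
  ...   | just p′ = just ((y , t) ∷ p′)
  ...   | nothing = nothing

  reduceAll : Triple → Bool → List Pattern → List Pattern
  reduceAll x s [] = []
  reduceAll x s (p ∷ ps) with reduce x s p
  ... | just p′ = p′ ∷ reduceAll x s ps
  ... | nothing = reduceAll x s ps

  solved : List Pattern → Bool
  solved [] = false
  solved ([] ∷ ps) = true
  solved ((_ ∷ _) ∷ ps) = solved ps

  -- Checks by branching on the signs that every assignment satisfies one of the patterns. A branch
  -- ends as soon as some pattern has no open condition.
  covered : List Triple → List Pattern → Bool
  covered [] ps = solved ps
  covered (x ∷ xs) ps =
    if solved ps then true
    else (if covered xs (reduceAll x true ps) then covered xs (reduceAll x false ps) else false)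

  module _ (χ : Triple → Bool) where

    reduce-sound : ∀ x p {p′} → reduce x (χ x) p ≡ just p′ → Matches χ p′ → Matches χ p
    reduce-sound x [] refl m = m
    reduce-sound x ((y , t) ∷ p) e m with y ≟ᵗ x
    ... | yes refl with t Bool.≟ χ x
    ...   | yes refl = refl ∷ reduce-sound x p e m
    reduce-sound x ((y , t) ∷ p) e m | no _ with reduce x (χ x) p in e′
    reduce-sound x ((y , t) ∷ p) refl (k ∷ m) | no _ | just p′ = k ∷ reduce-sound x p e′ m

    reduceAll-sound : ∀ x ps → Any (Matches χ) (reduceAll x (χ x) ps) → Any (Matches χ) ps
    reduceAll-sound x (p ∷ ps) m with reduce x (χ x) p in e
    reduceAll-sound x (p ∷ ps) m | nothing = there (reduceAll-sound x ps m)
    reduceAll-sound x (p ∷ ps) (here m) | just _ = here (reduce-sound x p e m)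
    reduceAll-sound x (p ∷ ps) (there m) | just _ = there (reduceAll-sound x ps m)

    solved-sound : ∀ ps → solved ps ≡ true → Any (Matches χ) ps
    solved-sound ([] ∷ ps) _ = here []
    solved-sound ((_ ∷ _) ∷ ps) e = there (solved-sound ps e)

    covered-sound : ∀ xs ps → covered xs ps ≡ true → Any (Matches χ) ps
    covered-sound [] ps e = solved-sound ps e
    covered-sound (x ∷ xs) ps e with solved ps in s
    ... | true = solved-sound ps s
    ... | false with covered xs (reduceAll x true ps) in l | χ x in c
    ...   | true | true =
      reduceAll-sound x ps (subst (λ b → Any (Matches χ) (reduceAll x b ps)) (sym c) (covered-sound xs _ l))
    ...   | true | false =
      reduceAll-sound x ps (subst (λ b → Any (Matches χ) (reduceAll x b ps)) (sym c) (covered-sound xs _ e))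

  subsets : ∀ {A : Set} → ℕ → List A → List (List A)
  subsets zero _ = [] ∷ []
  subsets (suc k) [] = []
  subsets (suc k) (x ∷ xs) = map (x ∷_) (subsets k xs) ++ subsets (suc k) xs

  subsets-⊆ : ∀ {A : Set} k (xs : List A) {ys} → ys ∈ subsets k xs → ys ⊆ xs
  subsets-⊆ zero xs (here refl) = minimum xs
  subsets-⊆ (suc k) (x ∷ xs) m with ∈-++⁻ (map (x ∷_) (subsets k xs)) m
  ... | inj₂ m′ = x ∷ʳ subsets-⊆ (suc k) xs m′
  ... | inj₁ m′ with ∈-map⁻ (x ∷_) m′
  ...   | _ , m″ , refl = refl ∷ subsets-⊆ k xs m″

  subsets-length : ∀ {A : Set} k (xs : List A) {ys} → ys ∈ subsets k xs → length ys ≡ k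
  subsets-length zero xs (here refl) = refl
  subsets-length (suc k) (x ∷ xs) m with ∈-++⁻ (map (x ∷_) (subsets k xs)) m
  ... | inj₂ m′ = subsets-length (suc k) xs m′
  ... | inj₁ m′ with ∈-map⁻ (x ∷_) m′
  ...   | _ , m″ , refl = cong suc (subsets-length k xs m″)

  ∈-subsets : ∀ {A : Set} {ys xs : List A} → ys ⊆ xs → ys ∈ subsets (length ys) xs
  ∈-subsets {ys = []} _ = here refl
  ∈-subsets {ys = y ∷ ys} (x ∷ʳ τ) = ∈-++⁺ʳ (map (x ∷_) (subsets (length ys) _)) (∈-subsets τ)
  ∈-subsets {ys = y ∷ ys} (refl ∷ τ) = ∈-++⁺ˡ (∈-map⁺ (y ∷_) (∈-subsets τ))

  pairsOf : ∀ {A : Set} → List A → List (A × A)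
  pairsOf [] = []
  pairsOf (x ∷ xs) = map (x ,_) xs ++ pairsOf xs

  triplesOf : ∀ {A : Set} → List A → List (A × A × A)
  triplesOf [] = []
  triplesOf (x ∷ xs) = map (x ,_) (pairsOf xs) ++ triplesOf xs

  -- The new position of the `i`-th given point when the new point takes position `p`.
  skip : ℕ → ℕ → ℕ
  skip zero i = suc i
  skip (suc p) zero = zero
  skip (suc p) (suc i) = suc (skip p i)

  skip³ : ℕ → Triple → Triple
  skip³ p (a , b , c) = skip p a , skip p b , skip p c

  -- Why an assignment of orientations is impossible, or which chain it contains. The
  -- two extra configurations are excluded by the coordinates of the eight points,
  -- not by the sign changes along four sorted points.
  data Reason : Set where
    wrong : Triple → Reason
    alternating : Bool → (omit : ℕ) → List ℕ → Reason
    chain : Bool → List ℕ → Reason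
    extra₁ extra₂ : Reason

  alternate : Bool → Triple → Triple → Triple → Pattern
  alternate s x y z = (x , s) ∷ (y , not s) ∷ (z , s) ∷ []

  module _ (table : Triple → Bool) (p : ℕ) where

    pattern′ : Reason → Pattern
    pattern′ (wrong t) = (skip³ p t , not (table t)) ∷ []
    pattern′ (alternating s 0 (a ∷ b ∷ c ∷ d ∷ [])) = alternate s (a , b , d) (a , c , d) (b , c , d)
    pattern′ (alternating s 1 (a ∷ b ∷ c ∷ d ∷ [])) = alternate s (a , b , c) (a , c , d) (b , c , d)
    pattern′ (alternating s 2 (a ∷ b ∷ c ∷ d ∷ [])) = alternate s (a , b , c) (a , b , d) (b , c , d)
    pattern′ (alternating s _ (a ∷ b ∷ c ∷ d ∷ [])) = alternate s (a , b , c) (a , b , d) (a , c , d)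
    -- Contradictory: only lists of four positions are meant.
    pattern′ (alternating s _ _) = ((0 , 0 , 0) , true) ∷ ((0 , 0 , 0) , false) ∷ []
    pattern′ (chain s ps) = map (_, s) (triplesOf ps)
    -- Position 5 is the new point, so positions 6, 7 and 8 belong to the given points 5, 6 and 7.
    pattern′ extra₁ = ((4 , 5 , 7) , true) ∷ ((5 , 6 , 8) , true) ∷ ((0 , 2 , 5) , false) ∷ []
    pattern′ extra₂ = ((1 , 2 , 5) , true) ∷ ((0 , 3 , 5) , false) ∷ []

    extras : ℕ → List Reason
    extras 5 = extra₁ ∷ extra₂ ∷ []
    extras _ = []

    through : ℕ → List ℕ → List (List ℕ)
    through k ps = filter (p ∈?_) (subsets k ps)

    alternations : List ℕ → List Reason
    alternations ps =
      concatMap (λ i → map (alternating true i) (through 4 ps) ++ map (alternating false i) (through 4 ps)) (upTo 4)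

    -- The lists unfold only where the search is evaluated and where a property of all reasons is
    -- proved.
    opaque
      reasons : List Reason
      reasons = map wrong (triplesOf (upTo 8)) ++ alternations (upTo 9) ++
        map (chain true) (through 5 (upTo 9)) ++ map (chain false) (through 4 (upTo 9)) ++ extras p

      -- The triples of given points come first, since their orientations are known,
      -- then those through p, starting with the positions closest to p.
      variables : List Triple
      variables = map (skip³ p) (triplesOf (upTo 8)) ++
        growing [] (interleave (filter (_<? p) (downFrom 9)) (filter (p <?_) (upTo 9)))
        where
        interleave : List ℕ → List ℕ → List ℕ
        interleave [] ys = ys
        interleave (x ∷ xs) [] = x ∷ xs
        interleave (x ∷ xs) (y ∷ ys) = x ∷ y ∷ interleave xs ys
        sorted : ℕ → ℕ → Triple
        sorted x y = if does (p <? x) then (p , x , y)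
          else (if does (p <? y) then (x , p , y) else (x , y , p))
        growing : List ℕ → List ℕ → List Triple
        growing seen [] = []
        growing seen (x ∷ xs) =
          map (λ y → if does (x <? y) then sorted x y else sorted y x) seen ++ growing (x ∷ seen) xs

    saturated : Bool
    saturated = covered variables (map pattern′ reasons)

  module _ (table : Triple → Bool) (p : ℕ) {P : Reason → Set} where

    ∈-through : ∀ {k ps I} → I ∈ through table p k ps → p ∈ I × I ⊆ ps × length I ≡ k
    ∈-through {k} {ps} m with ∈-filter⁻ (p ∈?_) {xs = subsets k ps} m
    ... | m′ , p∈ = p∈ , subsets-⊆ k ps m′ , subsets-length k ps m′

    opaque
      unfolding reasons

      All-reasons : (∀ {t} → t ∈ triplesOf (upTo 8) → P (wrong t)) →
        (∀ s i {I} → I ⊆ upTo 9 → length I ≡ 4 → P (alternating s i I)) →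
        (∀ s {I} → p ∈ I → I ⊆ upTo 9 → length I ≡ (if s then 5 else 4) → P (chain s I)) →
        All P (extras table p p) → All P (reasons table p)
      All-reasons w a c e = All.++⁺ (All.map⁺ (All.tabulate w)) (All.++⁺ (alternations-All (upTo 9) a)
        (All.++⁺ (chains-All true 5 (upTo 9) (c true)) (All.++⁺ (chains-All false 4 (upTo 9) (c false)) e)))
        where
        alternations-All : ∀ ps → (∀ s i {I} → I ⊆ ps → length I ≡ 4 → P (alternating s i I)) →
          All P (alternations table p ps)
        alternations-All ps a = All.concat⁺ (All.map⁺ (All.tabulate {xs = upTo 4} λ {i} _ →
          All.++⁺ (All.map⁺ (All.tabulate λ m → a true i (proj₁ (proj₂ (∈-through {4} {ps} m))) (proj₂ (proj₂ (∈-through {4} {ps} m)))))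
            (All.map⁺ (All.tabulate λ m → a false i (proj₁ (proj₂ (∈-through {4} {ps} m))) (proj₂ (proj₂ (∈-through {4} {ps} m)))))))
        chains-All : ∀ s k ps → (∀ {I} → p ∈ I → I ⊆ ps → length I ≡ k → P (chain s I)) →
          All P (map (chain s) (through table p k ps))
        chains-All s k ps c = All.map⁺ (All.tabulate λ m → let (p∈ , τ , e) = ∈-through {k} {ps} m in c p∈ τ e)

open Search

-- Sets given by a table of orientations, with one point inserted

module TableSets where
  open import Data.Rational using (0ℚ)
  open import Data.Nat as ℕ using (ℕ; zero; suc; _+_; _<_; _≤_; z≤n; s≤s; s<s; z<s)
  import Data.Nat.Properties as ℕ

  upTo-sorted : ∀ n → AllPairs _<_ (upTo n)
  upTo-sorted n = AllPairs.applyUpTo⁺₁ id n (λ i<j _ → i<j)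

  insert : ∀ {A : Set} → ℕ → A → (ℕ → A) → ℕ → A
  insert zero q f zero = q
  insert zero q f (suc i) = f i
  insert (suc p) q f zero = f zero
  insert (suc p) q f (suc i) = insert p q (f ∘ suc) i

  module _ {A : Set} where

    insert-skip : ∀ p (q : A) f i → insert p q f (skip p i) ≡ f i
    insert-skip zero q f i = refl
    insert-skip (suc p) q f zero = refl
    insert-skip (suc p) q f (suc i) = insert-skip p q (f ∘ suc) i

    insert-at : ∀ p (q : A) f → insert p q f p ≡ q
    insert-at zero q f = refl
    insert-at (suc p) q f = insert-at p q (f ∘ suc)

    insert-other : ∀ {n} p (q : A) f i → p ≤ n → i < suc n → i ≢ p → ∃[ j ] (j < n × insert p q f i ≡ f j)
    insert-other zero q f zero _ _ i≢p = ⊥-elim (i≢p refl)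
    insert-other zero q f (suc i) _ (s≤s i<n) _ = i , i<n , refl
    insert-other (suc p) q f zero (s≤s _) _ _ = zero , z<s , refl
    insert-other (suc p) q f (suc i) (s≤s p≤n) (s≤s i<n) i≢p with insert-other p q (f ∘ suc) i p≤n i<n (i≢p ∘ cong suc)
    ... | j , j<n , e = suc j , s<s j<n , e

    insert-pairs : ∀ (R : A → A → Set) {n} p q f → p ≤ n → (∀ {i j} → i < j → j < n → R (f i) (f j)) →
      (∀ {i} → i < p → R (f i) q) → (∀ {i} → p ≤ i → i < n → R q (f i)) →
      ∀ {i j} → i < j → j < suc n → R (insert p q f i) (insert p q f j)
    insert-pairs R zero q f _ r l g {zero} {suc j} _ (s≤s j<n) = g z≤n j<n
    insert-pairs R zero q f _ r l g {suc i} {suc j} (s≤s i<j) (s≤s j<n) = r i<j j<n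
    insert-pairs R {suc n} (suc p) q f (s≤s p≤n) r l g {zero} {suc j} _ (s≤s j<n) with j ℕ.≟ p
    ... | yes refl = subst (R (f 0)) (sym (insert-at j q (f ∘ suc))) (l z<s)
    ... | no j≢p with insert-other p q (f ∘ suc) j p≤n j<n j≢p
    ...   | i , i<n , e = subst (R (f 0)) (sym e) (r z<s (s<s i<n))
    insert-pairs R {suc n} (suc p) q f (s≤s p≤n) r l g {suc i} {suc j} (s≤s i<j) (s≤s j<n) =
      insert-pairs R p q (f ∘ suc) p≤n (λ i<j j<n → r (s<s i<j) (s<s j<n)) (λ i<p → l (s<s i<p))
        (λ p≤i i<n → g (s≤s p≤i) (s<s i<n)) i<j j<n

    insert-triples : ∀ (R : A → A → A → Set) {n} p q f → p ≤ n →
      (∀ {i j k} → i < j → j < k → k < n → R (f i) (f j) (f k)) →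
      (∀ {i j} → i < j → j < n → R (f i) (f j) q × R (f i) q (f j) × R q (f i) (f j)) →
      ∀ {i j k} → i < j → j < k → k < suc n → R (insert p q f i) (insert p q f j) (insert p q f k)
    insert-triples R zero q f _ r l {zero} {suc j} {suc k} _ (s≤s j<k) (s≤s k<n) = proj₂ (proj₂ (l j<k k<n))
    insert-triples R zero q f _ r l {suc i} {suc j} {suc k} (s≤s i<j) (s≤s j<k) (s≤s k<n) = r i<j j<k k<n
    insert-triples R {suc n} (suc p) q f (s≤s p≤n) r l {zero} {suc j} {suc k} _ (s≤s j<k) (s≤s k<n) =
      insert-pairs (R (f 0)) p q (f ∘ suc) p≤n (λ i<j j<n → r z<s (s<s i<j) (s<s j<n))
        (λ i<p → proj₁ (l z<s (s<s (ℕ.<-≤-trans i<p p≤n))))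
        (λ _ i<n → proj₁ (proj₂ (l z<s (s<s i<n)))) j<k k<n
    insert-triples R {suc n} (suc p) q f (s≤s p≤n) r l {suc i} {suc j} {suc k} (s≤s i<j) (s≤s j<k) (s≤s k<n) =
      insert-triples R p q (f ∘ suc) p≤n (λ i<j j<k k<n → r (s<s i<j) (s<s j<k) (s<s k<n))
        (λ i<j j<n → l (s<s i<j) (s<s j<n)) i<j j<k k<n

  -- `P` is closed downwards, so its indices form an initial segment; `p` is the length of this
  -- segment.
  locate : ∀ {P Q : ℕ → Set} n → (∀ {i} → i < n → P i ⊎ Q i) → (∀ {i j} → i < j → j < n → P j → P i) →
    (∀ {i} → P i → Q i → ⊥) →
    ∃[ p ] (p ≤ n × (∀ {i} → i < p → P i) × (∀ {i} → p ≤ i → i < n → Q i))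
  locate zero _ _ _ = 0 , z≤n , (λ ()) , λ _ ()
  locate {P} {Q} (suc n) f down excl with f {n} ℕ.≤-refl
  ... | inj₁ pn = suc n , ℕ.≤-refl , below , λ n<i i<n → ⊥-elim (ℕ.<⇒≱ n<i (ℕ.≤-pred i<n))
    where
    below : ∀ {i} → i < suc n → P i
    below {i} i<n with i ℕ.≟ n
    ... | yes refl = pn
    ... | no i≢n = down (ℕ.≤∧≢⇒< (ℕ.≤-pred i<n) i≢n) ℕ.≤-refl pn
  ... | inj₂ qn with locate n (λ i<n → f (ℕ.m<n⇒m<1+n i<n)) (λ i<j j<n → down i<j (ℕ.m<n⇒m<1+n j<n)) excl
  ...   | p , p≤n , below , above = p , ℕ.m≤n⇒m≤1+n p≤n , below , above′
    where
    above′ : ∀ {i} → p ≤ i → i < suc n → Q i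
    above′ {i} p≤i i<n with i ℕ.≟ n
    ... | yes refl = qn
    ... | no i≢n = above p≤i (ℕ.≤∧≢⇒< (ℕ.≤-pred i<n) i≢n)

  ∃-⊆-map : ∀ {A B : Set} (f : A → B) {S} xs → S ⊆ map f xs → ∃[ I ] (I ⊆ xs × S ≡ map f I)
  ∃-⊆-map f [] [] = [] , [] , refl
  ∃-⊆-map f (x ∷ xs) (_ ∷ʳ τ) with ∃-⊆-map f xs τ
  ... | I , σ , e = I , x ∷ʳ σ , e
  ∃-⊆-map f (x ∷ xs) (refl ∷ τ) with ∃-⊆-map f xs τ
  ... | I , σ , e = x ∷ I , refl ∷ σ , cong (f x ∷_) e

  alternation : ∀ s {a b c d e f g h i} → Btw (cross a b c) (cross d e f) (cross g h i) →
    Turn s a b c → Turn (not s) d e f → Turn s g h i → ⊥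
  alternation true B p q r = left-right (mid⁺ B p r) q
  alternation false B p q r = left-right q (mid⁻ B p r)

  turn-decide : ∀ s {a b c} → cross a b c ≢ 0ℚ → Turn s a b c ⊎ Turn (not s) a b c
  turn-decide true ne = side ne
  turn-decide false ne = Sum.swap (side ne)

  turn-excl : ∀ s {a b c} → Turn s a b c → Turn (not s) a b c → ⊥
  turn-excl true p q = left-right p q
  turn-excl false p q = left-right q p

  turn≢0 : ∀ s {a b c} → Turn s a b c → cross a b c ≢ 0ℚ
  turn≢0 true = left≢0
  turn≢0 false = right≢0

  turn? : ∀ s a b c → Dec (Turn s a b c)
  turn? true = left?
  turn? false a b c = map′ flipʳ′ flipˡ (left? a c b)
    where
    open import Relation.Nullary.Decidable using (map′)
    flipʳ′ : Left a c b → Right a b c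
    flipʳ′ = flipʳ

  triples-map⁺ : ∀ {A B : Set} {R : B → B → B → Set} {f : A → B} {xs} →
    Triples (λ a b c → R (f a) (f b) (f c)) xs → Triples R (map f xs)
  triples-map⁺ [] = []
  triples-map⁺ (p ∷ t) = AllPairs.map⁺ p ∷ triples-map⁺ t

  triples-map⁻ : ∀ {A B : Set} {R : B → B → B → Set} {f : A → B} xs →
    Triples R (map f xs) → Triples (λ a b c → R (f a) (f b) (f c)) xs
  triples-map⁻ [] [] = []
  triples-map⁻ (x ∷ xs) (p ∷ t) = AllPairs.map⁻ p ∷ triples-map⁻ xs t

  pairsOf⁺ : ∀ {A : Set} {R : A → A → Set} {xs} → AllPairs R xs → All (uncurry R) (pairsOf xs)
  pairsOf⁺ [] = []
  pairsOf⁺ (r ∷ rs) = All.++⁺ (All.map⁺ r) (pairsOf⁺ rs)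

  pairsOf⁻ : ∀ {A : Set} {R : A → A → Set} xs → All (uncurry R) (pairsOf xs) → AllPairs R xs
  pairsOf⁻ [] [] = []
  pairsOf⁻ (x ∷ xs) p = All.map⁻ (All.++⁻ˡ (map (x ,_) xs) p) ∷ pairsOf⁻ xs (All.++⁻ʳ (map (x ,_) xs) p)

  triplesOf⁺ : ∀ {A : Set} {R : A → A → A → Set} {xs} → Triples R xs →
    All (λ (a , b , c) → R a b c) (triplesOf xs)
  triplesOf⁺ [] = []
  triplesOf⁺ (p ∷ t) = All.++⁺ (All.map⁺ (pairsOf⁺ p)) (triplesOf⁺ t)

  triplesOf⁻ : ∀ {A : Set} {R : A → A → A → Set} xs →
    All (λ (a , b , c) → R a b c) (triplesOf xs) → Triples R xs
  triplesOf⁻ [] [] = []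
  triplesOf⁻ (x ∷ xs) p = pairsOf⁻ xs (All.map⁻ (All.++⁻ˡ (map (x ,_) (pairsOf xs)) p))
    ∷ triplesOf⁻ xs (All.++⁻ʳ (map (x ,_) (pairsOf xs)) p)

  triples-zip : ∀ {A : Set} {R S : A → A → A → Set} {xs} → Triples R xs → Triples S xs →
    Triples (λ a b c → R a b c × S a b c) xs
  triples-zip [] [] = []
  triples-zip (p ∷ s) (q ∷ t) = AllPairs.zip (p , q) ∷ triples-zip s t

  Increasing : ℕ → ℕ → ℕ → ℕ → Set
  Increasing n a b c = a < b × b < c × c < n

  upTo-increasing : ∀ n → Triples (Increasing n) (upTo n)
  upTo-increasing n = triples-tabulate λ τ → go (pairs-⊆ τ (upTo-sorted n)) (lookup τ (there (there (here refl))))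
    where
    go : ∀ {a b c} → AllPairs _<_ (a ∷ b ∷ c ∷ []) → c ∈ upTo n → Increasing n a b c
    go ((a<b ∷ _) ∷ (b<c ∷ _) ∷ _) m = a<b , b<c , ∈-upTo⁻ m

  -- Of four sorted points only the second or the third can lie inside the triangle of the others;
  -- the two alternatives are these cases in terms of signs.
  Concave : (Triple → Bool) → List ℕ → Set
  Concave T (a ∷ b ∷ c ∷ d ∷ []) =
    (T (a , b , c) ≡ not (T (a , b , d)) × T (b , c , d) ≡ T (a , b , d)) ⊎
    (T (a , c , d) ≡ T (a , b , c) × T (b , c , d) ≡ not (T (a , b , c)))
  Concave T _ = ⊥

  limit : Bool → ℕ
  limit true = 4
  limit false = 3

  take-⊆ : ∀ {A : Set} n (xs : List A) → take n xs ⊆ xs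
  take-⊆ zero xs = minimum xs
  take-⊆ (suc n) [] = []
  take-⊆ (suc n) (x ∷ xs) = refl ∷ take-⊆ n xs

  short : ∀ {A B : Set} (f : A → B) xs n {S} → S ⊆ map f xs →
    (∀ {I} → I ⊆ xs → length I ≡ suc n → map f I ⊆ S → ⊥) → length S ≤ n
  short f xs n {S} τ h with length S ℕ.≤? n
  ... | yes le = le
  ... | no nle with ∃-⊆-map f xs (⊆-trans (take-⊆ (suc n) S) τ)
  ...   | I , σ , e = ⊥-elim (h σ len (subst (_⊆ S) e (take-⊆ (suc n) S)))
    where
    len : length I ≡ suc n
    len = trans (sym (length-map f I)) (trans (cong length (sym e))
      (trans (length-take (suc n) S) (ℕ.m≤n⇒m⊓n≡m (ℕ.≰⇒> nle))))

  -- σ is the identity, or negation for a mirror image of the tabulated points.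
  module OfTable (table : Triple → Bool) (indices : List ℕ) (indices-upTo : indices ≡ upTo 8)
    (no-chain : ∀ s {I} → I ⊆ indices → length I ≡ suc (limit s) → Any (λ t → table t ≡ not s) (triplesOf I))
    (no-convex : ∀ {I} → I ⊆ indices → length I ≡ 7 → Any (Concave table) (subsets 4 I))
    (σ : Bool → Bool) (σ-not : ∀ s → σ (not s) ≡ not (σ s)) (f : ℕ → Point)
    (turns : ∀ {a b c} → Increasing 8 a b c → Turn (σ (table (a , b , c))) (f a) (f b) (f c))
    (no₁ : ∀ {q} → Turn (σ true) (f 4) q (f 6) → Turn (σ true) q (f 5) (f 7) →
      Turn (σ false) (f 0) (f 2) q → ⊥)
    (no₂ : ∀ {v q} → Steep v → Turn (σ true) (f 1) (f 2) q → Turn (σ false) (f 0) (f 3) q →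
      f 4 <[ v ] q → ⊥) where

    X : List Point
    X = map f indices

    increasing : Triples (Increasing 8) indices
    increasing = subst (Triples (Increasing 8)) (sym indices-upTo) (upTo-increasing 8)

    turn-σ-not : ∀ s {a b c} → Turn (σ (not s)) a b c → Turn (not (σ s)) a b c
    turn-σ-not s {a} {b} {c} = subst (λ s → Turn s a b c) (σ-not s)

    turn-not-σ : ∀ s {a b c} → Turn (not (σ s)) a b c → Turn (σ (not s)) a b c
    turn-not-σ s {a} {b} {c} = subst (λ s → Turn s a b c) (sym (σ-not s))

    excl : ∀ s {a b c} → Turn (σ s) a b c → Turn (σ (not s)) a b c → ⊥
    excl s p q = turn-excl (σ s) p (turn-σ-not s q)

    chain-bound : ∀ s {S} → S ⊆ X → Triples (Turn (σ s)) S → length S ≤ limit s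
    chain-bound s {S} τ t = short f indices (limit s) τ go
      where
      go : ∀ {I} → I ⊆ indices → length I ≡ suc (limit s) → map f I ⊆ S → ⊥
      go {I} σ′ len τ′ with find (no-chain s σ′ len)
      ... | (a , b , c) , mt , bad with All.lookup (triplesOf⁺ (triples-zip
          (triples-⊆ σ′ increasing) (triples-map⁻ I (triples-⊆ τ′ t)))) mt
      ...   | inc , tr = excl s tr (subst (λ b′ → Turn (σ b′) (f a) (f b) (f c)) bad (turns inc))

    proper-X : NonCollinear X
    proper-X = triples-map⁺ (triples-map (λ {a} {b} {c} inc → turn≢0 (σ (table (a , b , c))) (turns inc)) increasing)

    -- Any seven of the points include four with one inside the triangle of the others, which the
    -- table alone shows.
    convex-bound-X : ∀ {S} → S ⊆ X → ConvexPosition S → length S ≤ 6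
    convex-bound-X {S} τ cp = short f indices 6 τ go
      where
      quad : ∀ Q → Q ⊆ indices → map f Q ⊆ S → Concave table Q → ⊥
      quad (a ∷ b ∷ c ∷ d ∷ []) σ′ τ′ con with triples-⊆ σ′ increasing
      ... | ((abc ∷ abd ∷ []) ∷ (acd ∷ []) ∷ _) ∷ ((bcd ∷ []) ∷ _) ∷ _ = finish con
        where
        T = table
        at : ∀ {s t x y z} → s ≡ t → Turn (σ s) x y z → Turn (σ t) x y z
        at refl p = p
        finish : Concave table (a ∷ b ∷ c ∷ d ∷ []) → ⊥
        finish (inj₁ (e₁ , e₂)) = inner-second (σ (T (a , b , d))) cp τ′
          (turn-σ-not (T (a , b , d)) (at e₁ (turns abc))) (turns abd) (at e₂ (turns bcd))
        finish (inj₂ (e₁ , e₂)) = inner-third (σ (T (a , b , c))) cp τ′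
          (turns abc) (at e₁ (turns acd)) (turn-σ-not (T (a , b , c)) (at e₂ (turns bcd)))
      go : ∀ {I} → I ⊆ indices → length I ≡ 7 → map f I ⊆ S → ⊥
      go {I} σ′ len τ′ with find (no-convex σ′ len)
      ... | Q , mQ , con = quad Q (⊆-trans (subsets-⊆ 4 I mQ) σ′)
        (⊆-trans (map-⊆ (subsets-⊆ 4 I mQ)) τ′) con
        where
        map-⊆ : ∀ {xs ys : List ℕ} → xs ⊆ ys → map f xs ⊆ map f ys
        map-⊆ [] = []
        map-⊆ (y ∷ʳ τ) = f y ∷ʳ map-⊆ τ
        map-⊆ (refl ∷ τ) = refl ∷ map-⊆ τ

    σ-turn-decide : ∀ s {a b c} → cross a b c ≢ 0ℚ → Turn (σ s) a b c ⊎ Turn (σ (not s)) a b c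
    σ-turn-decide s ne = Sum.map₂ (turn-not-σ s) (turn-decide (σ s) ne)

    pairs-at : ∀ {R : ℕ → ℕ → Set} → AllPairs R indices → ∀ {i j} → i < j → j < 8 → R i j
    pairs-at r {i} {j} i<j j<8 = pairs-transfer ℕ.<-asym (upTo-sorted 8)
      (subst (AllPairs _) indices-upTo r) (∈-upTo⁺ (ℕ.<-trans i<j j<8)) (∈-upTo⁺ j<8) i<j

    module At {v q} (sv : Sorts v X) (g : Generic v q X) {p} (p≤8 : p ≤ 8)
      (left-of : ∀ {i} → i < p → f i <[ v ] q) (right-of : ∀ {i} → p ≤ i → i < 8 → q <[ v ] f i) where

      open Sorts
      open Generic

      point : ℕ → Point
      point = insert p q f

      ordered : ∀ {i j} → i < j → j < 9 → point i <[ v ] point j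
      ordered = insert-pairs (_<[ v ]_) p q f p≤8 (pairs-at (AllPairs.map⁻ (sorted sv))) left-of right-of

      no-line-at : ∀ {i j} → i < j → j < 8 → cross (f i) (f j) q ≢ 0ℚ
      no-line-at = pairs-at (AllPairs.map⁻ (no-line g))

      proper : ∀ {i j k} → i < j → j < k → k < 9 → cross (point i) (point j) (point k) ≢ 0ℚ
      proper = insert-triples (λ a b c → cross a b c ≢ 0ℚ) p q f p≤8
        (λ {i} {j} {k} i<j j<k k<8 → turn≢0 (σ (table (i , j , k))) (turns (i<j , j<k , k<8)))
        λ {i} {j} i<j j<8 → no-line-at i<j j<8 , mid i j (no-line-at i<j j<8) , first i j (no-line-at i<j j<8)
        where
        mid : ∀ i j → cross (f i) (f j) q ≢ 0ℚ → cross (f i) q (f j) ≢ 0ℚ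
        mid i j ne with side {f i} {f j} {q} ne
        ... | inj₁ l = right≢0 (flipʳ l)
        ... | inj₂ r = left≢0 (flipˡ r)
        first : ∀ i j → cross (f i) (f j) q ≢ 0ℚ → cross q (f i) (f j) ≢ 0ℚ
        first i j ne e = ne (trans (sym (cross-cycle (f i) (f j) q)) (trans (sym (cross-cycle (f j) q (f i))) e))

      -- Signs are taken relative to `σ`, so a mirror image gives the same kind of assignment and
      -- one search serves both.
      χ : Triple → Bool
      χ (i , j , k) = does (turn? (σ true) (point i) (point j) (point k))

      literal : ∀ s {i j k} → i < j → j < k → k < 9 → χ (i , j , k) ≡ s →
        Turn (σ s) (point i) (point j) (point k)
      literal s {i} {j} {k} i<j j<k k<9 e with turn? (σ true) (point i) (point j) (point k)
      literal true _ _ _ refl | yes t = t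
      literal false i<j j<k k<9 refl | no ¬t with σ-turn-decide true (proper i<j j<k k<9)
      ... | inj₁ t = ⊥-elim (¬t t)
      ... | inj₂ t = t

      Goal : Set
      Goal = Chain (Turn (σ true)) v q X 4 ⊎ Chain (Turn (σ false)) v q X 3

      -- An impossible pattern also yields the goal, so excluded configurations and chains are
      -- treated alike.
      Sound : Reason → Set
      Sound r = Matches χ (pattern′ table p r) → Goal

      wrong-sound : ∀ {t} → t ∈ triplesOf (upTo 8) → Sound (wrong t)
      wrong-sound {a , b , c} m (e ∷ []) = ⊥-elim (clash (table (a , b , c)) e
          (turns (All.lookup (triplesOf⁺ (upTo-increasing 8)) m)))
        where
        clash : ∀ s → χ (skip³ p (a , b , c)) ≡ not s → Turn (σ s) (f a) (f b) (f c) → ⊥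
        clash s e t with turn? (σ true) (point (skip p a)) (point (skip p b)) (point (skip p c))
        clash true () t | yes _
        clash true e t | no ¬t rewrite insert-skip p q f a | insert-skip p q f b | insert-skip p q f c = ¬t t
        clash false e t | yes t′ rewrite insert-skip p q f a | insert-skip p q f b | insert-skip p q f c = excl true t′ t
        clash false () t | no _

      alternating-sound : ∀ s i {I} → I ⊆ upTo 9 → length I ≡ 4 → Sound (alternating s i I)
      alternating-sound s i {a ∷ b ∷ c ∷ d ∷ []} τ _ with triples-⊆ τ (upTo-increasing 9)
      ... | (((a<b , b<c , c<9) ∷ _) ∷ ((_ , c<d , d<9) ∷ []) ∷ _) ∷ _ = ⊥-elim ∘ go i
        where
        b<d = ℕ.<-trans b<c c<d
        alt : ∀ {a b c d e f g h i} → Btw (cross a b c) (cross d e f) (cross g h i) →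
          Turn (σ s) a b c → Turn (σ (not s)) d e f → Turn (σ s) g h i → ⊥
        alt B x y z = alternation (σ s) B x (turn-σ-not s y) z
        ab = ordered a<b (ℕ.<-trans b<c c<9)
        bc = ordered b<c c<9
        cd = ordered c<d d<9
        abc : ∀ s → χ (a , b , c) ≡ s → Turn (σ s) (point a) (point b) (point c)
        abc s = literal s a<b b<c c<9
        abd : ∀ s → χ (a , b , d) ≡ s → Turn (σ s) (point a) (point b) (point d)
        abd s = literal s a<b b<d d<9
        acd : ∀ s → χ (a , c , d) ≡ s → Turn (σ s) (point a) (point c) (point d)
        acd s = literal s (ℕ.<-trans a<b b<c) c<d d<9
        bcd : ∀ s → χ (b , c , d) ≡ s → Turn (σ s) (point b) (point c) (point d)
        bcd s = literal s b<c c<d d<9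
        go : ∀ i → Matches χ (pattern′ table p (alternating s i (a ∷ b ∷ c ∷ d ∷ []))) → ⊥
        go 0 (x ∷ y ∷ z ∷ []) = alt (btw₂₃₄ ab bc cd) (abd s x) (acd (not s) y) (bcd s z)
        go 1 (x ∷ y ∷ z ∷ []) = alt (btw₁₃₄ ab bc cd) (abc s x) (acd (not s) y) (bcd s z)
        go 2 (x ∷ y ∷ z ∷ []) = alt (btw₁₂₄ ab bc cd) (abc s x) (abd (not s) y) (bcd s z)
        go (suc (suc (suc _))) (x ∷ y ∷ z ∷ []) = alt (btw₁₂₃ ab bc cd) (abc s x) (abd (not s) y) (acd s z)

      goal : ∀ s → Chain (Turn (σ s)) v q X (limit s) → Goal
      goal true = inj₁
      goal false = inj₂

      chain-sound : ∀ s {I} → p ∈ I → I ⊆ upTo 9 → length I ≡ suc (limit s) → Sound (chain s I)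
      chain-sound s {I} p∈ τ len m with ∈-∃++ p∈
      ... | L , R , refl = goal s (chain {l = map point L} {r = map point R}
          (All.map⁺ (All.tabulate λ mx → given (bound (∈-++⁺ˡ mx)) (ℕ.<⇒≢ (All.head (All.lookup L<p mx)))))
          (All.map⁺ (All.tabulate λ mx → given (bound (∈-++⁺ʳ L (there mx)))
            (ℕ.<⇒≢ (All.lookup (AllPairs.head p<R) mx) ∘ sym)))
          (trans (cong₂ _+_ (length-map point L) (length-map point R))
            (ℕ.suc-injective (trans (sym (ℕ.+-suc (length L) (length R))) (trans (sym (length-++ L)) len))))
          (subst (AllPairs _) at (AllPairs.map⁺ (pairs-within (λ _ mb i<j → ordered i<j (bound mb))
            (All.tabulate id) inc)))
          (subst (Triples _) at (triples-map⁺ (triples-map (λ ((i<j , j<k , k<9) , e) → literal s i<j j<k k<9 e)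
            (triples-zip (triples-⊆ τ (upTo-increasing 9)) (triplesOf⁻ (L ++ p ∷ R) (All.map⁻ m)))))))
        where
        inc : AllPairs _<_ (L ++ p ∷ R)
        inc = pairs-⊆ τ (upTo-sorted 9)
        bound : ∀ {i} → i ∈ L ++ p ∷ R → i < 9
        bound m = ∈-upTo⁻ (lookup τ m)
        L<p = proj₁ (proj₂ (pairs-++⁻ L inc))
        p<R = proj₂ (proj₂ (pairs-++⁻ L inc))
        at : map point (L ++ p ∷ R) ≡ map point L ++ q ∷ map point R
        at = trans (map-++ point L (p ∷ R)) (cong (λ x → map point L ++ x ∷ map point R) (insert-at p q f))
        given : ∀ {i} → i < 9 → i ≢ p → point i ∈ X
        given i<9 i≢p with insert-other p q f _ p≤8 i<9 i≢p
        ... | j , j<8 , e = subst (_∈ X) (sym e) (∈-map⁺ f (subst (j ∈_) (sym indices-upTo) (∈-upTo⁺ j<8)))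

      -- `n` is a copy of the fixed `p` on which cases are distinguished; only position 5 has
      -- additional patterns.
      extras-sound : ∀ n → n ≡ p → All Sound (extras table p n)
      extras-sound 5 e = first ∷ second ∷ []
        where
        at : ∀ i {x} → insert 5 q f i ≡ x → point i ≡ x
        at i = subst (λ p → ∀ {x} → insert 5 q f i ≡ x → insert p q f i ≡ x) e id
        as : ∀ s i j k {x y z} → insert 5 q f i ≡ x → insert 5 q f j ≡ y → insert 5 q f k ≡ z →
          i < j → j < k → k < 9 → χ (i , j , k) ≡ s → Turn (σ s) x y z
        as s i j k ei ej ek i<j j<k k<9 c with literal s i<j j<k k<9 c
        ... | t rewrite at i ei | at j ej | at k ek = t
        first : Sound extra₁
        first (x ∷ y ∷ z ∷ []) = ⊥-elim (no₁
          (as true 4 5 7 refl refl refl (ℕ.m≤m+n 5 0) (ℕ.m≤m+n 6 1) (ℕ.m≤m+n 8 1) x)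
          (as true 5 6 8 refl refl refl (ℕ.m≤m+n 6 0) (ℕ.m≤m+n 7 1) (ℕ.m≤m+n 9 0) y)
          (as false 0 2 5 refl refl refl (ℕ.m≤m+n 1 1) (ℕ.m≤m+n 3 2) (ℕ.m≤m+n 6 3) z))
        second : Sound extra₂
        second (x ∷ y ∷ []) = ⊥-elim (no₂ (steep sv)
          (as true 1 2 5 refl refl refl (ℕ.m≤m+n 2 0) (ℕ.m≤m+n 3 2) (ℕ.m≤m+n 6 3) x)
          (as false 0 3 5 refl refl refl (ℕ.m≤m+n 1 2) (ℕ.m≤m+n 4 1) (ℕ.m≤m+n 6 3) y)
          (left-of (subst (4 <_) e (ℕ.m≤m+n 5 0))))
      extras-sound 0 _ = []
      extras-sound 1 _ = []
      extras-sound 2 _ = []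
      extras-sound 3 _ = []
      extras-sound 4 _ = []
      extras-sound (suc (suc (suc (suc (suc (suc _)))))) _ = []

      found : saturated table p ≡ true → Goal
      found e with find (Any.map⁻ (covered-sound χ (variables table p) _ e))
      ... | r , mr , m = All.lookup
        (All-reasons table p wrong-sound alternating-sound
          (λ { true → chain-sound true ; false → chain-sound false }) (extras-sound p refl)) mr m

    saturated-X : (∀ p → p ≤ 8 → saturated table p ≡ true) → ∀ v q → Sorts v X → Generic v q X →
      Chain (Turn (σ true)) v q X 4 ⊎ Chain (Turn (σ false)) v q X 3
    saturated-X sat v q sv g with locate 8 tie down <v-asym
      where
      open Sorts
      open Generic
      tie : ∀ {i} → i < 8 → f i <[ v ] q ⊎ q <[ v ] f i
      tie i<8 = All.lookup (All.map⁻ (no-tie g)) (subst (_ ∈_) (sym indices-upTo) (∈-upTo⁺ i<8))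
      down : ∀ {i j} → i < j → j < 8 → f j <[ v ] q → f i <[ v ] q
      down i<j j<8 = <v-trans (pairs-at (AllPairs.map⁻ (sorted sv)) i<j j<8)
    ... | p , p≤8 , l , r = At.found sv g p≤8 l r (sat p p≤8)

open TableSets

-- The eight points and the evaluation of the search

module OctadTable where
  open import Data.Nat using (ℕ)
  open import Data.Integer using (+_; -[1+_])
  open import Data.Rational using (_/_)

  infix 5 _∙_
  _∙_ : _ → _ → Point
  x ∙ y = (x / 1) , (y / 1)

  -- Eight points without 5-cups and 4-caps such that every further point completes
  -- one of these, found by computer search.
  octad : ℕ → Point
  octad 0 = -[1+ 71 ] ∙ + 21
  octad 1 = + 32 ∙ + 7
  octad 2 = + 56 ∙ + 8
  octad 3 = + 72 ∙ + 10
  octad 4 = + 104 ∙ -[1+ 6 ]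
  octad 5 = + 144 ∙ + 7
  octad 6 = + 152 ∙ + 13
  octad _ = + 176 ∙ + 14

  table : Triple → Bool
  table (a , b , c) = does (left? (octad a) (octad b) (octad c))

  opaque
    unfolding reasons variables

    -- Each `refl` runs the search for one of the nine places of `q` among the eight points.
    octad-saturated : All (λ p → saturated table p ≡ true) (upTo 9)
    octad-saturated = refl ∷ refl ∷ refl ∷ refl ∷ refl ∷ refl ∷ refl ∷ refl ∷ refl ∷ []

open OctadTable

-- Translates and mirror images; inequalities special to the eight points

module Placements where
  open import Data.Integer using (+_)
  open import Data.Rational using (0ℚ; 1ℚ; _/_; _+_; _*_; _-_; -_; _<?_; _<_; _≟_)
  open import Data.Rational.Properties using (<-irrefl; neg-antimono-<)
  open import Data.Rational.Solver
  open import Data.Nat using (ℕ)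

  open +-*-Solver using (solve; _:*_; _:+_; _:-_; :-_; _:=_; con; Polynomial)

  infixl 6 _⊕_
  _⊕_ : Point → Point → Point
  (ax , ay) ⊕ (bx , by) = (ax + bx) , (ay + by)

  mirror : Bool → Point → Point
  mirror true p = p
  mirror false (x , y) = x , - y

  -- The negative of the reflected direction: with this sign, reflection keeps steepness and the
  -- order of the points.
  mirror-dir : Bool → Point → Point
  mirror-dir true v = v
  mirror-dir false (x , y) = - x , y

  mirror-steep : ∀ s {v} → Steep v → Steep (mirror-dir s v)
  mirror-steep true st = st
  mirror-steep false {x , y} (p , q) =
    subst Pos (solve 2 (λ x y → detP (con 1ℚ) (con (- 1ℚ)) x y := detP (con 1ℚ) (con 1ℚ) (:- x) y) refl x y) q ,
    subst Pos (solve 2 (λ x y → detP (con 1ℚ) (con 1ℚ) x y := detP (con 1ℚ) (con (- 1ℚ)) (:- x) y) refl x y) p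

  up : Point
  up = 0ℚ , 1ℚ

  cross-shift : ∀ t a b c → cross (t ⊕ a) (t ⊕ b) (t ⊕ c) ≡ cross a b c
  cross-shift (tx , ty) (ax , ay) (bx , by) (cx , cy) = solve 8 (λ tx ty ax ay bx by cx cy →
    crossP (tx :+ ax) (ty :+ ay) (tx :+ bx) (ty :+ by) (tx :+ cx) (ty :+ cy) := crossP ax ay bx by cx cy)
    refl tx ty ax ay bx by cx cy

  cross-mirror : ∀ a b c → cross (mirror false a) (mirror false b) (mirror false c) ≡ - cross a b c
  cross-mirror (ax , ay) (bx , by) (cx , cy) = solve 6 (λ ax ay bx by cx cy →
    crossP ax (:- ay) bx (:- by) cx (:- cy) := :- crossP ax ay bx by cx cy)
    refl ax ay bx by cx cy

  dir-shift : ∀ t a b v → det ((t ⊕ b) ⊖ (t ⊕ a)) v ≡ det (b ⊖ a) v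
  dir-shift (tx , ty) (ax , ay) (bx , by) (vx , vy) = solve 8 (λ tx ty ax ay bx by vx vy →
    dirP (tx :+ ax) (ty :+ ay) (tx :+ bx) (ty :+ by) vx vy := dirP ax ay bx by vx vy)
    refl tx ty ax ay bx by vx vy

  dir-mirror : ∀ a b v → det (mirror false b ⊖ mirror false a) v ≡ det (b ⊖ a) (mirror-dir false v)
  dir-mirror (ax , ay) (bx , by) (vx , vy) = solve 6 (λ ax ay bx by vx vy →
    dirP ax (:- ay) bx (:- by) vx vy := dirP ax ay bx by (:- vx) vy) refl ax ay bx by vx vy

  σ : Bool → Bool → Bool
  σ sg s = if sg then s else not s

  σ-not : ∀ sg s → σ sg (not s) ≡ not (σ sg s)
  σ-not true s = refl
  σ-not false s = refl

  turn-resp : ∀ s {a b c d e f} → cross a b c ≡ cross d e f → Turn s a b c → Turn s d e f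
  turn-resp true e (left p) = left (subst Pos e p)
  turn-resp false e (right p) = right (subst Neg e p)

  turn-neg : ∀ s {a b c d e f} → cross d e f ≡ - cross a b c → Turn s a b c → Turn (not s) d e f
  turn-neg true e (left p) = right (subst Neg (sym e) (neg-antimono-< p))
  turn-neg false e (right p) = left (subst Pos (sym e) (neg⇒pos p))

  turn-mirror : ∀ sg s {a b c} → Turn s a b c → Turn (σ sg s) (mirror sg a) (mirror sg b) (mirror sg c)
  turn-mirror true s p = p
  turn-mirror false s {a} {b} {c} p = turn-neg s (cross-mirror a b c) p

  mirror-mirror : ∀ sg p → mirror sg (mirror sg p) ≡ p
  mirror-mirror true p = refl
  mirror-mirror false (x , y) = cong (x ,_) (solve 1 (λ y → :- (:- y) := y) refl y)

  shift-back : ∀ t p → t ⊕ (p ⊖ t) ≡ p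
  shift-back (tx , ty) (x , y) = cong₂ _,_ (back tx x) (back ty y)
    where
    back : ∀ t x → t + (x - t) ≡ x
    back = solve 2 (λ t x → t :+ (x :- t) := x) refl

  module Placed (sg : Bool) (t : Point) where

    φ φ⁻¹ : Point → Point
    φ p = t ⊕ mirror sg p
    φ⁻¹ q = mirror sg (q ⊖ t)

    φ-φ⁻¹ : ∀ q → φ (φ⁻¹ q) ≡ q
    φ-φ⁻¹ q = trans (cong (t ⊕_) (mirror-mirror sg (q ⊖ t))) (shift-back t q)

    turn-φ : ∀ s {a b c} → Turn s a b c → Turn (σ sg s) (φ a) (φ b) (φ c)
    turn-φ s {a} {b} {c} p = turn-resp (σ sg s)
      (sym (cross-shift t (mirror sg a) (mirror sg b) (mirror sg c))) (turn-mirror sg s p)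

    turn-φ⁻ : ∀ s {a b c} → Turn (σ sg s) (φ a) (φ b) (φ c) → Turn s a b c
    turn-φ⁻ s {a} {b} {c} p with turn? s a b c
    ... | yes q = q
    ... | no ¬q = ⊥-elim (absurd (cmp (cross a b c)))
      where
      cmp : ∀ x → x ≡ 0ℚ ⊎ x ≢ 0ℚ
      cmp x with x ≟ 0ℚ
      ... | yes e = inj₁ e
      ... | no ne = inj₂ ne
      degenerate : ∀ sg s {a b c} → cross a b c ≡ 0ℚ → Turn (σ sg s) (mirror sg a) (mirror sg b) (mirror sg c) → ⊥
      degenerate true s e p = turn≢0 s p e
      degenerate false s {a} {b} {c} e p = turn≢0 (not s) p (trans (cross-mirror a b c) (cong -_ e))
      unshift : Turn (σ sg s) (mirror sg a) (mirror sg b) (mirror sg c)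
      unshift = turn-resp (σ sg s) (cross-shift t (mirror sg a) (mirror sg b) (mirror sg c)) p
      absurd : cross a b c ≡ 0ℚ ⊎ cross a b c ≢ 0ℚ → ⊥
      absurd (inj₁ e) = degenerate sg s e unshift
      absurd (inj₂ ne) with turn-decide s ne
      ... | inj₁ q = ¬q q
      ... | inj₂ q = turn-excl (σ sg s) p (subst (λ s → Turn s (φ a) (φ b) (φ c)) (σ-not sg s) (turn-φ (not s) q))

    before-φ : ∀ {v a b} → a <[ mirror-dir sg v ] b → φ a <[ v ] φ b
    before-φ {v} {a} {b} (before p) =
      before (subst Pos (sym (dir-shift t (mirror sg a) (mirror sg b) v)) (go sg p))
      where
      go : ∀ sg → Pos (det (b ⊖ a) (mirror-dir sg v)) → Pos (det (mirror sg b ⊖ mirror sg a) v)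
      go true p = p
      go false p = subst Pos (sym (dir-mirror a b v)) p

    before-φ⁻ : ∀ {v a b} → φ a <[ v ] φ b → a <[ mirror-dir sg v ] b
    before-φ⁻ {v} {a} {b} (before p) =
      before (go sg (subst Pos (dir-shift t (mirror sg a) (mirror sg b) v) p))
      where
      go : ∀ sg → Pos (det (mirror sg b ⊖ mirror sg a) v) → Pos (det (b ⊖ a) (mirror-dir sg v))
      go true p = p
      go false p = subst Pos (dir-mirror a b v) p

  -- The coefficients make the three distances to the lines 46, 57 and 02 add up to a
  -- negative constant.
  lines-apart : ∀ {q} → Left (octad 4) q (octad 6) → Left q (octad 5) (octad 7) → Right (octad 0) (octad 2) q → ⊥
  lines-apart {qx , qy} (left p₁) (left p₂) (right p₃) =
    <-irrefl refl (subst Pos (identity qx qy) (pos-+ (pos-+ (pos-+ (pos-* (pos! (+ 82 / 1)) p₁)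
      (pos-* (pos! (+ 199 / 1)) p₂)) (pos-* (pos! (+ 19 / 1)) (neg⇒pos p₃))) (pos! (+ 8808 / 1))))
    where
    pos! : ∀ c {_ : True (0ℚ <? c)} → Pos c
    pos! c {w} = toWitness w
    identity : ∀ qx qy → (+ 82 / 1) * cross (octad 4) (qx , qy) (octad 6) +
      (+ 199 / 1) * cross (qx , qy) (octad 5) (octad 7) +
      (+ 19 / 1) * (- cross (octad 0) (octad 2) (qx , qy)) + (+ 8808 / 1) ≡ 0ℚ
    identity = solve 2 (λ qx qy →
      con (+ 82 / 1) :* crossP (x 4) (y 4) qx qy (x 6) (y 6) :+
      con (+ 199 / 1) :* crossP qx qy (x 5) (y 5) (x 7) (y 7) :+
      con (+ 19 / 1) :* (:- crossP (x 0) (y 0) (x 2) (y 2) qx qy) :+ con (+ 8808 / 1) := con 0ℚ) refl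
      where
      x y : ∀ {n} → ℕ → Polynomial n
      x i = con (proj₁ (octad i))
      y i = con (proj₂ (octad i))

  -- The wedge above the line 12 and below the line 03 has its apex to the left of
  -- octad 4 and opens to the left, for every steep direction.
  wedge-left : ∀ {v q} → Steep v → Left (octad 1) (octad 2) q → Right (octad 0) (octad 3) q → octad 4 <[ v ] q → ⊥
  wedge-left {vx , vy} {qx , qy} (a⁺ , b⁺) (left p₁) (right p₂) (before p₃) =
    -- A positive combination of the assumptions that vanishes identically. The weights are linear
    -- in the two determinants of `Steep`, which covers all steep directions at once.
    <-irrefl refl (subst Pos (identity vx vy qx qy)
      (pos-+ (pos-+ (pos-+ (pos-* (pos! (+ 816 / 1)) p₃)
        (pos-* p₁ (pos-+ (pos-* (pos! (+ 133 / 1)) a⁺) (pos-* (pos! (+ 155 / 1)) b⁺))))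
        (pos-* (neg⇒pos p₂) (pos-+ (pos-* (pos! (+ 25 / 1)) a⁺) (pos-* (pos! (+ 23 / 1)) b⁺))))
        (pos-+ (pos-* (pos! (+ 1864 / 1)) a⁺) (pos-* (pos! (+ 15032 / 1)) b⁺))))
    where
    pos! : ∀ c {_ : True (0ℚ <? c)} → Pos c
    pos! c {w} = toWitness w
    identity : ∀ vx vy qx qy →
      (+ 816 / 1) * det ((qx , qy) ⊖ octad 4) (vx , vy) +
      cross (octad 1) (octad 2) (qx , qy) * ((+ 133 / 1) * det (1ℚ , 1ℚ) (vx , vy) + (+ 155 / 1) * det (1ℚ , - 1ℚ) (vx , vy)) +
      (- cross (octad 0) (octad 3) (qx , qy)) * ((+ 25 / 1) * det (1ℚ , 1ℚ) (vx , vy) + (+ 23 / 1) * det (1ℚ , - 1ℚ) (vx , vy)) +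
      ((+ 1864 / 1) * det (1ℚ , 1ℚ) (vx , vy) + (+ 15032 / 1) * det (1ℚ , - 1ℚ) (vx , vy)) ≡ 0ℚ
    identity = solve 4 (λ vx vy qx qy →
      let a = detP (con 1ℚ) (con 1ℚ) vx vy
          b = detP (con 1ℚ) (con (- 1ℚ)) vx vy in
      con (+ 816 / 1) :* detP (qx :- x 4) (qy :- y 4) vx vy :+
      crossP (x 1) (y 1) (x 2) (y 2) qx qy :* (con (+ 133 / 1) :* a :+ con (+ 155 / 1) :* b) :+
      (:- crossP (x 0) (y 0) (x 3) (y 3) qx qy) :* (con (+ 25 / 1) :* a :+ con (+ 23 / 1) :* b) :+
      (con (+ 1864 / 1) :* a :+ con (+ 15032 / 1) :* b) := con 0ℚ) refl
      where
      x y : ∀ {n} → ℕ → Polynomial n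
      x i = con (proj₁ (octad i))
      y i = con (proj₂ (octad i))

open Placements

-- The eight points as blocks F(4,3) and F(3,4)

module Octads where
  open import Data.Nat as ℕ using (ℕ; suc; s≤s)
  import Data.Nat.Properties as ℕ

  -- This describes F(a+1,b+1). With the shifted indices, sizes follow Pascal's triangle and `a + b`
  -- is constant along a row.
  record Good (a b : ℕ) (X : List Point) : Set where
    field
      free : Free (suc a) (suc b) (suc (a ℕ.+ b)) X
      sat : Sat (suc a) (suc b) X
      sorted : Sorts up X

  concave? : ∀ T I → Dec (Concave T I)
  concave? T (a ∷ b ∷ c ∷ d ∷ []) =
    ((T (a , b , c) Bool.≟ not (T (a , b , d))) ×-dec (T (b , c , d) Bool.≟ T (a , b , d))) ⊎-dec
    ((T (a , c , d) Bool.≟ T (a , b , c)) ×-dec (T (b , c , d) Bool.≟ not (T (a , b , c))))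
  concave? T [] = no λ ()
  concave? T (_ ∷ []) = no λ ()
  concave? T (_ ∷ _ ∷ []) = no λ ()
  concave? T (_ ∷ _ ∷ _ ∷ []) = no λ ()
  concave? T (_ ∷ _ ∷ _ ∷ _ ∷ _ ∷ _) = no λ ()

  octad-turns : Triples (λ a b c → Turn (table (a , b , c)) (octad a) (octad b) (octad c)) (upTo 8)
  octad-turns = triplesOf⁻ (upTo 8) (from-yes (all? (λ (a , b , c) →
    turn? (table (a , b , c)) (octad a) (octad b) (octad c)) (triplesOf (upTo 8))))

  octad-order : AllPairs (λ a b → octad a <[ up ] octad b) (upTo 8)
  octad-order = from-yes (allPairs? (λ a b → <v? (octad a) up (octad b)) (upTo 8))

  octad-chains : ∀ s → All (λ I → Any (λ t → table t ≡ not s) (triplesOf I)) (subsets (suc (limit s)) (upTo 8))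
  octad-chains true = from-yes (all? (λ I → any? (λ t → table t Bool.≟ false) (triplesOf I)) (subsets 5 (upTo 8)))
  octad-chains false = from-yes (all? (λ I → any? (λ t → table t Bool.≟ true) (triplesOf I)) (subsets 4 (upTo 8)))

  octad-concave : All (λ I → Any (Concave table) (subsets 4 I)) (subsets 7 (upTo 8))
  octad-concave = from-yes (all? (λ I → any? (concave? table) (subsets 4 I)) (subsets 7 (upTo 8)))

  ∈-subsets-of : ∀ {k} {I : List ℕ} → I ⊆ upTo 8 → length I ≡ k → I ∈ subsets k (upTo 8)
  ∈-subsets-of {I = I} τ e = subst (λ k → I ∈ subsets k (upTo 8)) e (∈-subsets τ)

  saturated-upTo : ∀ p → p ℕ.≤ 8 → saturated table p ≡ true
  saturated-upTo p p≤8 = All.lookup octad-saturated (∈-upTo⁺ (s≤s p≤8))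

  module PlacedOctad (sg : Bool) (t : Point) where
    open Placed sg t

    f : ℕ → Point
    f i = φ (octad i)

    f-turns : ∀ {a b c} → Increasing 8 a b c → Turn (σ sg (table (a , b , c))) (f a) (f b) (f c)
    f-turns {a} {b} {c} (a<b , b<c , c<8) = turn-φ (table (a , b , c))
      (triples-transfer ℕ.<-asym (upTo-sorted 8) octad-turns
        (∈-upTo⁺ (ℕ.<-trans a<b (ℕ.<-trans b<c c<8))) (∈-upTo⁺ (ℕ.<-trans b<c c<8)) (∈-upTo⁺ c<8) a<b b<c)

    pull : ∀ {q} (P : Point → Set) → P q → P (φ (φ⁻¹ q))
    pull P = subst P (sym (φ-φ⁻¹ _))

    apart : ∀ {q} → Turn (σ sg true) (f 4) q (f 6) → Turn (σ sg true) q (f 5) (f 7) →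
      Turn (σ sg false) (f 0) (f 2) q → ⊥
    apart {q} p₁ p₂ p₃ = lines-apart {φ⁻¹ q}
      (turn-φ⁻ true (pull {q} (λ q → Turn (σ sg true) (f 4) q (f 6)) p₁))
      (turn-φ⁻ true (pull {q} (λ q → Turn (σ sg true) q (f 5) (f 7)) p₂))
      (turn-φ⁻ false (pull {q} (λ q → Turn (σ sg false) (f 0) (f 2) q) p₃))

    wedge : ∀ {v q} → Steep v → Turn (σ sg true) (f 1) (f 2) q → Turn (σ sg false) (f 0) (f 3) q →
      f 4 <[ v ] q → ⊥
    wedge {v} {q} st p₁ p₂ p₃ = wedge-left {mirror-dir sg v} {φ⁻¹ q} (mirror-steep sg st)
      (turn-φ⁻ true (pull {q} (λ q → Turn (σ sg true) (f 1) (f 2) q) p₁))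
      (turn-φ⁻ false (pull {q} (λ q → Turn (σ sg false) (f 0) (f 3) q) p₂))
      (before-φ⁻ (pull {q} (λ q → f 4 <[ v ] q) p₃))

    open OfTable table (upTo 8) refl
      (λ s τ e → All.lookup (octad-chains s) (∈-subsets-of τ e))
      (λ τ e → All.lookup octad-concave (∈-subsets-of τ e))
      (σ sg) (σ-not sg) f f-turns apart wedge public

    X-sorted : Sorts up X
    X-sorted = sorts (from-yes ((0ℚ <? det (1ℚ , 1ℚ) up)) , from-yes (0ℚ <? det (1ℚ , - 1ℚ) up))
      (AllPairs.map⁺ (AllPairs.map (λ {a} {b} lt → before-φ {up} (vertical sg lt)) octad-order))
      where
      open import Data.Rational using (0ℚ; 1ℚ; -_; _<?_)
      vertical : ∀ sg {a b} → a <[ up ] b → a <[ mirror-dir sg up ] b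
      vertical true lt = lt
      vertical false lt = lt

  octad-good : ∀ t → Good 3 2 (map (PlacedOctad.f true t) (upTo 8))
  octad-good t = record
    { free = record { proper = proper-X ; cup-bound = chain-bound true ; cap-bound = chain-bound false ; convex-bound = convex-bound-X }
    ; sat = saturated-X saturated-upTo
    ; sorted = X-sorted }
    where open PlacedOctad true t

  -- Reflection exchanges cups and caps, hence the two bounds and the two alternatives.
  octad-good′ : ∀ t → Good 2 3 (map (PlacedOctad.f false t) (upTo 8))
  octad-good′ t = record
    { free = record { proper = proper-X ; cup-bound = chain-bound false ; cap-bound = chain-bound true ; convex-bound = convex-bound-X }
    ; sat = λ v q s g → Sum.swap (saturated-X saturated-upTo v q s g)
    ; sorted = X-sorted }
    where open PlacedOctad false t

open Octads

-- Moving a block far to the right and far up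

module Translations where
  open import Data.Rational as ℚ using (ℚ; 0ℚ; 1ℚ; _+_; _*_; _-_; -_; _<_; 1/_; _⊔_; Positive; NonZero; positive)
  open import Data.Rational.Properties as ℚ using (p≤p⊔q; p≤q⊔p; ≤-<-trans; *-monoʳ-<-pos; pos⇒nonZero; *-inverseʳ; +-identityˡ; +-identityʳ; +-assoc; +-monoʳ-<)
  open import Data.Rational.Solver
  open import Data.Nat as ℕ using (ℕ; suc; s≤s)
  import Data.Nat.Properties as ℕ

  open +-*-Solver using (solve; _:*_; _:+_; _:-_; :-_; _:=_; con)
  open Sorts
  open Good

  -- Validity for all sufficiently large `h`: finitely many such conditions can be met together
  -- without computing distances.
  Ev : (ℚ → Set) → Set
  Ev P = ∃[ h₀ ] (∀ {h} → h₀ < h → P h)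

  ev-× : ∀ {P Q} → Ev P → Ev Q → Ev (λ h → P h × Q h)
  ev-× (h₁ , p) (h₂ , q) = h₁ ⊔ h₂ , λ lt →
    p (≤-<-trans (p≤p⊔q h₁ h₂) lt) , q (≤-<-trans (p≤q⊔p h₁ h₂) lt)

  ev-map : ∀ {P Q : ℚ → Set} → (∀ {h} → P h → Q h) → Ev P → Ev Q
  ev-map f (h₀ , p) = h₀ , λ lt → f (p lt)

  ev-all : ∀ {A : Set} {P : A → ℚ → Set} xs → (∀ {x} → x ∈ xs → Ev (P x)) → Ev (λ h → All (λ x → P x h) xs)
  ev-all [] f = 0ℚ , λ _ → []
  ev-all (x ∷ xs) f = ev-map (λ (p , ps) → p ∷ ps) (ev-× (f (here refl)) (ev-all xs (f ∘ there)))

  ev-pairs : ∀ {A : Set} {R : A → A → ℚ → Set} {xs} → AllPairs (λ a b → Ev (R a b)) xs →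
    Ev (λ h → AllPairs (λ a b → R a b h) xs)
  ev-pairs [] = 0ℚ , λ _ → []
  ev-pairs {xs = x ∷ xs} (r ∷ rs) = ev-map (λ (p , ps) → p ∷ ps)
    (ev-× (ev-all xs (All.lookup r)) (ev-pairs rs))

  opaque
    ev-witness : ∀ {P} → Ev P → ∃[ h ] P h
    ev-witness (h₀ , p) = h₀ + 1ℚ , p (subst (_< h₀ + 1ℚ) (+-identityʳ h₀) (+-monoʳ-< h₀ (ℚ.positive⁻¹ 1ℚ)))

    ev-linear : ∀ A {B} → Pos B → Ev (λ h → Pos (A + B * h))
    ev-linear A {B} B⁺ = - A * 1/ B , λ {h} lt → subst (_< A + B * h) cancel (+-monoʳ-< A (*-monoʳ-<-pos B lt))
      where
      instance
        B-pos : Positive B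
        B-pos = positive B⁺
        B-nz : NonZero B
        B-nz = pos⇒nonZero B
      cancel : A + B * (- A * 1/ B) ≡ 0ℚ
      cancel = trans (solve 3 (λ A B i → A :+ B :* (:- A :* i) := A :- A :* (B :* i)) refl A B (1/ B))
        (trans (cong (λ z → A - A * z) (*-inverseʳ B)) (solve 1 (λ A → A :- A :* con 1ℚ := con 0ℚ) refl A))

  -- The determinant is linear in `h` with slope `proj₁ e`.
  ev-det : ∀ e dx dy → Pos (proj₁ e) → Ev (λ h → Pos (det e (dx , h + dy)))
  ev-det e@(ex , ey) dx dy p = ev-map (λ {h} → subst Pos (expand h)) (ev-linear (ex * dy - ey * dx) p)
    where
    expand : ∀ h → ex * dy - ey * dx + ex * h ≡ det e (dx , h + dy)
    expand h = solve 5 (λ ex ey dx dy h → ex :* dy :- ey :* dx :+ ex :* h := ex :* (h :+ dy) :- ey :* dx)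
      refl ex ey dx dy h

  up-pos : ∀ {a b} → a <[ up ] b → Pos (proj₁ (b ⊖ a))
  up-pos {ax , ay} {bx , by} (before p) = subst Pos
    (solve 4 (λ ax ay bx by → dirP ax ay bx by (con 0ℚ) (con 1ℚ) := bx :- ax) refl ax ay bx by) p

  pos-up : ∀ {a b} → Pos (proj₁ (b ⊖ a)) → a <[ up ] b
  pos-up {ax , ay} {bx , by} p = before (subst Pos
    (solve 4 (λ ax ay bx by → bx :- ax := dirP ax ay bx by (con 0ℚ) (con 1ℚ)) refl ax ay bx by) p)

  -- The direction approaches the vertical as `h` grows, and finitely many strict inequalities
  -- survive a small turn.
  ev-sorts : ∀ {X} dx dy → Sorts up X → Ev (λ h → Sorts (dx , h + dy) X)
  ev-sorts dx dy (sorts _ o) = ev-map (λ ((p , q) , r) → sorts (p , q) r)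
    (ev-× (ev-× (ev-det (1ℚ , 1ℚ) dx dy (ℚ.positive⁻¹ 1ℚ)) (ev-det (1ℚ , - 1ℚ) dx dy (ℚ.positive⁻¹ 1ℚ)))
      (ev-pairs (AllPairs.map (λ {a} {b} lt → ev-map before (ev-det (b ⊖ a) dx dy (up-pos lt))) o)))

  shift : Point → List Point → List Point
  shift t = map (t ⊕_)

  sorts-shift : ∀ {v X} t → Sorts v X → Sorts v (shift t X)
  sorts-shift t (sorts s o) = sorts s (AllPairs.map⁺ (AllPairs.map (Placed.before-φ true t) o))

  ⊖-shift : ∀ t a b → (t ⊕ a) ⊖ (t ⊕ b) ≡ a ⊖ b
  ⊖-shift (tx , ty) (ax , ay) (bx , by) = cong₂ _,_ (go tx ax bx) (go ty ay by)
    where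
    go : ∀ t a b → t + a - (t + b) ≡ a - b
    go = solve 3 (λ t a b → t :+ a :- (t :+ b) := a :- b) refl

  joins-shift : ∀ {X Y} t → Joins X Y → Joins (shift t X) (shift t Y)
  joins-shift {X} {Y} t J = record { sortsˡ = λ mu my → go X sortsˡ mu my ; sortsʳ = λ mu my → go Y sortsʳ mu my }
    where
    open Joins J
    go : ∀ Z → (∀ {u y} → u ∈ X → y ∈ Y → Sorts (y ⊖ u) Z) →
      ∀ {u y} → u ∈ shift t X → y ∈ shift t Y → Sorts (y ⊖ u) (shift t Z)
    go Z s mu my with ∈-map⁻ (t ⊕_) mu | ∈-map⁻ (t ⊕_) my
    ... | u , mu′ , refl | y , my′ , refl =
      subst (λ v → Sorts v (shift t Z)) (sym (⊖-shift t y u)) (sorts-shift t (s mu′ my′))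

  module _ {X Y : List Point} (sX : Sorts up X) (sY : Sorts up Y) where

    -- The shift is chosen in two steps: `c` brings `Y` to the right of `X`, and then, for this `c`,
    -- a large `h` makes all directions from `X` to `Y` nearly vertical.
    Beyond : ℚ → Set
    Beyond c = All (λ x → All (λ y → Pos (c + proj₁ y - proj₁ x)) Y) X

    Above : ℚ → ℚ → Set
    Above c h = All (λ u → All (λ y → Sorts (c + proj₁ y - proj₁ u , h + (proj₂ y - proj₂ u)) X ×
      Sorts (c + proj₁ y - proj₁ u , h + (proj₂ y - proj₂ u)) Y) Y) X

    joins-at : ∀ c h → Beyond c → Above c h →
      Joins X (shift (c , h) Y) × Sorts up (X ++ shift (c , h) Y)
    joins-at c h far high =
      record { sortsˡ = λ mu my → go proj₁ mu my
             ; sortsʳ = λ mu my → go (λ s → sorts-shift (c , h) (proj₂ s)) mu my } ,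
      sorts (steep sX) (AllPairs.++⁺ (sorted sX) (sorted (sorts-shift (c , h) sY))
        (All.map (λ p → All.map⁺ (All.map pos-up p)) far))
      where
      go : ∀ {Z} → (∀ {v} → Sorts v X × Sorts v Y → Sorts v Z) →
        ∀ {u y} → u ∈ X → y ∈ shift (c , h) Y → Sorts (y ⊖ u) Z
      go {Z} f {u} mu my with ∈-map⁻ ((c , h) ⊕_) my
      ... | y , my′ , refl = subst (λ d → Sorts (c + proj₁ y - proj₁ u , d) Z)
        (sym (+-assoc h (proj₂ y) (- proj₂ u))) (f (All.lookup (All.lookup high mu) my′))

    ev-beyond : Ev Beyond
    ev-beyond = ev-all X λ {x} _ → ev-all Y λ {y} _ →
      ev-map (λ {c} → subst Pos (rearrange (proj₁ y) (proj₁ x) c))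
        (ev-linear (proj₁ y - proj₁ x) (ℚ.positive⁻¹ 1ℚ))
      where
      rearrange : ∀ y x c → y - x + 1ℚ * c ≡ c + y - x
      rearrange = solve 3 (λ y x c → y :- x :+ con 1ℚ :* c := c :+ y :- x) refl

    ev-above : ∀ c → Ev (Above c)
    ev-above c = ev-all X λ {u} _ → ev-all Y λ {y} _ → ev-×
      (ev-sorts (c + proj₁ y - proj₁ u) (proj₂ y - proj₂ u) sX)
      (ev-sorts (c + proj₁ y - proj₁ u) (proj₂ y - proj₂ u) sY)

    opaque
      joinable : ∃[ t ] (Joins X (shift t Y) × Sorts up (X ++ shift t Y))
      joinable = finish (ev-witness {Beyond} ev-beyond)
        where
        place : ∀ c → Beyond c → ∃[ h ] Above c h → ∃[ t ] (Joins X (shift t Y) × Sorts up (X ++ shift t Y))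
        place c far (h , high) = (c , h) , joins-at c h far high
        finish : ∃[ c ] Beyond c → ∃[ t ] (Joins X (shift t Y) × Sorts up (X ++ shift t Y))
        finish (c , far) = place c far (ev-witness {Above c} (ev-above c))

  good-join : ∀ {a b X Y} → Good a (suc b) X → Good (suc a) b Y → Joins X Y → Sorts up (X ++ Y) →
    Good (suc a) (suc b) (X ++ Y)
  good-join {a} {b} gX gY J s = record
    { free = free-join J (free gX) (free gY) ℕ.≤-refl ℕ.≤-refl ℕ.≤-refl ℕ.≤-refl
        (ℕ.n≤1+n _) (s≤s (s≤s (ℕ.+-monoʳ-≤ a (ℕ.n≤1+n b)))) (ℕ.n≤1+n _)
    ; sat = sat-join J (sat gX) (sat gY)
    ; sorted = s }

  -- All translates are carried along, in place of translation invariance of `Sat`, because a join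
  -- moves one of its two blocks.
  record Block (a b N : ℕ) : Set where
    field
      points : List Point
      size : length points ≡ N
      good : ∀ t → Good a b (shift t points)
  open Block

  ⊕-assoc : ∀ s t p → s ⊕ (t ⊕ p) ≡ (s ⊕ t) ⊕ p
  ⊕-assoc (sx , sy) (tx , ty) (px , py) = cong₂ _,_ (sym (+-assoc sx tx px)) (sym (+-assoc sy ty py))

  sorted-good : ∀ {a b X} → (∀ t → Good a b (shift t X)) → Sorts up X
  sorted-good {X = X} g = subst (Sorts up) (trans (map-cong (λ (x , y) → cong₂ _,_ (+-identityˡ x) (+-identityˡ y)) X) (map-id X))
    (sorted (g (0ℚ , 0ℚ)))

  block-join : ∀ {a b M N} → Block a (suc b) M → Block (suc a) b N → Block (suc a) (suc b) (M ℕ.+ N)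
  block-join {a} {b} B C = record
    { points = points B ++ shift t (points C)
    ; size = trans (length-++ (points B)) (cong₂ ℕ._+_ (size B) (trans (length-map (t ⊕_) (points C)) (size C)))
    ; good = λ s → subst (Good (suc a) (suc b)) (sym (map-++ (s ⊕_) (points B) (shift t (points C))))
        (good-join (good B s)
          (subst (Good (suc a) b) (trans (map-cong (λ p → sym (⊕-assoc s t p)) (points C)) (map-∘ (points C))) (good C (s ⊕ t)))
          (joins-shift s (proj₁ (proj₂ joined)))
          (subst (Sorts up) (map-++ (s ⊕_) (points B) (shift t (points C))) (sorts-shift s (proj₂ (proj₂ joined)))))
    }
    where
    joined = joinable (sorted-good (good B)) (sorted-good (good C))
    t = proj₁ joined

open Translations

-- Blocks, rows and their sizes

module Rows where
  open import Data.Rational using (0ℚ; 1ℚ; -_; _<?_)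
  open import Data.Nat as ℕ using (ℕ; zero; suc; _+_; _*_; _^_; _≤_; z≤n; s≤s)
  import Data.Nat.Properties as ℕ

  open Good
  open Block

  ⊆-single : ∀ {p : Point} {S} → S ⊆ p ∷ [] → length S ≤ 1
  ⊆-single (_ ∷ʳ []) = z≤n
  ⊆-single (_ ∷ []) = s≤s z≤n

  free-single : ∀ {k l m} p → Free (suc k) (suc l) (suc m) (p ∷ [])
  free-single p = record
    { proper = [] ∷ []
    ; cup-bound = λ τ _ → ℕ.≤-trans (⊆-single τ) (s≤s z≤n)
    ; cap-bound = λ τ _ → ℕ.≤-trans (⊆-single τ) (s≤s z≤n)
    ; convex-bound = λ τ _ → ℕ.≤-trans (⊆-single τ) (s≤s z≤n) }

  chain-single : ∀ {R v q p} → p <[ v ] q ⊎ q <[ v ] p → Chain R v q (p ∷ []) 1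
  chain-single {p = p} (inj₁ lt) = chain {l = p ∷ []} {r = []} (here refl ∷ []) [] refl
    ((lt ∷ []) ∷ [] ∷ []) ((([] ∷ [])) ∷ [] ∷ [])
  chain-single {p = p} (inj₂ lt) = chain {l = []} {r = p ∷ []} [] (here refl ∷ []) refl
    ((lt ∷ []) ∷ [] ∷ []) ((([] ∷ [])) ∷ [] ∷ [])

  sorts-single : ∀ p → Sorts up (p ∷ [])
  sorts-single p = sorts (from-yes (0ℚ <? det (1ℚ , 1ℚ) up) , from-yes (0ℚ <? det (1ℚ , - 1ℚ) up)) ([] ∷ [])

  claim-single : ∀ {n} p → Claim n 1 (p ∷ [])
  claim-single p v q _ (generic (t ∷ []) _) = inj₂ (chain-single t)

  -- Two points always form a cap, so for caps of at most one point a single point is saturated,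
  -- whatever `a` is.
  single₁ : ∀ a → Block a 0 1
  single₁ a = record { points = (0ℚ , 0ℚ) ∷ [] ; size = refl ; good = λ t → record
    { free = free-single _
    ; sat = λ { v q _ (generic (t ∷ []) _) → inj₂ (chain-single t) }
    ; sorted = sorts-single _ } }

  single₂ : ∀ b → Block 0 b 1
  single₂ b = record { points = (0ℚ , 0ℚ) ∷ [] ; size = refl ; good = λ t → record
    { free = free-single _
    ; sat = λ { v q _ (generic (t ∷ []) _) → inj₁ (chain-single t) }
    ; sorted = sorts-single _ } }

  octad-block : Block 3 2 8
  octad-block = record { points = map (λ i → mirror true (octad i)) (upTo 8) ; size = refl
    ; good = octad-good }

  octad-block′ : Block 2 3 8
  octad-block′ = record { points = map (λ i → mirror false (octad i)) (upTo 8) ; size = refl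
    ; good = octad-good′ }

  -- `a` and `b` are the predecessors of the block indices; the blocks meant are 3, 2 and 2, 3.
  Exceptional : Bool → ℕ → ℕ → Set
  Exceptional e a b = e ≡ true × ((a ≡ 2 × b ≡ 1) ⊎ (a ≡ 1 × b ≡ 2))

  exceptional? : ∀ e a b → Dec (Exceptional e a b)
  exceptional? e a b = (e Bool.≟ true) ×-dec
    (((a ℕ.≟ 2) ×-dec (b ℕ.≟ 1)) ⊎-dec ((a ℕ.≟ 1) ×-dec (b ℕ.≟ 2)))

  -- Pascal's triangle, where for e = true the entries C(5,2) = C(5,3) = 10 are
  -- replaced by 8.
  block-size : Bool → ℕ → ℕ → ℕ
  block-size e zero b = 1
  block-size e (suc a) zero = 1
  block-size e (suc a) (suc b) =
    if does (exceptional? e a b) then 8 else block-size e a (suc b) + block-size e (suc a) b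

  block : ∀ e a b → Block a b (block-size e a b)
  block e zero b = single₂ b
  block e (suc a) zero = single₁ (suc a)
  block e (suc a) (suc b) = choose (exceptional? e a b) (block e a (suc b)) (block e (suc a) b)
    where
    choose : ∀ {M N} (d : Dec (Exceptional e a b)) → Block a (suc b) M → Block (suc a) b N →
      Block (suc a) (suc b) (if does d then 8 else M + N)
    choose (yes (_ , inj₁ (refl , refl))) _ _ = octad-block
    choose (yes (_ , inj₂ (refl , refl))) _ _ = octad-block′
    choose (no _) B C = block-join B C

  -- The join of the first `a + 1` blocks. `n` bounds the convex subsets, so the claim concerns
  -- polygons with `suc n` vertices.
  record Row (n a N : ℕ) : Set where
    field
      points : List Point
      size : length points ≡ N
      free : Free (suc a) n n points
      claim : Claim (suc n) (suc a) points
      sorted : Sorts up points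

  row-single : ∀ n → Row (suc n) 0 1
  row-single n = record { points = (0ℚ , 0ℚ) ∷ [] ; size = refl ; free = free-single _
    ; claim = claim-single _ ; sorted = sorts-single _ }

  row-join : ∀ {a b n M N} → a + suc (suc b) ≡ n → Row n a M → Block (suc a) b N → Row n (suc a) (N + M)
  row-join {a} {b} {n} {M} {N} refl R B = record
    { points = Row.points R ++ shift t (points B)
    ; size = trans (length-++ (Row.points R)) (trans (ℕ.+-comm (length (Row.points R)) _)
        (cong₂ _+_ (trans (length-map (t ⊕_) (points B)) (size B)) (Row.size R)))
    ; free = free-join J′ (Row.free R) (free (good B t)) ℕ.≤-refl ℕ.≤-refl ℕ.≤-refl
        (ℕ.m≤n+m _ a) ℕ.≤-refl (ℕ.≤-reflexive shifted) (ℕ.≤-reflexive (sym (ℕ.+-suc a (suc b))))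
    ; claim = claim-join J′ refl (Row.claim R) (sat (good B t))
    ; sorted = proj₂ (proj₂ joined) }
    where
    joined = joinable (Row.sorted R) (sorted-good (good B))
    t = proj₁ joined
    J′ = proj₁ (proj₂ joined)
    shifted : suc (suc a + b) ≡ a + suc (suc b)
    shifted = sym (trans (ℕ.+-suc a (suc b)) (cong suc (ℕ.+-suc a b)))

  row-size : Bool → ℕ → ℕ → ℕ
  row-size e zero b = 1
  row-size e (suc a) b = block-size e (suc a) b + row-size e a (suc b)

  row : ∀ e a b → Row (suc (a + b)) a (row-size e a b)
  row e zero b = row-single b
  row e (suc a) b = row-join {a} {b} (trans (ℕ.+-suc a (suc b)) (cong suc (ℕ.+-suc a b)))
    (subst (λ n → Row n a (row-size e a (suc b))) (cong suc (ℕ.+-suc a b)) (row e a (suc b))) (block e (suc a) b)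

  -- The relation is equality for the full row and `_≤_` for the row with the smaller blocks.
  module Doubling (_∼_ : ℕ → ℕ → Set) (∼-refl : ∀ {m} → m ∼ m)
    (∼-+ : ∀ {i j k l} → i ∼ j → k ∼ l → (i + k) ∼ (j + l)) (e : Bool)
    (pascal : ∀ a b → block-size e (suc a) (suc b) ∼ (block-size e a (suc b) + block-size e (suc a) b)) where

    -- Pascal's rule at every entry: an antidiagonal sum is made of two shifted copies of the
    -- preceding one.
    row-step : ∀ a b → row-size e (suc a) (suc b) ∼ (row-size e a (suc b) + row-size e (suc a) b)
    row-step zero b = subst (row-size e 1 (suc b) ∼_) (ℕ.+-assoc 1 (block-size e 1 b) 1) (∼-+ (pascal 0 b) ∼-refl)
    row-step (suc a) b = subst (row-size e (suc (suc a)) (suc b) ∼_)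
      (interchange (block-size e (suc a) (suc b)) (block-size e (suc (suc a)) b) (row-size e a (suc (suc b))) (row-size e (suc a) (suc b)))
      (∼-+ (pascal (suc a) b) (row-step a (suc b)))
      where
      interchange : ∀ p q r s → (p + q) + (r + s) ≡ (p + r) + (q + s)
      interchange p q r s = begin
        (p + q) + (r + s)  ≡⟨ ℕ.+-assoc p q (r + s) ⟩
        p + (q + (r + s))  ≡⟨ cong (p +_) (trans (sym (ℕ.+-assoc q r s)) (trans (cong (_+ s) (ℕ.+-comm q r)) (ℕ.+-assoc r q s))) ⟩
        p + (r + (q + s))  ≡⟨ ℕ.+-assoc p r (q + s) ⟨
        (p + r) + (q + s)  ∎
        where open ≡-Reasoning

    doubling : ∀ N → row-size e (suc (suc N)) 0 ∼ (2 * row-size e (suc N) 0)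
    -- The last entry `1` of the new row completes the first copy of the preceding row.
    doubling N = subst (row-size e (suc (suc N)) 0 ∼_) (double (row-size e N 1)) (∼-+ {1} ∼-refl (row-step N 0))
      where
      double : ∀ m → 1 + (m + (1 + m)) ≡ 2 * (1 + m)
      double m = cong suc (cong (m +_) (cong suc (sym (ℕ.+-identityʳ m))))

  pascal-≤ : ∀ a b → block-size true (suc a) (suc b) ≤ block-size true a (suc b) + block-size true (suc a) b
  pascal-≤ a b = choose (exceptional? true a b)
    where
    choose : (d : Dec (Exceptional true a b)) →
      (if does d then 8 else block-size true a (suc b) + block-size true (suc a) b) ≤
      block-size true a (suc b) + block-size true (suc a) b
    -- The entry that is replaced by 8 would be 6 + 4.
    choose (yes (_ , inj₁ (refl , refl))) = ℕ.m≤m+n 8 2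
    choose (yes (_ , inj₂ (refl , refl))) = ℕ.m≤m+n 8 2
    choose (no _) = ℕ.≤-refl

  pascal-≡ : ∀ a b → block-size false (suc a) (suc b) ≡ block-size false a (suc b) + block-size false (suc a) b
  pascal-≡ a b = refl

  small-size : ∀ N → 8 * row-size true (5 + N) 0 ≤ 7 * 2 ^ (5 + N)
  -- The row is 1 + 5 + 8 + 8 + 5 + 1 = 28, and 8 * 28 = 7 * 32.
  small-size zero = ℕ.≤-refl
  small-size (suc N) = begin
    8 * row-size true (6 + N) 0        ≤⟨ ℕ.*-monoʳ-≤ 8 (doubling (4 + N)) ⟩
    8 * (2 * row-size true (5 + N) 0)  ≡⟨ swap 8 2 (row-size true (5 + N) 0) ⟩
    2 * (8 * row-size true (5 + N) 0)  ≤⟨ ℕ.*-monoʳ-≤ 2 (small-size N) ⟩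
    2 * (7 * 2 ^ (5 + N))              ≡⟨ swap 2 7 (2 ^ (5 + N)) ⟩
    7 * 2 ^ (6 + N)                    ∎
    where
    open Doubling _≤_ ℕ.≤-refl ℕ.+-mono-≤ true pascal-≤
    open ℕ.≤-Reasoning
    swap : ∀ a b c → a * (b * c) ≡ b * (a * c)
    swap a b c = trans (sym (ℕ.*-assoc a b c)) (trans (cong (_* c) (ℕ.*-comm a b)) (ℕ.*-assoc b a c))

  full-size : ∀ N → row-size false (suc N) 0 ≡ 2 ^ suc N
  full-size zero = refl
  full-size (suc N) = trans (doubling N) (cong (2 *_) (full-size N))
    where open Doubling _≡_ refl (cong₂ _+_) false pascal-≡

open Rows

-- From polygons and cups to saturation in terms of convex hulls

module Saturation where
  open import Data.Rational as ℚ using (ℚ; 0ℚ; 1ℚ; _*_; _+_; _-_; -_; _<_; nonNegative)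
  import Data.Rational.Properties as ℚ
  open import Data.Rational.Solver
  open import Data.Nat as ℕ using (ℕ; suc; _≤_; z≤n; s≤s; _^_; _∸_)
  import Data.Nat.Properties as ℕ

  open +-*-Solver using (solve; _:*_; _:+_; _:-_; :-_; _:=_; con)

  _≟ₚ_ : DecidableEquality Point
  _≟ₚ_ = ≡-dec ℚ._≟_ ℚ._≟_

  open import Data.List.Membership.DecPropositional _≟ₚ_ using (_∈?_)

  unique-length : ∀ {A : Set} {xs ys : List A} → Unique xs → (∀ {x} → x ∈ xs → x ∈ ys) → length xs ≤ length ys
  unique-length [] _ = z≤n
  unique-length {xs = x ∷ xs} (x∉ ∷ u) f with ∈-∃++ (f (here refl))
  ... | l , r , refl = ℕ.≤-trans (s≤s (unique-length u inside))
    (ℕ.≤-reflexive (trans (cong suc (length-++ l)) (sym (trans (length-++ l) (ℕ.+-suc (length l) (length r))))))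
    where
    inside : ∀ {y} → y ∈ xs → y ∈ l ++ r
    inside my with ∈-++⁻ l (f (there my))
    ... | inj₁ m = ∈-++⁺ˡ m
    ... | inj₂ (here refl) = ⊥-elim (All.lookup x∉ my refl)
    ... | inj₂ (there m) = ∈-++⁺ʳ l m

  left-≢ : ∀ {x a b} → Left x a b → a ≢ b
  left-≢ p refl = left-asym p p

  -- The points of a left turn are distinct, and in a list of at least three points any two belong
  -- to a common triple.
  poly-unique : ∀ {x y z L} → Triples Left (x ∷ y ∷ z ∷ L) → Unique (x ∷ y ∷ z ∷ L)
  poly-unique {x} {y} (p@(xy ∷ _) ∷ t) =
    (x≢y ∷ All.map (λ l e → left-≢ (cyc l) (sym e)) xy) ∷ AllPairs.map left-≢ p
    where
    x≢y : x ≢ y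
    x≢y e = left-≢ (cyc² (All.head xy)) e

  wsum-affine : ∀ A B C w Q → length w ≡ length Q →
    wsum (λ s → A * proj₁ s + B * proj₂ s + C) w Q ≡ A * wsum proj₁ w Q + B * wsum proj₂ w Q + C * sumℚ w
  wsum-affine A B C [] [] _ = solve 3 (λ A B C → con 0ℚ := A :* con 0ℚ :+ B :* con 0ℚ :+ C :* con 0ℚ) refl A B C
  wsum-affine A B C (w ∷ ws) ((x , y) ∷ Q) e = trans
    (cong (w * (A * x + B * y + C) +_) (wsum-affine A B C ws Q (ℕ.suc-injective e)))
    (solve 9 (λ A B C w x y sx sy s →
      w :* (A :* x :+ B :* y :+ C) :+ (A :* sx :+ B :* sy :+ C :* s) :=
      A :* (w :* x :+ sx) :+ B :* (w :* y :+ sy) :+ C :* (w :+ s)) refl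
      A B C w x y (wsum proj₁ ws Q) (wsum proj₂ ws Q) (sumℚ ws))

  lower-bound : ∀ (f : Point → ℚ) Q → All (λ s → Pos (f s)) Q → ∃[ δ ] (Pos δ × All (λ s → δ ℚ.≤ f s) Q)
  lower-bound f [] [] = 1ℚ , ℚ.positive⁻¹ 1ℚ , []
  lower-bound f (s ∷ Q) (p ∷ ps) with lower-bound f Q ps
  ... | δ , δ⁺ , h = δ ℚ.⊓ f s , min-pos , ℚ.p⊓q≤q δ (f s) ∷ All.map (ℚ.≤-trans (ℚ.p⊓q≤p δ (f s))) h
    where
    min-pos : Pos (δ ℚ.⊓ f s)
    min-pos with ℚ.⊓-sel δ (f s)
    ... | inj₁ e = subst Pos (sym e) δ⁺
    ... | inj₂ e = subst Pos (sym e) p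

  wsum-≥ : ∀ (f : Point → ℚ) δ w Q → length w ≡ length Q → All (0ℚ ℚ.≤_) w → All (λ s → δ ℚ.≤ f s) Q →
    δ * sumℚ w ℚ.≤ wsum f w Q
  wsum-≥ f δ [] [] _ [] [] = ℚ.≤-reflexive (ℚ.*-zeroʳ δ)
  wsum-≥ f δ (w ∷ ws) (s ∷ Q) e (w≥0 ∷ ws≥0) (h ∷ hs) =
    ℚ.≤-trans (ℚ.≤-reflexive (solve 3 (λ δ w s → δ :* (w :+ s) := w :* δ :+ δ :* s) refl δ w (sumℚ ws)))
      (ℚ.+-mono-≤ (ℚ.*-monoˡ-≤-nonNeg w {{nonNegative w≥0}} h) (wsum-≥ f δ ws Q (ℕ.suc-injective e) ws≥0 hs))

  -- On the hull an affine function is at least its minimum over `Q`, which is positive.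
  separated : ∀ {p Q} A B C → All (λ s → Pos (A * proj₁ s + B * proj₂ s + C)) Q →
    A * proj₁ p + B * proj₂ p + C ≡ 0ℚ → ¬ InConvexHull p Q
  separated {p} {Q} A B C pos e (w , len , w≥0 , s , sx , sy) with lower-bound _ Q pos
  ... | δ , δ⁺ , h = ℚ.<-irrefl refl (ℚ.<-≤-trans δ⁺ (ℚ.≤-trans
    (ℚ.≤-reflexive (sym (trans (cong (δ *_) s) (ℚ.*-identityʳ δ))))
    (ℚ.≤-trans (wsum-≥ _ δ w Q len w≥0 h) (ℚ.≤-reflexive (trans (wsum-affine A B C w Q len) zeroed)))))
    where
    zeroed : A * wsum proj₁ w Q + B * wsum proj₂ w Q + C * sumℚ w ≡ 0ℚ
    zeroed = trans (cong₂ _+_ (cong₂ (λ x y → A * x + B * y) sx sy) (trans (cong (C *_) s) (ℚ.*-identityʳ C))) e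

  -- With a and z the first and the last of the other vertices seen from p, the
  -- sum of the distances to the lines pa and pz vanishes at p only.
  vertex : ∀ {p a L Q} → AllPairs (Left p) (a ∷ L) → 1 ≤ length L → All (_∈ a ∷ L) Q → ¬ InConvexHull p Q
  vertex {p@(px , py)} {a} {L@(b ∷ L′)} o@(ao ∷ _) _ Q⊆ with last-of a L o
  ... | z , mz , zlast = separated (zy - ay) (ax - zx) (- (zy - ay) * px - (ax - zx) * py)
      (All.map (λ {s} m → subst Pos (sym (expand s)) (positive m)) Q⊆)
      (solve 6 (λ px py ax ay zx zy → (zy :- ay) :* px :+ (ax :- zx) :* py :+ (:- (zy :- ay) :* px :- (ax :- zx) :* py) := con 0ℚ)
        refl px py ax ay zx zy)
    where
    ax = proj₁ a
    ay = proj₂ a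
    zx = proj₁ z
    zy = proj₂ z
    expand : ∀ s → (zy - ay) * proj₁ s + (ax - zx) * proj₂ s + (- (zy - ay) * px - (ax - zx) * py) ≡
      cross p a s + cross p s z
    expand (sx , sy) = solve 8 (λ px py ax ay zx zy sx sy →
      (zy :- ay) :* sx :+ (ax :- zx) :* sy :+ (:- (zy :- ay) :* px :- (ax :- zx) :* py) :=
      crossP px py ax ay sx sy :+ crossP px py sx sy zx zy) refl px py ax ay zx zy sx sy
    degenerate : ∀ s → cross p s s ≡ 0ℚ
    degenerate (sx , sy) = solve 4 (λ px py sx sy → crossP px py sx sy sx sy := con 0ℚ) refl px py sx sy
    after-a : ∀ {s} → s ∈ a ∷ L → 0ℚ ℚ.≤ cross p a s
    after-a (here refl) = ℚ.≤-reflexive (sym (degenerate a))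
    after-a (there m) = ℚ.<⇒≤ (Left.left-pos (All.lookup ao m))
    before-z : ∀ {s} → s ∈ a ∷ L → 0ℚ ℚ.≤ cross p s z
    before-z m with zlast m
    ... | inj₁ refl = ℚ.≤-reflexive (sym (degenerate z))
    ... | inj₂ l = ℚ.<⇒≤ (Left.left-pos l)
    a-z : Left p a z
    a-z with zlast (here refl)
    ... | inj₂ l = l
    ... | inj₁ refl with zlast (there (here refl))
    ...   | inj₁ refl = ⊥-elim (left-asym (All.head ao) (All.head ao))
    ...   | inj₂ l = ⊥-elim (left-asym (All.head ao) l)
    positive : ∀ {s} → s ∈ a ∷ L → Pos (cross p a s + cross p s z)
    positive (here refl) = ℚ.+-mono-≤-< (after-a (here refl)) (Left.left-pos a-z)
    positive (there m) = ℚ.+-mono-<-≤ (Left.left-pos (All.lookup ao m)) (before-z (there m))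

  -- Rotating the circuit so that it starts with `p` sorts the other vertices by angle around `p`,
  -- as `vertex` requires. `S` may list the vertices in any order.
  polygon-convex : ∀ {L S} → Triples Left L → 3 ≤ length L → Unique S → All (_∈ L) S → ConvexPosition S
  polygon-convex {L} t 3≤ u S⊆ pre p post refl
    with ∈-∃++ (All.lookup S⊆ (∈-++⁺ʳ pre (here refl)))
  ... | A , B , refl with triples-++⁻ A t
  ... | _ , ABB , AAB , (pB ∷ _) = rest (B ++ A) refl seen long
    where
    seen : AllPairs (Left p) (B ++ A)
    seen = AllPairs.++⁺ pB (AllPairs.map (λ q → cyc² (All.head q)) ABB)
      (All.tabulate λ mb → All.tabulate λ ma → cyc (All.lookup (AllPairs.head (All.lookup AAB ma)) mb))
    long : 2 ≤ length (B ++ A)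
    long = subst (2 ≤_) (trans (ℕ.+-comm (length A) (length B)) (sym (length-++ B)))
      (ℕ.≤-pred (subst (3 ≤_) (trans (length-++ A) (ℕ.+-suc (length A) (length B))) 3≤))
    others : All (_∈ B ++ A) (pre ++ post)
    others = All.tabulate λ {s} m → place s m (∈-++⁻ A (All.lookup S⊆ (weaken m)))
      where
      weaken : ∀ {s} → s ∈ pre ++ post → s ∈ pre ++ p ∷ post
      weaken m with ∈-++⁻ pre m
      ... | inj₁ m′ = ∈-++⁺ˡ m′
      ... | inj₂ m′ = ∈-++⁺ʳ pre (there m′)
      distinct : ∀ {s} → s ∈ pre ++ post → s ≢ p
      distinct m e with ∈-++⁻ pre m | pairs-++⁻ pre u
      ... | inj₁ m′ | _ , c , _ = All.head (All.lookup c m′) e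
      ... | inj₂ m′ | _ , _ , (c ∷ _) = All.lookup c m′ (sym e)
      place : ∀ s → s ∈ pre ++ post → s ∈ A ⊎ s ∈ p ∷ B → s ∈ B ++ A
      place s m (inj₁ mA) = ∈-++⁺ʳ B mA
      place s m (inj₂ (here e)) = ⊥-elim (distinct m e)
      place s m (inj₂ (there mB)) = ∈-++⁺ˡ mB
    rest : ∀ M → M ≡ B ++ A → AllPairs (Left p) M → 2 ≤ length M → ¬ InConvexHull p (pre ++ post)
    rest (a ∷ M) e o (s≤s l) = vertex o l (subst (λ M → All (_∈ M) (pre ++ post)) (sym e) others)

  -- A sublist of `q ∷ P` is asked for, so filtering brings the vertices into the order of that
  -- list.
  ngon-convex : ∀ {n q P} → 3 ≤ n → Unique (q ∷ P) → NGon n q P →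
    ∃[ S ] (S ⊆ q ∷ P × length S ≡ n × q ∈ S × ConvexPosition S)
  ngon-convex {n} {q} {P} 3≤n u (ngon {L} q∈ L⊆ size poly) =
    S , filter-⊆ (_∈? L) (q ∷ P) , trans (ℕ.≤-antisym (unique-length uS S→L) (unique-length uL L→S)) size ,
    L→S q∈ , polygon-convex poly 3≤L uS (All.tabulate S→L)
    where
    S = filter (_∈? L) (q ∷ P)
    3≤L : 3 ≤ length L
    3≤L = subst (3 ≤_) (sym size) 3≤n
    uS : Unique S
    uS = AllPairs.filter⁺ (_∈? L) u
    S→L : ∀ {x} → x ∈ S → x ∈ L
    S→L m = proj₂ (∈-filter⁻ (_∈? L) {xs = q ∷ P} m)
    L→S : ∀ {x} → x ∈ L → x ∈ S
    L→S m = ∈-filter⁺ (_∈? L) (All.lookup L⊆ m) m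
    unique : ∀ L → Triples Left L → 3 ≤ length L → Unique L
    unique (x ∷ y ∷ z ∷ L) t _ = poly-unique t
    unique (_ ∷ _ ∷ []) _ (s≤s (s≤s ()))
    unique (_ ∷ []) _ (s≤s ())
    uL : Unique L
    uL = unique L poly 3≤L

  ev-tie : ∀ p q → p ≢ q → Ev (λ h → p <[ 1ℚ , h + 0ℚ ] q ⊎ q <[ 1ℚ , h + 0ℚ ] p)
  ev-tie p@(px , py) q@(qx , qy) p≢q with ℚ.<-cmp 0ℚ (qx - px)
  ... | tri< lt _ _ = ev-map (inj₁ ∘ before) (ev-det (q ⊖ p) 1ℚ 0ℚ lt)
  ... | tri> _ _ gt = ev-map (inj₂ ∘ before) (ev-det (p ⊖ q) 1ℚ 0ℚ
    (subst Pos (solve 2 (λ p q → :- (q :- p) := p :- q) refl px qx) (neg⇒pos gt)))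
  ... | tri≈ _ x≡ _ = 0ℚ , λ {h} _ → vertical h (ℚ.<-cmp py qy)
    where
    det-vertical : ∀ a b h → a ≡ 0ℚ → det (a , b) (1ℚ , h + 0ℚ) ≡ - b
    det-vertical _ b h refl = solve 2 (λ b h → con 0ℚ :* (h :+ con 0ℚ) :- b :* con 1ℚ := :- b) refl b h
    negate : ∀ a b → a - b ≡ - (b - a)
    negate = solve 2 (λ a b → a :- b := :- (b :- a)) refl
    vertical : ∀ h → _ → p <[ 1ℚ , h + 0ℚ ] q ⊎ q <[ 1ℚ , h + 0ℚ ] p
    vertical h (tri< lt _ _) = inj₂ (before (subst Pos
      (sym (trans (det-vertical (px - qx) (py - qy) h (trans (negate px qx) (cong -_ (sym x≡)))) (sym (negate qy py))))
      (subst (_< qy - py) (ℚ.+-inverseʳ py) (ℚ.+-monoˡ-< (- py) lt))))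
    vertical h (tri> _ _ gt) = inj₁ (before (subst Pos
      (sym (trans (det-vertical (qx - px) (qy - py) h (sym x≡)) (sym (negate py qy))))
      (subst (_< py - qy) (ℚ.+-inverseʳ qy) (ℚ.+-monoˡ-< (- qy) gt))))
    vertical h (tri≈ _ y≡ _) = ⊥-elim (p≢q (cong₂ _,_
      (trans (solve 2 (λ p q → p := q :- (q :- p)) refl px qx) (trans (cong (λ d → qx - d) (sym x≡)) (ℚ.+-identityʳ qx))) y≡))

  -- General position allows `q` to lie vertically above or below a point of `P`. A slight tilt of
  -- the direction breaks such ties and still sorts `P`.
  generic-direction : ∀ {P q} → Sorts up P → q ∉ P → GeneralPosition (q ∷ P) → ∃[ v ] (Sorts v P × Generic v q P)
  generic-direction {P} {q} s q∉ (_ , gp) = finish (ev-witness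
      {λ h → Sorts (1ℚ , h + 0ℚ) P × All (λ p → p <[ 1ℚ , h + 0ℚ ] q ⊎ q <[ 1ℚ , h + 0ℚ ] p) P}
      (ev-× (ev-sorts 1ℚ 0ℚ s) (ev-all P λ {p} m → ev-tie p q λ e → q∉ (subst (_∈ P) e m))))
    where
    lines : AllPairs (λ a b → cross a b q ≢ 0ℚ) P
    lines = pairs-tabulate λ {a} {b} τ e → gp q a b (refl ∷ τ)
      (trans (sym (cross-cycle q a b)) e)
    finish : _ → ∃[ v ] (Sorts v P × Generic v q P)
    finish (h , sv , t) = (1ℚ , h + 0ℚ) , sv , generic t lines

  general-position : ∀ {P} → Sorts up P → NonCollinear P → GeneralPosition P
  general-position s t =
    AllPairs.map (λ {a} {b} lt e → <v-asym lt (subst₂ (_<[ up ]_) e (sym e) lt)) (Sorts.sorted s) ,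
    λ a b c τ → triples-lookup t τ

  module _ {n a N} (R : Row n a N) where
    open Row R

    row-general : GeneralPosition points
    row-general = general-position sorted (Free.proper free)

    row-free : NGonFree (suc n) points
    row-free S τ e cp = ℕ.<-irrefl refl (subst (_≤ n) e (Free.convex-bound free τ cp))

    row-saturated : suc a ≡ n → 2 ≤ n → NGonSaturated (suc n) points
    row-saturated refl 2≤n = row-general , row-free , λ q q∉ gp → extend q gp (generic-direction sorted q∉ gp)
      where
      extend : ∀ q → GeneralPosition (q ∷ points) → ∃[ v ] (Sorts v points × Generic v q points) →
        ∃[ S ] (S ⊆ q ∷ points × length S ≡ suc n × q ∈ S × ConvexPosition S)
      extend q (u , _) (v , s , g) = ngon-convex (s≤s 2≤n) u (Sum.[ (λ x → x) , cup→ngon ]′ (claim v q s g))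
        where
        cup→ngon : Chain Left v q points n → NGon (suc n) q points
        cup→ngon (chain {l} {r} ml mr e _ t) = ngon (∈-++⁺ʳ l (here refl))
          (All.++⁺ (All.map there ml) (here refl ∷ All.map there mr))
          (trans (length-++ l) (trans (ℕ.+-suc (length l) (length r)) (cong suc e))) t

open Saturation

open import Data.Nat using (ℕ; _≤_; _*_; _^_; _∸_)
open import Data.Nat as ℕ using (suc; z≤n; s≤s; _+_)
import Data.Nat.Properties as ℕ

theorem3 : ∀ (n : ℕ) → 7 ≤ n →
    (∃[ P ] (NGonSaturated n P × 8 * length P ≤ 7 * 2 ^ (n ∸ 2)))
    × (∃[ P ] (GeneralPosition P × NGonFree n P × 2 ^ (n ∸ 2) ≤ length P))
theorem3 (suc (suc (suc (suc (suc (suc (suc N))))))) (s≤s (s≤s (s≤s (s≤s (s≤s (s≤s (s≤s z≤n))))))) =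
  (Row.points R₁ , row-saturated R₁ refl (s≤s (s≤s z≤n)) ,
    subst (λ m → 8 * m ≤ 7 * 2 ^ (5 + N)) (sym (Row.size R₁)) (small-size N)) ,
  (Row.points R₂ , row-general R₂ , row-free R₂ ,
    ℕ.≤-reflexive (sym (trans (Row.size R₂) (full-size (4 + N)))))
  where
  -- For `n = 7 + N` the convex subsets have at most `n - 1` points, and the indices `n - 2` and `0`
  -- mark the end of the row. `e` selects the row with the small blocks or the full one.
  at : ∀ e → Row (6 + N) (5 + N) (row-size e (5 + N) 0)
  at e = subst (λ m → Row m (5 + N) (row-size e (5 + N) 0)) (cong (6 +_) (ℕ.+-identityʳ N)) (row e (5 + N) 0)
  R₁ = at true
  R₂ = at false
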